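{- Let $\kappa$ be an inaccessible cardinal, let ${}^*\mathbb{Q}$ be a saturated model of $\operatorname{Th}(\mathbb{Q})$ (in the ring language) of cardinality $\kappa$, and let ${}^*\mathbb{Z}$ be the nonstandard integer ring of ${}^*\mathbb{Q}$. Then every abelian group $(A,+_A,1_A)$ definable (with parameters) in ${}^*\mathbb{Q}$ admits a ${}^*\mathbb{Z}$-module structure $\cdot^*:{}^*\mathbb{Z}\times A\to A$ extending its natural $\mathbb{Z}$-module structure, i.e. $n\cdot^*a=n\cdot a$ for all $n\in\mathbb{Z}$, $a\in A$. In particular, for every nonsingular elliptic curve $E$ over ${}^*\mathbb{Q}$, $E({}^*\mathbb{Q})$ has such a ${}^*\mathbb{Z}$-module structure.
   Context: ${}^*\mathbb{Z}=Z({}^*\mathbb{Q})$ for a fixed ring-language formula $Z(x)$ defining $\mathbb{Z}$ in $\mathbb{Q}$; $\mathbb{Z}\subseteq{}^*\mathbb{Z}$ via the elementary embedding. The natural $\mathbb{Z}$-module structure on an abelian group $A$ is $n\cdot a=a+_A\cdots+_Aa$ ($n$ times) for $n>0$, $0\cdot a=1_A$ (the identity), and $n\cdot a=(-a)+_A\cdots+_A(-a)$ ($|n|$ times) for $n<0$. A nonsingular elliptic curve over a field $L$ is $y^2=x^3+Ax+B$, $A,B\in L$, $4A^3+27B^2\ne0$, and $E(L)$ (its points with the point at infinity) is a definable abelian group. -}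

module Defs where

open import Algebra.Bundles using (AbelianGroup; CommutativeRing)
open import Algebra.Structures using (IsAbelianGroup)
open import Algebra.Module.Structures using (IsLeftModule)
import Algebra.Definitions.RawMonoid as RawMonoidDefs
open import Data.Bool.Base using (Bool)
open import Data.Empty.Polymorphic using (⊥)
open import Data.Fin.Base using (Fin; zero; suc)
open import Data.Integer.Base as ℤ using (ℤ; +_; -[1+_])
open import Data.List.Base using (List)
open import Data.List.Relation.Unary.All using (All)
open import Data.Maybe.Base using (Maybe; just; nothing)
open import Data.Nat.Base as ℕ using (ℕ; zero; suc)
open import Data.Product using (Σ; ∃; ∃-syntax; _×_; _,_; proj₁; proj₂)
open import Data.Rational.Base as ℚ using (ℚ; mkℚ; _/_; ↥_; ↧_; ↧ₙ_)
import Data.Rational.Properties as ℚ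
open import Data.Rational.Unnormalised.Base as ℚᵘ using (mkℚᵘ; *≡*)
import Data.Rational.Unnormalised.Properties as ℚᵘ
open import Data.Integer.Tactic.RingSolver using (solve-∀)
open import Data.Sum.Base using (_⊎_; inj₁; inj₂)
open import Data.Vec.Base using (Vec; []; _∷_; _++_; lookup; map)
open import Function.Bundles using (_↣_; _⇔_; mk⇔; module Equivalence)
open import Level using (Level; 0ℓ) renaming (suc to lsuc; _⊔_ to _⊔ˡ_)
open import Relation.Binary.PropositionalEquality
open import Relation.Nullary using (¬_)
open import Relation.Unary using (Pred)

private variable
  ℓ g h : Level
  k m n : ℕ

infixl 6 _+′_
infixl 7 _*′_
infix  8 -′_
infix  5 _≐_
infixr 4 _∧′_
infixr 3 _∨′_
infixr 2 _⇒′_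

data Term (n : ℕ) : Set where
  var       : Fin n → Term n
  0′ 1′     : Term n
  _+′_ _*′_ : Term n → Term n → Term n
  -′_       : Term n → Term n

-- Formula n has its free variables among n de Bruijn indices; a quantifier
-- binds index zero.
data Formula : ℕ → Set where
  _≐_            : Term n → Term n → Formula n
  ⊥′             : Formula n
  _∧′_ _∨′_ _⇒′_ : Formula n → Formula n → Formula n
  ∀′ ∃′          : Formula (suc n) → Formula n

Sentence : Set
Sentence = Formula 0

record Structure (ℓ : Level) : Set (lsuc ℓ) where
  infixl 6 _+_
  infixl 7 _*_
  infix  8 -_
  field
    Carrier : Set ℓ
    0# 1#   : Carrier
    _+_ _*_ : Carrier → Carrier → Carrier
    -_      : Carrier → Carrier

∣_∣ : Structure ℓ → Set ℓ
∣ M ∣ = Structure.Carrier M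

eval : (M : Structure ℓ) → Vec ∣ M ∣ n → Term n → ∣ M ∣
eval M ρ (var i)  = lookup ρ i
eval M ρ 0′       = Structure.0# M
eval M ρ 1′       = Structure.1# M
eval M ρ (s +′ t) = Structure._+_ M (eval M ρ s) (eval M ρ t)
eval M ρ (s *′ t) = Structure._*_ M (eval M ρ s) (eval M ρ t)
eval M ρ (-′ t)   = Structure.-_ M (eval M ρ t)

infix 1 _⊨_[_]

_⊨_[_] : (M : Structure ℓ) → Formula n → Vec ∣ M ∣ n → Set ℓ
M ⊨ s ≐ t  [ ρ ] = eval M ρ s ≡ eval M ρ t
M ⊨ ⊥′     [ ρ ] = ⊥
M ⊨ φ ∧′ ψ [ ρ ] = (M ⊨ φ [ ρ ]) × (M ⊨ ψ [ ρ ])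
M ⊨ φ ∨′ ψ [ ρ ] = (M ⊨ φ [ ρ ]) ⊎ (M ⊨ ψ [ ρ ])
M ⊨ φ ⇒′ ψ [ ρ ] = (M ⊨ φ [ ρ ]) → (M ⊨ ψ [ ρ ])
M ⊨ ∀′ φ   [ ρ ] = ∀ x → M ⊨ φ [ x ∷ ρ ]
M ⊨ ∃′ φ   [ ρ ] = ∃[ x ] (M ⊨ φ [ x ∷ ρ ])

𝓠 : Structure 0ℓ
𝓠 = record
  { Carrier = ℚ ; 0# = ℚ.0ℚ ; 1# = ℚ.1ℚ
  ; _+_ = ℚ._+_ ; _*_ = ℚ._*_ ; -_ = ℚ.-_ }

-- The converse implication comes classically from the sentences σ ⇒′ ⊥′.
_⊨Thℚ : Structure ℓ → Set ℓ
M ⊨Thℚ = (σ : Sentence) → 𝓠 ⊨ σ [ [] ] → M ⊨ σ [ [] ]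

Definesℤ : Formula 1 → Set
Definesℤ Z = ∀ q → (𝓠 ⊨ Z [ q ∷ [] ]) ⇔ (∃[ i ] q ≡ i / 1)

-- Cardinals are represented by types, compared through injections.
infix 4 _≺_

_≺_ : Set g → Set h → Set (g ⊔ˡ h)
X ≺ Y = (X ↣ Y) × ¬ (Y ↣ X)

-- Restricting to X, I, F i in the same universe as κ loses nothing: whatever
-- is smaller than κ is equipotent with a subset of κ.
record Inaccessible (κ : Set ℓ) : Set (lsuc ℓ) where
  field
    uncountable : ℕ ≺ κ
    strongLimit : (X : Set ℓ) → X ≺ κ → (X → Bool) ≺ κ
    regular     : (I : Set ℓ) (F : I → Set ℓ) →
                  I ≺ κ → (∀ i → F i ≺ κ) → Σ I F ≺ κ

-- Index zero is the free variable; the others are parameters named by I.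
ParamFormula : Set ℓ → Set ℓ
ParamFormula I = ∃[ n ] (Formula (suc n) × Vec I n)

module _ (M : Structure ℓ) where

  holds : {I : Set ℓ} → (I → ∣ M ∣) → ∣ M ∣ → ParamFormula I → Set ℓ
  holds c x (n , φ , is) = M ⊨ φ [ x ∷ map c is ]

  -- The parameter set is the range of c; every set Γ of formulas over it that
  -- is finitely satisfiable in M is realised in M.
  Saturated : Set (lsuc ℓ)
  Saturated =
    (I : Set ℓ) → I ≺ ∣ M ∣ → (c : I → ∣ M ∣) (Γ : Pred (ParamFormula I) ℓ) →
    (∀ (Δ : List (ParamFormula I)) → All Γ Δ → ∃[ x ] All (holds c x) Δ) →
    ∃[ x ] (∀ ψ → Γ ψ → holds c x ψ)

module _ (M : Structure ℓ) where

  Definable : Pred (Vec ∣ M ∣ k) ℓ → Set ℓ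
  Definable {k} P =
    ∃[ m ] Σ (Formula (k ℕ.+ m)) λ φ → Σ (Vec ∣ M ∣ m) λ c →
    ∀ x → P x ⇔ (M ⊨ φ [ x ++ c ])

  -- Elements are tuples together with a membership proof; two of them are
  -- identified when the tuples agree.
  record DefinableAbelianGroup : Set (lsuc ℓ) where
    infixl 6 _+ᴬ_
    field
      arity : ℕ
      Dom   : Pred (Vec ∣ M ∣ arity) ℓ

    Element : Set ℓ
    Element = Σ (Vec ∣ M ∣ arity) Dom

    _≈ᴬ_ : Element → Element → Set ℓ
    a ≈ᴬ b = proj₁ a ≡ proj₁ b

    field
      _+ᴬ_           : Element → Element → Element
      1ᴬ             : Element
      -ᴬ_            : Element → Element
      isAbelianGroup : IsAbelianGroup _≈ᴬ_ _+ᴬ_ 1ᴬ -ᴬ_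

    Graph : Pred (Vec ∣ M ∣ (arity ℕ.+ (arity ℕ.+ arity))) ℓ
    Graph v = ∃[ a ] ∃[ b ] v ≡ proj₁ a ++ (proj₁ b ++ proj₁ (a +ᴬ b))

    field
      dom-definable   : Definable Dom
      graph-definable : Definable Graph

    abelianGroup : AbelianGroup ℓ ℓ
    abelianGroup = record { isAbelianGroup = isAbelianGroup }

module _ (M : Structure ℓ) where
  open Structure M

  fromℕ : ℕ → ∣ M ∣
  fromℕ zero    = 0#
  fromℕ (suc n) = 1# + fromℕ n

  Nonsingular : (A B : ∣ M ∣) → Set ℓ
  Nonsingular A B = ¬ (fromℕ 4 * (A * A * A) + fromℕ 27 * (B * B) ≡ 0#)

  module _ (A B : ∣ M ∣) where

    data Point : Set ℓ where
      O      : Point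
      affine : ∀ x y → y * y ≡ x * x * x + A * x + B → Point

    coords : Point → Maybe (∣ M ∣ × ∣ M ∣)
    coords O              = nothing
    coords (affine x y _) = just (x , y)

    _≈ᴾ_ : Point → Point → Set ℓ
    P ≈ᴾ Q = coords P ≡ coords Q

    -- ChordTangent P Q R: R is the sum of P and Q by the chord–tangent law;
    -- s is the slope of the chord or tangent.
    data ChordTangent : Point → Point → Point → Set ℓ where
      identityˡ : ∀ {Q R} → Q ≈ᴾ R → ChordTangent O Q R
      identityʳ : ∀ {P R} → P ≈ᴾ R → ChordTangent P O R
      opposite  : ∀ {x₁ y₁ x₂ y₂ e₁ e₂} → x₁ ≡ x₂ → y₁ ≡ - y₂ →
                  ChordTangent (affine x₁ y₁ e₁) (affine x₂ y₂ e₂) O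
      chord     : ∀ {x₁ y₁ x₂ y₂ x₃ y₃ e₁ e₂ e₃} s → ¬ (x₁ ≡ x₂) →
                  s * (x₂ + - x₁) ≡ y₂ + - y₁ →
                  x₃ ≡ s * s + - x₁ + - x₂ → y₃ ≡ s * (x₁ + - x₃) + - y₁ →
                  ChordTangent (affine x₁ y₁ e₁) (affine x₂ y₂ e₂) (affine x₃ y₃ e₃)
      tangent   : ∀ {x₁ y₁ x₂ y₂ x₃ y₃ e₁ e₂ e₃} s → x₁ ≡ x₂ → y₁ ≡ y₂ →
                  ¬ (y₁ ≡ - y₂) →
                  s * (fromℕ 2 * y₁) ≡ fromℕ 3 * (x₁ * x₁) + A →
                  x₃ ≡ s * s + - x₁ + - x₂ → y₃ ≡ s * (x₁ + - x₃) + - y₁ →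
                  ChordTangent (affine x₁ y₁ e₁) (affine x₂ y₂ e₂) (affine x₃ y₃ e₃)

    record EllipticGroup : Set ℓ where
      infixl 6 _⊕_
      field
        _⊕_            : Point → Point → Point
        ⊖_             : Point → Point
        isAbelianGroup : IsAbelianGroup _≈ᴾ_ _⊕_ O ⊖_
        chordTangent   : ∀ P Q → ChordTangent P Q (P ⊕ Q)

      abelianGroup : AbelianGroup ℓ ℓ
      abelianGroup = record { isAbelianGroup = isAbelianGroup }

renT : (Fin m → Fin n) → Term m → Term n
renT r (var i)  = var (r i)
renT r 0′       = 0′
renT r 1′       = 1′
renT r (s +′ t) = renT r s +′ renT r t
renT r (s *′ t) = renT r s *′ renT r t
renT r (-′ t)   = -′ renT r t

lift : (Fin m → Fin n) → Fin (suc m) → Fin (suc n)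
lift r zero    = zero
lift r (suc i) = suc (r i)

ren : (Fin m → Fin n) → Formula m → Formula n
ren r (s ≐ t)  = renT r s ≐ renT r t
ren r ⊥′       = ⊥′
ren r (φ ∧′ ψ) = ren r φ ∧′ ren r ψ
ren r (φ ∨′ ψ) = ren r φ ∨′ ren r ψ
ren r (φ ⇒′ ψ) = ren r φ ⇒′ ren r ψ
ren r (∀′ φ)   = ∀′ (ren (lift r) φ)
ren r (∃′ φ)   = ∃′ (ren (lift r) φ)

module _ (M : Structure ℓ) where

  Agree : Vec ∣ M ∣ m → (Fin m → Fin n) → Vec ∣ M ∣ n → Set ℓ
  Agree ρ r ρ′ = ∀ i → lookup ρ i ≡ lookup ρ′ (r i)

  agree-lift : ∀ {ρ : Vec ∣ M ∣ m} {r : Fin m → Fin n} {ρ′} x →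
               Agree ρ r ρ′ → Agree (x ∷ ρ) (lift r) (x ∷ ρ′)
  agree-lift x e zero    = refl
  agree-lift x e (suc i) = e i

  eval-ren : ∀ {ρ : Vec ∣ M ∣ m} {r : Fin m → Fin n} {ρ′} → Agree ρ r ρ′ →
             ∀ t → eval M ρ t ≡ eval M ρ′ (renT r t)
  eval-ren e (var i)  = e i
  eval-ren e 0′       = refl
  eval-ren e 1′       = refl
  eval-ren e (s +′ t) = cong₂ (Structure._+_ M) (eval-ren e s) (eval-ren e t)
  eval-ren e (s *′ t) = cong₂ (Structure._*_ M) (eval-ren e s) (eval-ren e t)
  eval-ren e (-′ t)   = cong (Structure.-_ M) (eval-ren e t)

  sat-ren   : ∀ {ρ : Vec ∣ M ∣ m} {r : Fin m → Fin n} {ρ′} → Agree ρ r ρ′ →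
              ∀ φ → M ⊨ φ [ ρ ] → M ⊨ ren r φ [ ρ′ ]
  sat-ren⁻¹ : ∀ {ρ : Vec ∣ M ∣ m} {r : Fin m → Fin n} {ρ′} → Agree ρ r ρ′ →
              ∀ φ → M ⊨ ren r φ [ ρ′ ] → M ⊨ φ [ ρ ]

  sat-ren e (s ≐ t)  p        = trans (sym (eval-ren e s)) (trans p (eval-ren e t))
  sat-ren e (φ ∧′ ψ) (p , q)  = sat-ren e φ p , sat-ren e ψ q
  sat-ren e (φ ∨′ ψ) (inj₁ p) = inj₁ (sat-ren e φ p)
  sat-ren e (φ ∨′ ψ) (inj₂ q) = inj₂ (sat-ren e ψ q)
  sat-ren e (φ ⇒′ ψ) f        = λ p → sat-ren e ψ (f (sat-ren⁻¹ e φ p))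
  sat-ren e (∀′ φ)   f        = λ x → sat-ren (agree-lift x e) φ (f x)
  sat-ren e (∃′ φ)   (x , p)  = x , sat-ren (agree-lift x e) φ p

  sat-ren⁻¹ e (s ≐ t)  p        = trans (eval-ren e s) (trans p (sym (eval-ren e t)))
  sat-ren⁻¹ e (φ ∧′ ψ) (p , q)  = sat-ren⁻¹ e φ p , sat-ren⁻¹ e ψ q
  sat-ren⁻¹ e (φ ∨′ ψ) (inj₁ p) = inj₁ (sat-ren⁻¹ e φ p)
  sat-ren⁻¹ e (φ ∨′ ψ) (inj₂ q) = inj₂ (sat-ren⁻¹ e ψ q)
  sat-ren⁻¹ e (φ ⇒′ ψ) f        = λ p → sat-ren⁻¹ e ψ (f (sat-ren e φ p))
  sat-ren⁻¹ e (∀′ φ)   f        = λ x → sat-ren⁻¹ (agree-lift x e) φ (f x)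
  sat-ren⁻¹ e (∃′ φ)   (x , p)  = x , sat-ren⁻¹ (agree-lift x e) φ p

  at : Formula 1 → Fin n → Formula n
  at Z i = ren (λ _ → i) Z

  sat-at : ∀ Z (ρ : Vec ∣ M ∣ n) i →
           (M ⊨ Z [ lookup ρ i ∷ [] ]) ⇔ (M ⊨ at Z i [ ρ ])
  sat-at Z ρ i = mk⇔ (sat-ren agree Z) (sat-ren⁻¹ agree Z)
    where
    agree : Agree (lookup ρ i ∷ []) (λ _ → i) ρ
    agree zero = refl

numeral : ℕ → Term n
numeral zero    = 0′
numeral (suc j) = 1′ +′ numeral j

integer : ℤ → Term n
integer (+ j)      = numeral j
integer (-[1+ j ]) = -′ numeral (suc j)

-- The formula "den(q) · x = num(q)", x being index zero.
isRational : ℚ → Formula (suc n)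
isRational q = numeral (↧ₙ q) *′ var zero ≐ integer (↥ q)

private
  toℚᵘ-/1 : ∀ i → ℚ.toℚᵘ (i / 1) ℚᵘ.≃ mkℚᵘ i 0
  toℚᵘ-/1 i = ℚ.toℚᵘ-fromℚᵘ (mkℚᵘ i 0)

+-/1 : ∀ i j → (i / 1) ℚ.+ (j / 1) ≡ (i ℤ.+ j) / 1
+-/1 i j = ℚ.toℚᵘ-injective (ℚᵘ.≃-trans (ℚ.toℚᵘ-homo-+ (i / 1) (j / 1))
  (ℚᵘ.≃-trans (ℚᵘ.+-cong (toℚᵘ-/1 i) (toℚᵘ-/1 j))
  (ℚᵘ.≃-trans (*≡* (eq i j)) (ℚᵘ.≃-sym (toℚᵘ-/1 (i ℤ.+ j))))))
  where
  eq : ∀ i j → (i ℤ.* + 1 ℤ.+ j ℤ.* + 1) ℤ.* + 1 ≡ (i ℤ.+ j) ℤ.* + 1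
  eq = solve-∀

*-/1 : ∀ i j → (i / 1) ℚ.* (j / 1) ≡ (i ℤ.* j) / 1
*-/1 i j = ℚ.toℚᵘ-injective (ℚᵘ.≃-trans (ℚ.toℚᵘ-homo-* (i / 1) (j / 1))
  (ℚᵘ.≃-trans (ℚᵘ.*-cong (toℚᵘ-/1 i) (toℚᵘ-/1 j))
  (ℚᵘ.≃-sym (toℚᵘ-/1 (i ℤ.* j)))))

neg-/1 : ∀ i → ℚ.- (i / 1) ≡ (ℤ.- i) / 1
neg-/1 i = ℚ.toℚᵘ-injective (ℚᵘ.≃-trans (ℚ.toℚᵘ-homo‿- (i / 1))
  (ℚᵘ.≃-trans (ℚᵘ.-‿cong (toℚᵘ-/1 i)) (ℚᵘ.≃-sym (toℚᵘ-/1 (ℤ.- i)))))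

eval-numeral : ∀ (ρ : Vec ℚ n) j → eval 𝓠 ρ (numeral j) ≡ + j / 1
eval-numeral ρ zero    = refl
eval-numeral ρ (suc j) =
  trans (cong (ℚ.1ℚ ℚ.+_) (eval-numeral ρ j)) (+-/1 (+ 1) (+ j))

eval-integer : ∀ (ρ : Vec ℚ n) i → eval 𝓠 ρ (integer i) ≡ i / 1
eval-integer ρ (+ j)      = eval-numeral ρ j
eval-integer ρ (-[1+ j ]) =
  trans (cong ℚ.-_ (eval-numeral ρ (suc j))) (neg-/1 (+ suc j))

denominator-* : ∀ q → ((↧ q) / 1) ℚ.* q ≡ (↥ q) / 1
denominator-* q@(mkℚ u d-1 _) = ℚ.toℚᵘ-injective
  (ℚᵘ.≃-trans (ℚ.toℚᵘ-homo-* ((↧ q) / 1) q)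
  (ℚᵘ.≃-trans (ℚᵘ.*-cong (toℚᵘ-/1 (↧ q)) (ℚᵘ.≃-refl {ℚ.toℚᵘ q}))
  (ℚᵘ.≃-trans cancel (ℚᵘ.≃-sym (toℚᵘ-/1 u)))))
  where
  eq : ∀ d u → (d ℤ.* u) ℤ.* + 1 ≡ u ℤ.* (+ 1 ℤ.* d)
  eq = solve-∀

  cancel : mkℚᵘ (+ suc d-1) 0 ℚᵘ.* mkℚᵘ u d-1 ℚᵘ.≃ mkℚᵘ u 0
  cancel = *≡* (eq (+ suc d-1) u)

isRational-sound : ∀ q (ρ : Vec ℚ n) → 𝓠 ⊨ isRational q [ q ∷ ρ ]
isRational-sound q ρ =
  trans (cong (ℚ._* q) (eval-numeral (q ∷ ρ) (↧ₙ q)))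
  (trans (denominator-* q) (sym (eval-integer (q ∷ ρ) (↥ q))))

isRational-unique : ∀ q x (ρ : Vec ℚ n) → 𝓠 ⊨ isRational q [ x ∷ ρ ] → x ≡ q
isRational-unique q x ρ e =
  ℚ.≤-antisym (cancel (ℚ.≤-reflexive d*x≡d*q)) (cancel (ℚ.≤-reflexive (sym d*x≡d*q)))
  where
  d = (↧ q) / 1

  instance
    d-pos : ℚ.Positive d
    d-pos = ℚ.normalize-pos (↧ₙ q) 1

  cancel : ∀ {y z} → d ℚ.* y ℚ.≤ d ℚ.* z → y ℚ.≤ z
  cancel = ℚ.*-cancelˡ-≤-pos d

  d*x≡d*q : d ℚ.* x ≡ d ℚ.* q
  d*x≡d*q =
    trans (cong (ℚ._* x) (sym (eval-numeral (x ∷ ρ) (↧ₙ q))))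
    (trans e (trans (eval-integer (x ∷ ρ) (↥ q)) (sym (denominator-* q))))

module _ (M : Structure ℓ) (th : M ⊨Thℚ) where

  private
    witness : ∀ q → M ⊨ ∃′ (isRational q) [ [] ]
    witness q = th (∃′ (isRational q)) (q , isRational-sound q [])

  embed : ℚ → ∣ M ∣
  embed q = proj₁ (witness q)

  private
    eval-numeral-closed : ∀ (ρ : Vec ∣ M ∣ m) (ρ′ : Vec ∣ M ∣ n) j →
                          eval M ρ (numeral j) ≡ eval M ρ′ (numeral j)
    eval-numeral-closed ρ ρ′ zero    = refl
    eval-numeral-closed ρ ρ′ (suc j) =
      cong (Structure._+_ M (Structure.1# M)) (eval-numeral-closed ρ ρ′ j)

    eval-integer-closed : ∀ (ρ : Vec ∣ M ∣ m) (ρ′ : Vec ∣ M ∣ n) i →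
                          eval M ρ (integer i) ≡ eval M ρ′ (integer i)
    eval-integer-closed ρ ρ′ (+ j)      = eval-numeral-closed ρ ρ′ j
    eval-integer-closed ρ ρ′ (-[1+ j ]) =
      cong (Structure.-_ M) (eval-numeral-closed ρ ρ′ (suc j))

    embed-isRational : ∀ q (ρ : Vec ∣ M ∣ n) → M ⊨ isRational q [ embed q ∷ ρ ]
    embed-isRational q ρ =
      trans (cong (λ d → Structure._*_ M d (embed q))
                  (eval-numeral-closed (embed q ∷ ρ) (embed q ∷ []) (↧ₙ q)))
      (trans (proj₂ (witness q))
             (eval-integer-closed (embed q ∷ []) (embed q ∷ ρ) (↥ q)))

    close : Vec ℚ n → Formula n → Sentence
    close []      φ = φ
    close (q ∷ ρ) φ = close ρ (∀′ (isRational q ⇒′ φ))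

    close-true : ∀ (ρ : Vec ℚ n) φ → 𝓠 ⊨ φ [ ρ ] → 𝓠 ⊨ close ρ φ [ [] ]
    close-true []      φ p = p
    close-true (q ∷ ρ) φ p = close-true ρ _ λ x e →
      subst (λ y → 𝓠 ⊨ φ [ y ∷ ρ ]) (sym (isRational-unique q x ρ e)) p

    close-apply : ∀ (ρ : Vec ℚ n) φ → M ⊨ close ρ φ [ [] ] → M ⊨ φ [ map embed ρ ]
    close-apply []      φ p = p
    close-apply (q ∷ ρ) φ p =
      close-apply ρ _ p (embed q) (embed-isRational q (map embed ρ))

  -- Classically the converse follows by taking φ ⇒′ ⊥′ for φ, so embed is an
  -- elementary embedding.
  embed-elementary : ∀ (φ : Formula n) (ρ : Vec ℚ n) →
                     𝓠 ⊨ φ [ ρ ] → M ⊨ φ [ map embed ρ ]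
  embed-elementary φ ρ p = close-apply ρ φ (th (close ρ φ) (close-true ρ φ p))

module NonstandardIntegers
  (M : Structure ℓ) (th : M ⊨Thℚ) (Z : Formula 1) (defZ : Definesℤ Z) where

  open Structure M

  *ℤ : Set ℓ
  *ℤ = Σ ∣ M ∣ λ x → M ⊨ Z [ x ∷ [] ]

  embedℤ : ℤ → *ℤ
  embedℤ i = embed M th (i / 1) ,
    embed-elementary M th Z (i / 1 ∷ []) (Equivalence.from (defZ (i / 1)) (i , refl))

  private
    pattern v0 = var zero
    pattern v1 = var (suc zero)
    pattern v2 = var (suc (suc zero))

    i0 i1 : Fin 3
    i0 = zero
    i1 = suc zero

    toZ : ∀ {q} → (∃[ i ] q ≡ i / 1) → 𝓠 ⊨ Z [ q ∷ [] ]
    toZ = Equivalence.from (defZ _)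

    fromZ : ∀ {q} → 𝓠 ⊨ Z [ q ∷ [] ] → ∃[ i ] q ≡ i / 1
    fromZ = Equivalence.to (defZ _)

    closed₂ : (t : Term 3) →
      (∀ x y z → (∃[ i ] x ≡ i / 1) → (∃[ i ] y ≡ i / 1) →
         ∃[ i ] eval 𝓠 (x ∷ y ∷ z ∷ []) t ≡ i / 1) →
      ∀ x y z → M ⊨ Z [ x ∷ [] ] → M ⊨ Z [ y ∷ [] ] →
      z ≡ eval M (x ∷ y ∷ z ∷ []) t → M ⊨ Z [ z ∷ [] ]
    closed₂ t h x y z p q e = Equivalence.from (sat-at M Z (x ∷ y ∷ z ∷ []) i2)
      (th (∀′ (∀′ (∀′ (at 𝓠 Z i0 ⇒′ at 𝓠 Z i1 ⇒′ v2 ≐ t ⇒′ at 𝓠 Z i2))))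
        (λ z y x p q e → let ρ = x ∷ y ∷ z ∷ [] in
          Equivalence.to (sat-at 𝓠 Z ρ i2)
            (subst (λ w → 𝓠 ⊨ Z [ w ∷ [] ]) (sym e)
              (toZ (h x y z (fromZ (Equivalence.from (sat-at 𝓠 Z ρ i0) p))
                            (fromZ (Equivalence.from (sat-at 𝓠 Z ρ i1) q))))))
        z y x
        (Equivalence.to (sat-at M Z (x ∷ y ∷ z ∷ []) i0) p)
        (Equivalence.to (sat-at M Z (x ∷ y ∷ z ∷ []) i1) q)
        e)
      where
      i2 : Fin 3
      i2 = suc (suc zero)

    Z0 : M ⊨ Z [ 0# ∷ [] ]
    Z0 = Equivalence.from (sat-at M Z (0# ∷ []) zero)
      (th (∀′ (v0 ≐ 0′ ⇒′ at 𝓠 Z zero))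
        (λ x e → Equivalence.to (sat-at 𝓠 Z (x ∷ []) zero) (toZ (+ 0 , e)))
        0# refl)

    Z1 : M ⊨ Z [ 1# ∷ [] ]
    Z1 = Equivalence.from (sat-at M Z (1# ∷ []) zero)
      (th (∀′ (v0 ≐ 1′ ⇒′ at 𝓠 Z zero))
        (λ x e → Equivalence.to (sat-at 𝓠 Z (x ∷ []) zero) (toZ (+ 1 , e)))
        1# refl)

  _+ℤ_ _*ℤ_ : *ℤ → *ℤ → *ℤ
  (x , p) +ℤ (y , q) = x + y ,
    closed₂ (v0 +′ v1)
      (λ { _ _ _ (i , e) (j , f) → i ℤ.+ j , trans (cong₂ ℚ._+_ e f) (+-/1 i j) })
      x y (x + y) p q refl
  (x , p) *ℤ (y , q) = x * y ,
    closed₂ (v0 *′ v1)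
      (λ { _ _ _ (i , e) (j , f) → i ℤ.* j , trans (cong₂ ℚ._*_ e f) (*-/1 i j) })
      x y (x * y) p q refl

  -ℤ_ : *ℤ → *ℤ
  -ℤ (x , p) = - x ,
    closed₂ (-′ v0)
      (λ { _ _ _ (i , e) _ → ℤ.- i , trans (cong ℚ.-_ e) (neg-/1 i) })
      x x (- x) p p refl

  ring : CommutativeRing ℓ ℓ
  ring = record
    { Carrier = *ℤ
    ; _≈_ = λ a b → proj₁ a ≡ proj₁ b
    ; _+_ = _+ℤ_ ; _*_ = _*ℤ_ ; -_ = -ℤ_
    ; 0# = 0# , Z0 ; 1# = 1# , Z1
    ; isCommutativeRing = record
      { isRing = record
        { +-isAbelianGroup = record
          { isGroup = record
            { isMonoid = record
              { isSemigroup = record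
                { isMagma = record
                  { isEquivalence = record { refl = refl ; sym = sym ; trans = trans }
                  ; ∙-cong = cong₂ _+_ }
                ; assoc = λ a b c →
                    th (∀′ (∀′ (∀′ ((v2 +′ v1) +′ v0 ≐ v2 +′ (v1 +′ v0)))))
                       ℚ.+-assoc (proj₁ a) (proj₁ b) (proj₁ c) }
              ; identity =
                  (λ a → th (∀′ (0′ +′ v0 ≐ v0)) ℚ.+-identityˡ (proj₁ a)) ,
                  (λ a → th (∀′ (v0 +′ 0′ ≐ v0)) ℚ.+-identityʳ (proj₁ a)) }
            ; inverse =
                (λ a → th (∀′ (-′ v0 +′ v0 ≐ 0′)) ℚ.+-inverseˡ (proj₁ a)) ,
                (λ a → th (∀′ (v0 +′ -′ v0 ≐ 0′)) ℚ.+-inverseʳ (proj₁ a))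
            ; ⁻¹-cong = cong -_ }
          ; comm = λ a b →
              th (∀′ (∀′ (v1 +′ v0 ≐ v0 +′ v1))) ℚ.+-comm (proj₁ a) (proj₁ b) }
        ; *-cong = cong₂ _*_
        ; *-assoc = λ a b c →
            th (∀′ (∀′ (∀′ ((v2 *′ v1) *′ v0 ≐ v2 *′ (v1 *′ v0)))))
               ℚ.*-assoc (proj₁ a) (proj₁ b) (proj₁ c)
        ; *-identity =
            (λ a → th (∀′ (1′ *′ v0 ≐ v0)) ℚ.*-identityˡ (proj₁ a)) ,
            (λ a → th (∀′ (v0 *′ 1′ ≐ v0)) ℚ.*-identityʳ (proj₁ a))
        ; distrib =
            (λ a b c →
              th (∀′ (∀′ (∀′ (v2 *′ (v1 +′ v0) ≐ v2 *′ v1 +′ v2 *′ v0))))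
                 ℚ.*-distribˡ-+ (proj₁ a) (proj₁ b) (proj₁ c)) ,
            (λ a b c →
              th (∀′ (∀′ (∀′ ((v1 +′ v0) *′ v2 ≐ v1 *′ v2 +′ v0 *′ v2))))
                 ℚ.*-distribʳ-+ (proj₁ a) (proj₁ b) (proj₁ c)) }
      ; *-comm = λ a b →
          th (∀′ (∀′ (v1 *′ v0 ≐ v0 *′ v1))) ℚ.*-comm (proj₁ a) (proj₁ b) } }

  module _ (G : AbelianGroup g h) where
    private module G = AbelianGroup G
    open RawMonoidDefs G.rawMonoid using () renaming (_×_ to _times_)

    natural : ℤ → G.Carrier → G.Carrier
    natural (+ j)      a = j times a
    natural (-[1+ j ]) a = suc j times (a G.⁻¹)

    record ModuleExtension : Set (ℓ ⊔ˡ g ⊔ˡ h) where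
      field
        _·*_         : *ℤ → G.Carrier → G.Carrier
        isLeftModule : IsLeftModule (CommutativeRing.ring ring)
                         G._≈_ G._∙_ G.ε G._⁻¹ _·*_
        extends      : ∀ i a → embedℤ i ·* a G.≈ natural i a

{-# OPTIONS --safe #-}

-- Definable groups.  In ℚ the multiple n a by an integer n is first-order
-- definable, uniformly in the parameters defining the group: b = n a iff (n , b)
-- lies in every coded finite set that contains (0 , e) and is closed under
-- (i , x) ↦ (i ± 1 , x ± a) as long as i ≠ ± n.  Quantifying over all coded sets,
-- with the two-sided step, makes an order on ℤ unnecessary.  A finite subset of ℚᵐ
-- is coded by clearing denominators, bounding the numerators i by 1 + 2 i ∣ μ,
-- packing a tuple into one integer h by Horner's rule and requiring 1 + u h ∣ v;
-- for u divisible by all differences of values h the moduli are comaximal.  That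
-- the definable relation obeys the laws of a module is a sentence true in ℚ,
-- hence in *ℚ.
--
-- Elliptic curves.  Associativity is proved in the class group of the coordinate
-- ring R = F[X,Y]/(Y² − X³ − A X − B).  Send (x , y) to the ideal (X − x , Y − y)
-- and O to R.  If P, Q, S lie on the line ℓ = 0 then
-- (X − x(S)) I(P) I(Q) = ℓ I(− S), and I(P) I(− P) = (X − x(P)) by nonsingularity,
-- so addition becomes multiplication of classes.  I(P) is never principal, because
-- no element of R has a simple pole at infinity; hence the map to classes is
-- injective.

module Submission where

open import Algebra.Bundles using (AbelianGroup; CommutativeRing)
open import Algebra.Structures using (IsCommutativeRing)
import Algebra.Properties.AbelianGroup as AbelianGroupProperties
import Algebra.Properties.CommutativeMonoid.Mult as Mult
import Algebra.Properties.Group as GroupProperties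
import Algebra.Properties.Ring as RingProperties
import Algebra.Properties.Semiring.Mult as SemiringMult
import Algebra.Solver.Ring
open import Algebra.Solver.Ring.AlmostCommutativeRing
  using (fromCommutativeRing; _-Raw-AlmostCommutative⟶_)
open import Data.Empty using (⊥-elim)
open import Data.Fin.Base using (Fin; zero; suc; _↑ˡ_; _↑ʳ_)
open import Data.Fin.Patterns using (0F; 1F; 2F; 3F; 4F; 5F; 6F; 7F; 8F; 9F)
open import Data.Integer.Base as ℤ using (ℤ; +_; -[1+_]; _⊖_; 0ℤ; 1ℤ) renaming (∣_∣ to ∣_∣ᶻ)
open import Data.Integer.Divisibility.Signed as ℤ∣ using (divides) renaming (_∣_ to _∣ℤ_)
import Data.Integer.Properties as ℤ
open import Data.Integer.Tactic.RingSolver using (solve-∀)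
open import Data.List.Base as List using (List; []; _∷_; upTo)
import Data.List.Membership.DecPropositional as DecMembership
open import Data.List.Membership.Propositional using (_∈_)
open import Data.List.Membership.Propositional.Properties
  using (∈-map⁺; ∈-map⁻; ∈-++⁺ˡ; ∈-++⁺ʳ; ∈-++⁻; ∈-upTo⁺; ∈-upTo⁻)
import Data.List.Relation.Unary.All as ListAll
open ListAll using ([]; _∷_)
open import Data.List.Relation.Unary.Any using (here; there)
open import Data.Maybe.Base using (Maybe; just; nothing)
open import Data.Nat.Base as ℕ using (ℕ; zero; suc; _≤_; _<_; s≤s; z≤n; NonZero; _!)
import Data.Nat.Divisibility as ℕ∣
import Data.Nat.ListAction as ListAction
import Data.Nat.Properties as ℕ
open import Data.Product using (Σ; ∃; ∃-syntax; _×_; _,_; proj₁; proj₂)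
open import Data.Rational.Base as ℚ using (ℚ; _/_; ↥_; ↧_; ↧ₙ_)
import Data.Rational.Properties as ℚ
open import Data.Rational.Unnormalised.Base using (mkℚᵘ; *≡*)
import Data.Rational.Unnormalised.Properties as ℚᵘ
open import Data.Sum.Base as Sum using (_⊎_; inj₁; inj₂)
open import Data.Unit.Polymorphic.Base using (⊤; tt)
open import Data.Vec.Base as Vec using (Vec; []; _∷_; _++_; lookup; allFin; tabulate)
open import Data.Vec.Properties
  using (lookup-map; map-++; map-∘; map-cong; lookup-++ˡ; lookup-++ʳ; map-lookup-allFin;
         ∷-injective; ++-injective; ≡-dec; tabulate-∘; tabulate-cong; tabulate∘lookup)
open import Data.Vec.Relation.Binary.Pointwise.Inductive as Pointwise using (Pointwise; []; _∷_)
open import Data.Vec.Relation.Unary.All as All using (All; []; _∷_)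
open import Function.Bundles using (_⇔_; _↔_; mk⇔; module Equivalence)
open import Level using (Level; _⊔_; lower) renaming (suc to lsuc)
open import Relation.Binary.Definitions using (tri<; tri≈; tri>)
open import Relation.Binary.PropositionalEquality as ≡ using (_≡_; _≢_)
open import Relation.Nullary using (¬_; Dec; yes; no)
open import Relation.Unary using (Pred)

-- Integer multiples in abelian groups, and a ring solver with integer coefficients

-- Transfer moves sentences only, and the parameters of a group definable in `*ℚ` have no
-- counterpart in ℚ. So what is proved in ℚ speaks of all parameters c and all e for which the
-- formula defines a group with identity e. One formula for n a must serve all of them, and finite
-- sets must be coded by a fixed number of rationals, here five. Nothing has to be known about what
-- arbitrary parameters code, only that every finite set has a code: a pair (n , b) that passes the
-- test is caught by a single set, that of all (j , j a) with |j| ≤ |n|. The exception at ± n is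
-- what allows this finite set to be closed. The logic is constructive, while the chord-tangent law
-- branches on equality of coordinates and degrees on the vanishing of coefficients. Decidability of
-- equality is itself transferred: "x = y or not x = y" is true in ℚ for all x and y, and its
-- satisfaction in `*ℚ` is a decision. Associativity computed from coordinates would split into many
-- cases of equal and opposite points; multiplication of ideals is associative without any case
-- distinction.

module IntegerMultiples {c ℓ} (G : AbelianGroup c ℓ) where
  open AbelianGroup G
  open Mult commutativeMonoid using (×-homo-+; ×-congʳ; ×-homo-1; ×-assocˡ; ×-distrib-+)
    renaming (_×_ to infixr 8 _×′_)
  open GroupProperties group using (ε⁻¹≈ε; ⁻¹-involutive; inverseˡ-unique)
  open AbelianGroupProperties G using (⁻¹-∙-comm)
  open import Relation.Binary.Reasoning.Setoid setoid

  infixr 7.5 _⋆_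
  _⋆_ : ℤ → Carrier → Carrier
  + n      ⋆ a = n ×′ a
  -[1+ n ] ⋆ a = (suc n ×′ a) ⁻¹

  ⋆-1 : ∀ a → + 1 ⋆ a ≈ a
  ⋆-1 = ×-homo-1

  ⋆-cong : ∀ i {a b} → a ≈ b → i ⋆ a ≈ i ⋆ b
  ⋆-cong (+ n)    e = ×-congʳ n e
  ⋆-cong -[1+ n ] e = ⁻¹-cong (×-congʳ (suc n) e)

  ⋆-neg : ∀ i a → (ℤ.- i) ⋆ a ≈ (i ⋆ a) ⁻¹
  ⋆-neg (+ zero)  a = sym ε⁻¹≈ε
  ⋆-neg (+ suc n) a = refl
  ⋆-neg -[1+ n ]  a = sym (⁻¹-involutive _)

  ⋆-⊖ : ∀ m n a → (m ⊖ n) ⋆ a ≈ m ×′ a ∙ (n ×′ a) ⁻¹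
  ⋆-⊖ m       zero    a = sym (trans (∙-congˡ ε⁻¹≈ε) (identityʳ _))
  ⋆-⊖ zero    (suc n) a = sym (identityˡ _)
  ⋆-⊖ (suc m) (suc n) a = begin
    (suc m ⊖ suc n) ⋆ a            ≡⟨ ≡.cong (_⋆ a) (ℤ.[1+m]⊖[1+n]≡m⊖n m n) ⟩
    (m ⊖ n) ⋆ a                    ≈⟨ ⋆-⊖ m n a ⟩
    x ∙ y ⁻¹                       ≈⟨ ∙-congʳ (identityʳ x) ⟨
    x ∙ ε ∙ y ⁻¹                   ≈⟨ ∙-congʳ (∙-congˡ (inverseʳ a)) ⟨
    x ∙ (a ∙ a ⁻¹) ∙ y ⁻¹          ≈⟨ ∙-congʳ (assoc _ _ _) ⟨
    x ∙ a ∙ a ⁻¹ ∙ y ⁻¹            ≈⟨ assoc _ _ _ ⟩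
    x ∙ a ∙ (a ⁻¹ ∙ y ⁻¹)          ≈⟨ ∙-cong (comm x a) (⁻¹-∙-comm a y) ⟩
    a ∙ x ∙ (a ∙ y) ⁻¹             ∎
    where
    x = m ×′ a
    y = n ×′ a

  ⋆-+ : ∀ i j a → (i ℤ.+ j) ⋆ a ≈ i ⋆ a ∙ j ⋆ a
  ⋆-+ (+ m)    (+ n)    a = ×-homo-+ a m n
  ⋆-+ (+ m)    -[1+ n ] a = ⋆-⊖ m (suc n) a
  ⋆-+ -[1+ m ] (+ n)    a = trans (⋆-⊖ n (suc m) a) (comm _ _)
  ⋆-+ -[1+ m ] -[1+ n ] a = begin
    (suc (suc (m ℕ.+ n)) ×′ a) ⁻¹          ≡⟨ ≡.cong (λ k → (suc k ×′ a) ⁻¹) (ℕ.+-suc m n) ⟨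
    ((suc m ℕ.+ suc n) ×′ a) ⁻¹            ≈⟨ ⁻¹-cong (×-homo-+ a (suc m) (suc n)) ⟩
    (suc m ×′ a ∙ suc n ×′ a) ⁻¹            ≈⟨ ⁻¹-∙-comm _ _ ⟨
    (suc m ×′ a) ⁻¹ ∙ (suc n ×′ a) ⁻¹       ∎

  ⋆-distrib : ∀ i a b → i ⋆ (a ∙ b) ≈ i ⋆ a ∙ i ⋆ b
  ⋆-distrib (+ n)    a b = ×-distrib-+ a b n
  ⋆-distrib -[1+ n ] a b = trans (⁻¹-cong (×-distrib-+ a b (suc n))) (sym (⁻¹-∙-comm _ _))

  -- By distributivity x = `i ⋆ ε` satisfies x ∙ x = x; this avoids a case split on the sign of i.
  ⋆-ε : ∀ i → i ⋆ ε ≈ ε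
  ⋆-ε i = begin
    x               ≈⟨ identityʳ x ⟨
    x ∙ ε           ≈⟨ ∙-congˡ (inverseʳ x) ⟨
    x ∙ (x ∙ x ⁻¹)  ≈⟨ assoc _ _ _ ⟨
    x ∙ x ∙ x ⁻¹    ≈⟨ ∙-congʳ (⋆-distrib i ε ε) ⟨
    i ⋆ (ε ∙ ε) ∙ x ⁻¹ ≈⟨ ∙-congʳ (⋆-cong i (identityʳ ε)) ⟩
    x ∙ x ⁻¹        ≈⟨ inverseʳ x ⟩
    ε               ∎
    where x = i ⋆ ε

  ⋆-⁻¹ : ∀ i a → i ⋆ a ⁻¹ ≈ (i ⋆ a) ⁻¹
  ⋆-⁻¹ i a = inverseˡ-unique _ _
    (trans (sym (⋆-distrib i (a ⁻¹) a)) (trans (⋆-cong i (inverseˡ a)) (⋆-ε i)))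

  ⋆-assoc : ∀ i j a → (i ℤ.* j) ⋆ a ≈ i ⋆ (j ⋆ a)
  ⋆-assoc (+ m)    j a = nonnegative m j
    where
    nonnegative : ∀ m j → (+ m ℤ.* j) ⋆ a ≈ + m ⋆ (j ⋆ a)
    nonnegative m (+ n) = trans (reflexive (≡.cong (_⋆ a) (≡.sym (ℤ.pos-* m n)))) (sym (×-assocˡ a m n))
    nonnegative m -[1+ n ] = begin
      (+ m ℤ.* -[1+ n ]) ⋆ a         ≡⟨ ≡.cong (_⋆ a) (ℤ.neg-distribʳ-* (+ m) (+ suc n)) ⟨
      (ℤ.- (+ m ℤ.* + suc n)) ⋆ a    ≈⟨ ⋆-neg (+ m ℤ.* + suc n) a ⟩
      ((+ m ℤ.* + suc n) ⋆ a) ⁻¹     ≈⟨ ⁻¹-cong (nonnegative m (+ suc n)) ⟩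
      (+ m ⋆ (suc n ×′ a)) ⁻¹         ≈⟨ ⋆-⁻¹ (+ m) _ ⟨
      + m ⋆ (suc n ×′ a) ⁻¹           ∎
  ⋆-assoc -[1+ m ] j a = begin
    (-[1+ m ] ℤ.* j) ⋆ a           ≡⟨ ≡.cong (_⋆ a) (ℤ.neg-distribˡ-* (+ suc m) j) ⟨
    (ℤ.- (+ suc m ℤ.* j)) ⋆ a      ≈⟨ ⋆-neg (+ suc m ℤ.* j) a ⟩
    ((+ suc m ℤ.* j) ⋆ a) ⁻¹       ≈⟨ ⁻¹-cong (⋆-assoc (+ suc m) j a) ⟩
    (suc m ×′ (j ⋆ a)) ⁻¹           ∎

-- A solver cancels terms by deciding equality of coefficients, which a general commutative ring
-- does not offer. The integers do, and i ↦ `i ⋆ 1#` maps them into every commutative ring.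
module ℤCoefficientSolver {c ℓ} (R : CommutativeRing c ℓ) where
  open CommutativeRing R
  open SemiringMult semiring using (×-assoc-*; ×-congʳ)
  open RingProperties ring using (-‿distribˡ-*)
  open IntegerMultiples +-abelianGroup

  private
    ⋆-* : ∀ i x → i ⋆ x ≈ i ⋆ 1# * x
    ⋆-* (+ n)    x = sym (trans (×-assoc-* n 1# x) (×-congʳ n (*-identityˡ x)))
    ⋆-* -[1+ n ] x = trans (-‿cong (⋆-* (+ suc n) x)) (-‿distribˡ-* _ x)

    morphism : ℤ.+-*-rawRing -Raw-AlmostCommutative⟶ fromCommutativeRing R
    morphism = record
      { ⟦_⟧ = _⋆ 1#
      ; +-homo = λ i j → ⋆-+ i j 1#
      ; *-homo = λ i j → trans (⋆-assoc i j 1#) (⋆-* i _)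
      ; -‿homo = λ i → ⋆-neg i 1#
      ; 0-homo = refl
      ; 1-homo = ⋆-1 1# }

    coeff≟ : ∀ i j → Maybe (i ⋆ 1# ≈ j ⋆ 1#)
    coeff≟ i j with i ℤ.≟ j
    ... | yes ≡.refl = just refl
    ... | no _       = nothing

  open Algebra.Solver.Ring ℤ.+-*-rawRing (fromCommutativeRing R) morphism coeff≟ public
    using (Polynomial; solve; _:=_; _:+_; _:*_; _:-_; :-_; con)

-- Polynomials

module Polynomial {c ℓ} (F : CommutativeRing c ℓ) where
  open CommutativeRing F
  open ℤCoefficientSolver F
  open import Relation.Binary.Reasoning.Setoid setoid

  Poly : Set c
  Poly = List Carrier

  coeff : Poly → ℕ → Carrier
  coeff []      n       = 0#
  coeff (a ∷ p) zero    = a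
  coeff (a ∷ p) (suc n) = coeff p n

  infix 4 _≋_
  -- Lists are not normalised and may end in zeros, so different lists can stand for the same
  -- polynomial.
  record _≋_ (p q : Poly) : Set ℓ where
    constructor mk
    field at : ∀ n → coeff p n ≈ coeff q n
  open _≋_ public

  infixl 6 _⊞_
  infixl 7 _⊠_ _·_

  _⊞_ : Poly → Poly → Poly
  []      ⊞ q       = q
  (a ∷ p) ⊞ []      = a ∷ p
  (a ∷ p) ⊞ (b ∷ q) = a + b ∷ p ⊞ q

  _·_ : Carrier → Poly → Poly
  a · p = List.map (a *_) p

  ⊟_ : Poly → Poly
  ⊟ p = List.map -_ p

  _⊠_ : Poly → Poly → Poly
  []      ⊠ q = []
  (a ∷ p) ⊠ q = a · q ⊞ (0# ∷ p ⊠ q)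

  coeff-⊞ : ∀ p q n → coeff (p ⊞ q) n ≈ coeff p n + coeff q n
  coeff-⊞ []      q       n       = sym (+-identityˡ _)
  coeff-⊞ (a ∷ p) []      n       = sym (+-identityʳ _)
  coeff-⊞ (a ∷ p) (b ∷ q) zero    = refl
  coeff-⊞ (a ∷ p) (b ∷ q) (suc n) = coeff-⊞ p q n

  coeff-· : ∀ a p n → coeff (a · p) n ≈ a * coeff p n
  coeff-· a []      n       = sym (zeroʳ a)
  coeff-· a (b ∷ p) zero    = refl
  coeff-· a (b ∷ p) (suc n) = coeff-· a p n

  coeff-⊟ : ∀ p n → coeff (⊟ p) n ≈ - coeff p n
  coeff-⊟ []      n       = solve 0 (con ℤ.0ℤ := :- con ℤ.0ℤ) refl
  coeff-⊟ (b ∷ p) zero    = refl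
  coeff-⊟ (b ∷ p) (suc n) = coeff-⊟ p n

  coeff-⊠-0 : ∀ a p q → coeff ((a ∷ p) ⊠ q) 0 ≈ a * coeff q 0
  coeff-⊠-0 a p q = trans (coeff-⊞ (a · q) _ 0) (trans (+-identityʳ _) (coeff-· a q 0))

  coeff-⊠-suc : ∀ a p q n →
    coeff ((a ∷ p) ⊠ q) (suc n) ≈ a * coeff q (suc n) + coeff (p ⊠ q) n
  coeff-⊠-suc a p q n = trans (coeff-⊞ (a · q) _ (suc n)) (+-congʳ (coeff-· a q (suc n)))

  coeff-⊠∷-0 : ∀ p b q → coeff (p ⊠ (b ∷ q)) 0 ≈ coeff p 0 * b
  coeff-⊠∷-0 []      b q = sym (zeroˡ b)
  coeff-⊠∷-0 (a ∷ p) b q = coeff-⊠-0 a p (b ∷ q)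

  -- Multiplication recurses on its first factor; this is the mirror image of `coeff-⊠-suc`, and the
  -- two together give `⊠-comm` by induction.
  coeff-⊠∷-suc : ∀ p b q n →
    coeff (p ⊠ (b ∷ q)) (suc n) ≈ coeff p (suc n) * b + coeff (p ⊠ q) n
  coeff-⊠∷-suc []      b q n = sym (trans (+-identityʳ _) (zeroˡ b))
  coeff-⊠∷-suc (a ∷ p) b q zero = begin
    coeff ((a ∷ p) ⊠ (b ∷ q)) 1              ≈⟨ coeff-⊠-suc a p (b ∷ q) 0 ⟩
    a * coeff q 0 + coeff (p ⊠ (b ∷ q)) 0    ≈⟨ +-comm _ _ ⟩
    coeff (p ⊠ (b ∷ q)) 0 + a * coeff q 0    ≈⟨ +-cong (coeff-⊠∷-0 p b q) (sym (coeff-⊠-0 a p q)) ⟩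
    coeff p 0 * b + coeff ((a ∷ p) ⊠ q) 0    ∎
  coeff-⊠∷-suc (a ∷ p) b q (suc n) = begin
    coeff ((a ∷ p) ⊠ (b ∷ q)) (suc (suc n))              ≈⟨ coeff-⊠-suc a p (b ∷ q) (suc n) ⟩
    a * coeff q (suc n) + coeff (p ⊠ (b ∷ q)) (suc n)    ≈⟨ +-congˡ (coeff-⊠∷-suc p b q n) ⟩
    a * coeff q (suc n) + (coeff p (suc n) * b + coeff (p ⊠ q) n)
      ≈⟨ solve 3 (λ x y z → x :+ (y :+ z) := y :+ (x :+ z)) refl _ _ _ ⟩
    coeff p (suc n) * b + (a * coeff q (suc n) + coeff (p ⊠ q) n)
      ≈⟨ +-congˡ (coeff-⊠-suc a p q n) ⟨
    coeff p (suc n) * b + coeff ((a ∷ p) ⊠ q) (suc n)    ∎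

  ⊠-zeroʳ : ∀ p n → coeff (p ⊠ []) n ≈ 0#
  ⊠-zeroʳ []      n       = refl
  ⊠-zeroʳ (a ∷ p) zero    = refl
  ⊠-zeroʳ (a ∷ p) (suc n) = ⊠-zeroʳ p n

  ⊠-comm : ∀ p q n → coeff (p ⊠ q) n ≈ coeff (q ⊠ p) n
  ⊠-comm []      q n       = sym (⊠-zeroʳ q n)
  ⊠-comm (a ∷ p) q zero    = trans (coeff-⊠-0 a p q) (trans (*-comm _ _) (sym (coeff-⊠∷-0 q a p)))
  ⊠-comm (a ∷ p) q (suc n) = trans (coeff-⊠-suc a p q n)
    (trans (+-cong (*-comm _ _) (⊠-comm p q n)) (sym (coeff-⊠∷-suc q a p n)))

  ⊠-congˡ : ∀ p {q q′} → q ≋ q′ → ∀ n → coeff (p ⊠ q) n ≈ coeff (p ⊠ q′) n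
  ⊠-congˡ []      e n = refl
  ⊠-congˡ (a ∷ p) {q} {q′} e zero =
    trans (coeff-⊠-0 a p q) (trans (*-congˡ (at e 0)) (sym (coeff-⊠-0 a p q′)))
  ⊠-congˡ (a ∷ p) {q} {q′} e (suc n) = trans (coeff-⊠-suc a p q n)
    (trans (+-cong (*-congˡ (at e (suc n))) (⊠-congˡ p e n)) (sym (coeff-⊠-suc a p q′ n)))

  ⊠-distribˡ : ∀ p q r n → coeff (p ⊠ (q ⊞ r)) n ≈ coeff (p ⊠ q) n + coeff (p ⊠ r) n
  ⊠-distribˡ []      q r n = sym (+-identityʳ 0#)
  ⊠-distribˡ (a ∷ p) q r zero = begin
    coeff ((a ∷ p) ⊠ (q ⊞ r)) 0      ≈⟨ coeff-⊠-0 a p (q ⊞ r) ⟩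
    a * coeff (q ⊞ r) 0              ≈⟨ *-congˡ (coeff-⊞ q r 0) ⟩
    a * (coeff q 0 + coeff r 0)      ≈⟨ distribˡ _ _ _ ⟩
    a * coeff q 0 + a * coeff r 0    ≈⟨ +-cong (coeff-⊠-0 a p q) (coeff-⊠-0 a p r) ⟨
    coeff ((a ∷ p) ⊠ q) 0 + coeff ((a ∷ p) ⊠ r) 0 ∎
  ⊠-distribˡ (a ∷ p) q r (suc n) = begin
    coeff ((a ∷ p) ⊠ (q ⊞ r)) (suc n)      ≈⟨ coeff-⊠-suc a p (q ⊞ r) n ⟩
    a * coeff (q ⊞ r) (suc n) + coeff (p ⊠ (q ⊞ r)) n
      ≈⟨ +-cong (*-congˡ (coeff-⊞ q r (suc n))) (⊠-distribˡ p q r n) ⟩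
    a * (coeff q (suc n) + coeff r (suc n)) + (coeff (p ⊠ q) n + coeff (p ⊠ r) n)
      ≈⟨ solve 5 (λ a x y z w → a :* (x :+ y) :+ (z :+ w) := (a :* x :+ z) :+ (a :* y :+ w))
           refl _ _ _ _ _ ⟩
    (a * coeff q (suc n) + coeff (p ⊠ q) n) + (a * coeff r (suc n) + coeff (p ⊠ r) n)
      ≈⟨ +-cong (coeff-⊠-suc a p q n) (coeff-⊠-suc a p r n) ⟨
    coeff ((a ∷ p) ⊠ q) (suc n) + coeff ((a ∷ p) ⊠ r) (suc n) ∎

  ⊠-distribʳ : ∀ r p q n → coeff ((p ⊞ q) ⊠ r) n ≈ coeff (p ⊠ r) n + coeff (q ⊠ r) n
  ⊠-distribʳ r p q n = trans (⊠-comm (p ⊞ q) r n)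
    (trans (⊠-distribˡ r p q n) (+-cong (⊠-comm r p n) (⊠-comm r q n)))

  ·-⊠ : ∀ a p q n → coeff ((a · p) ⊠ q) n ≈ a * coeff (p ⊠ q) n
  ·-⊠ a []      q n    = sym (zeroʳ a)
  ·-⊠ a (b ∷ p) q zero = begin
    coeff ((a * b ∷ a · p) ⊠ q) 0 ≈⟨ coeff-⊠-0 (a * b) (a · p) q ⟩
    a * b * coeff q 0             ≈⟨ *-assoc _ _ _ ⟩
    a * (b * coeff q 0)           ≈⟨ *-congˡ (coeff-⊠-0 b p q) ⟨
    a * coeff ((b ∷ p) ⊠ q) 0     ∎
  ·-⊠ a (b ∷ p) q (suc n) = begin
    coeff ((a * b ∷ a · p) ⊠ q) (suc n)                ≈⟨ coeff-⊠-suc (a * b) (a · p) q n ⟩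
    a * b * coeff q (suc n) + coeff ((a · p) ⊠ q) n    ≈⟨ +-cong (*-assoc _ _ _) (·-⊠ a p q n) ⟩
    a * (b * coeff q (suc n)) + a * coeff (p ⊠ q) n    ≈⟨ distribˡ _ _ _ ⟨
    a * (b * coeff q (suc n) + coeff (p ⊠ q) n)        ≈⟨ *-congˡ (coeff-⊠-suc b p q n) ⟨
    a * coeff ((b ∷ p) ⊠ q) (suc n)                    ∎

  0∷-⊠ : ∀ p q n → coeff ((0# ∷ p) ⊠ q) n ≈ coeff (0# ∷ p ⊠ q) n
  0∷-⊠ p q zero    = trans (coeff-⊠-0 0# p q) (zeroˡ _)
  0∷-⊠ p q (suc n) = trans (coeff-⊠-suc 0# p q n) (trans (+-congʳ (zeroˡ _)) (+-identityˡ _))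

  ⊠-assoc : ∀ p q r n → coeff ((p ⊠ q) ⊠ r) n ≈ coeff (p ⊠ (q ⊠ r)) n
  ⊠-assoc []      q r n = refl
  ⊠-assoc (a ∷ p) q r n = begin
    coeff ((a · q ⊞ (0# ∷ p ⊠ q)) ⊠ r) n                  ≈⟨ ⊠-distribʳ r (a · q) _ n ⟩
    coeff ((a · q) ⊠ r) n + coeff ((0# ∷ p ⊠ q) ⊠ r) n    ≈⟨ +-cong (·-⊠ a q r n) (0∷-⊠ (p ⊠ q) r n) ⟩
    a * coeff (q ⊠ r) n + coeff (0# ∷ (p ⊠ q) ⊠ r) n      ≈⟨ +-congˡ (shift n) ⟩
    a * coeff (q ⊠ r) n + coeff (0# ∷ p ⊠ (q ⊠ r)) n      ≈⟨ +-congʳ (coeff-· a (q ⊠ r) n) ⟨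
    coeff (a · (q ⊠ r)) n + coeff (0# ∷ p ⊠ (q ⊠ r)) n    ≈⟨ coeff-⊞ (a · (q ⊠ r)) _ n ⟨
    coeff ((a ∷ p) ⊠ (q ⊠ r)) n                           ∎
    where
    shift : ∀ n → coeff (0# ∷ (p ⊠ q) ⊠ r) n ≈ coeff (0# ∷ p ⊠ (q ⊠ r)) n
    shift zero    = refl
    shift (suc n) = ⊠-assoc p q r n

  C : Carrier → Poly
  C a = a ∷ []

  coeff-C⊠ : ∀ a p n → coeff (C a ⊠ p) n ≈ a * coeff p n
  coeff-C⊠ a p zero    = coeff-⊠-0 a [] p
  coeff-C⊠ a p (suc n) = trans (coeff-⊠-suc a [] p n) (+-identityʳ _)

  ⊠-identityˡ : ∀ p n → coeff (C 1# ⊠ p) n ≈ coeff p n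
  ⊠-identityˡ p n = trans (coeff-C⊠ 1# p n) (*-identityˡ _)

  polynomialRing : CommutativeRing c ℓ
  polynomialRing = record
    { Carrier = Poly ; _≈_ = _≋_ ; _+_ = _⊞_ ; _*_ = _⊠_ ; -_ = ⊟_ ; 0# = [] ; 1# = C 1#
    ; isCommutativeRing = record
      { isRing = record
        { +-isAbelianGroup = record
          { isGroup = record
            { isMonoid = record
              { isSemigroup = record
                { isMagma = record
                  { isEquivalence = record
                    { refl = mk λ _ → refl ; sym = λ e → mk λ n → sym (at e n)
                    ; trans = λ e f → mk λ n → trans (at e n) (at f n) }
                  ; ∙-cong = λ {p} {p′} {q} {q′} e f → mk λ n → trans (coeff-⊞ p q n)
                      (trans (+-cong (at e n) (at f n)) (sym (coeff-⊞ p′ q′ n))) }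
                ; assoc = λ p q r → mk λ n → trans (coeff-⊞ (p ⊞ q) r n)
                    (trans (+-congʳ (coeff-⊞ p q n)) (trans (+-assoc _ _ _)
                    (sym (trans (coeff-⊞ p (q ⊞ r) n) (+-congˡ (coeff-⊞ q r n)))))) }
              ; identity = (λ p → mk λ n → refl) ,
                  (λ p → mk λ n → trans (coeff-⊞ p [] n) (+-identityʳ _)) }
            ; inverse =
                (λ p → mk λ n → trans (coeff-⊞ (⊟ p) p n)
                  (trans (+-congʳ (coeff-⊟ p n)) (-‿inverseˡ _))) ,
                (λ p → mk λ n → trans (coeff-⊞ p (⊟ p) n)
                  (trans (+-congˡ (coeff-⊟ p n)) (-‿inverseʳ _)))
            ; ⁻¹-cong = λ {p} {q} e → mk λ n → trans (coeff-⊟ p n)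
                (trans (-‿cong (at e n)) (sym (coeff-⊟ q n))) }
          ; comm = λ p q → mk λ n → trans (coeff-⊞ p q n)
              (trans (+-comm _ _) (sym (coeff-⊞ q p n))) }
        ; *-cong = λ {p} {p′} {q} {q′} e f → mk λ n → trans (⊠-congˡ p f n)
            (trans (⊠-comm p q′ n) (trans (⊠-congˡ q′ e n) (⊠-comm q′ p′ n)))
        ; *-assoc = λ p q r → mk (⊠-assoc p q r)
        ; *-identity = (λ p → mk (⊠-identityˡ p)) ,
            (λ p → mk λ n → trans (⊠-comm p _ n) (⊠-identityˡ p n))
        ; distrib =
            (λ p q r → mk λ n → trans (⊠-distribˡ p q r n) (sym (coeff-⊞ (p ⊠ q) _ n))) ,
            (λ p q r → mk λ n → trans (⊠-distribʳ p q r n) (sym (coeff-⊞ (q ⊠ p) _ n))) }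
      ; *-comm = λ p q → mk (⊠-comm p q) } }

  C-+ : ∀ a b → C (a + b) ≋ C a ⊞ C b
  C-+ a b = mk λ n → refl

  C-* : ∀ a b → C (a * b) ≋ C a ⊠ C b
  C-* a b = mk λ { zero → sym (coeff-C⊠ a (C b) 0)
                 ; (suc n) → sym (trans (coeff-C⊠ a (C b) (suc n)) (zeroʳ a)) }

  C-cong : ∀ {a b} → a ≈ b → C a ≋ C b
  C-cong e = mk λ { zero → e ; (suc n) → refl }

  C-neg : ∀ a → C (- a) ≋ ⊟ C a
  C-neg a = mk λ n → refl

  module Evaluation (x : Carrier) where
    ev : Poly → Carrier
    ev []      = 0#
    ev (a ∷ p) = a + x * ev p

    private
      ev-null : ∀ p → (∀ n → coeff p n ≈ 0#) → ev p ≈ 0#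
      ev-null []      e = refl
      ev-null (a ∷ p) e = trans (+-cong (e 0) (*-congˡ (ev-null p (λ n → e (suc n)))))
        (trans (+-identityˡ _) (zeroʳ x))

    ev-cong′ : ∀ p q → (∀ n → coeff p n ≈ coeff q n) → ev p ≈ ev q
    ev-cong′ []      q       e = sym (ev-null q (λ n → sym (e n)))
    ev-cong′ (a ∷ p) []      e = ev-null (a ∷ p) e
    ev-cong′ (a ∷ p) (b ∷ q) e = +-cong (e 0) (*-congˡ (ev-cong′ p q (λ n → e (suc n))))

    ev-cong : ∀ {p q} → p ≋ q → ev p ≈ ev q
    ev-cong {p} {q} e = ev-cong′ p q (at e)

    ev-⊞ : ∀ p q → ev (p ⊞ q) ≈ ev p + ev q
    ev-⊞ []      q       = sym (+-identityˡ _)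
    ev-⊞ (a ∷ p) []      = sym (+-identityʳ _)
    ev-⊞ (a ∷ p) (b ∷ q) = trans (+-congˡ (*-congˡ (ev-⊞ p q)))
      (solve 5 (λ a b x p q → a :+ b :+ x :* (p :+ q) := (a :+ x :* p) :+ (b :+ x :* q))
         refl a b x (ev p) (ev q))

    ev-· : ∀ a p → ev (a · p) ≈ a * ev p
    ev-· a []      = sym (zeroʳ a)
    ev-· a (b ∷ p) = trans (+-congˡ (*-congˡ (ev-· a p)))
      (solve 4 (λ a b x p → a :* b :+ x :* (a :* p) := a :* (b :+ x :* p)) refl a b x (ev p))

    ev-⊠ : ∀ p q → ev (p ⊠ q) ≈ ev p * ev q
    ev-⊠ []      q = sym (zeroˡ _)
    ev-⊠ (a ∷ p) q = begin
      ev (a · q ⊞ (0# ∷ p ⊠ q))               ≈⟨ ev-⊞ (a · q) _ ⟩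
      ev (a · q) + (0# + x * ev (p ⊠ q))
        ≈⟨ +-cong (ev-· a q) (trans (+-identityˡ _) (*-congˡ (ev-⊠ p q))) ⟩
      a * ev q + x * (ev p * ev q)
        ≈⟨ solve 4 (λ a x p q → a :* q :+ x :* (p :* q) := (a :+ x :* p) :* q) refl a x (ev p) (ev q) ⟩
      (a + x * ev p) * ev q                   ∎

  VanishesAbove : ℕ → Poly → Set ℓ
  VanishesAbove n p = ∀ m → n < m → coeff p m ≈ 0#

  private
    null-⊠ : ∀ p q → (∀ n → coeff p n ≈ 0#) → ∀ n → coeff (p ⊠ q) n ≈ 0#
    null-⊠ p q e n = trans (⊠-comm p q n) (trans (⊠-congˡ q (mk e) n) (⊠-zeroʳ q n))

  vanishesAbove-⊠ : ∀ p q {n m} → VanishesAbove n p → VanishesAbove m q →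
    VanishesAbove (n ℕ.+ m) (p ⊠ q)
  vanishesAbove-⊠ []      q v w k lt = refl
  vanishesAbove-⊠ (a ∷ p) q {n} {m} v w (suc k) lt = begin
    coeff ((a ∷ p) ⊠ q) (suc k)            ≈⟨ coeff-⊠-suc a p q k ⟩
    a * coeff q (suc k) + coeff (p ⊠ q) k
      ≈⟨ +-cong (trans (*-congˡ (w (suc k) (ℕ.≤-<-trans (ℕ.m≤n+m m n) lt))) (zeroʳ a)) (rest n v lt) ⟩
    0# + 0#                                ≈⟨ +-identityʳ 0# ⟩
    0#                                     ∎
    where
    -- A degree bound n for `a ∷ p` is a bound n - 1 for `p`. For n = 0 the tail is zero, though
    -- possibly written as a list of zeros.
    rest : ∀ n → VanishesAbove n (a ∷ p) → n ℕ.+ m < suc k → coeff (p ⊠ q) k ≈ 0#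
    rest zero    v lt       = null-⊠ p q (λ j → v (suc j) (s≤s z≤n)) k
    rest (suc n) v (s≤s lt) = vanishesAbove-⊠ p q (λ j l → v (suc j) (s≤s l)) w k lt

  coeff-top-⊠ : ∀ p q {n m} → VanishesAbove n p → VanishesAbove m q →
    coeff (p ⊠ q) (n ℕ.+ m) ≈ coeff p n * coeff q m
  coeff-top-⊠ []      q v w = sym (zeroˡ _)
  coeff-top-⊠ (a ∷ p) q {zero} {zero}  v w = coeff-⊠-0 a p q
  coeff-top-⊠ (a ∷ p) q {zero} {suc m} v w = trans (coeff-⊠-suc a p q m)
    (trans (+-congˡ (null-⊠ p q (λ j → v (suc j) (s≤s z≤n)) m)) (+-identityʳ _))
  coeff-top-⊠ (a ∷ p) q {suc n} {m} v w = trans (coeff-⊠-suc a p q (n ℕ.+ m))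
    (trans (+-cong (trans (*-congˡ (w _ (s≤s (ℕ.m≤n+m m n)))) (zeroʳ a))
                   (coeff-top-⊠ p q (λ j l → v (suc j) (s≤s l)) w))
           (+-identityˡ _))

-- Pairs (p , q) stand for p + q √d.
module QuadraticExtension {c ℓ} (S : CommutativeRing c ℓ) (d : CommutativeRing.Carrier S) where
  open CommutativeRing S
  open ℤCoefficientSolver S

  quadraticExtension : CommutativeRing c ℓ
  quadraticExtension = record
    { Carrier = Carrier × Carrier
    ; _≈_ = λ { (p , q) (p′ , q′) → (p ≈ p′) × (q ≈ q′) }
    ; _+_ = λ { (p , q) (p′ , q′) → p + p′ , q + q′ }
    ; _*_ = λ { (p , q) (p′ , q′) → p * p′ + d * (q * q′) , p * q′ + q * p′ }
    ; -_ = λ { (p , q) → - p , - q }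
    ; 0# = 0# , 0# ; 1# = 1# , 0#
    ; isCommutativeRing = record
      { isRing = record
        { +-isAbelianGroup = record
          { isGroup = record
            { isMonoid = record
              { isSemigroup = record
                { isMagma = record
                  { isEquivalence = record
                    { refl = refl , refl ; sym = λ { (e , f) → sym e , sym f }
                    ; trans = λ { (e , f) (e′ , f′) → trans e e′ , trans f f′ } }
                  ; ∙-cong = λ { (e , f) (e′ , f′) → +-cong e e′ , +-cong f f′ } }
                ; assoc = λ _ _ _ → +-assoc _ _ _ , +-assoc _ _ _ }
              ; identity = (λ _ → +-identityˡ _ , +-identityˡ _) ,
                           (λ _ → +-identityʳ _ , +-identityʳ _) }
            ; inverse = (λ _ → -‿inverseˡ _ , -‿inverseˡ _) ,
                        (λ _ → -‿inverseʳ _ , -‿inverseʳ _)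
            ; ⁻¹-cong = λ { (e , f) → -‿cong e , -‿cong f } }
          ; comm = λ _ _ → +-comm _ _ , +-comm _ _ }
        ; *-cong = λ { (e , f) (e′ , f′) →
            +-cong (*-cong e e′) (*-congˡ (*-cong f f′)) , +-cong (*-cong e f′) (*-cong f e′) }
        ; *-assoc = λ { (a , b) (a′ , b′) (a″ , b″) →
            solve 7 (λ d a b a′ b′ a″ b″ →
              (a :* a′ :+ d :* (b :* b′)) :* a″ :+ d :* ((a :* b′ :+ b :* a′) :* b″) :=
              a :* (a′ :* a″ :+ d :* (b′ :* b″)) :+ d :* (b :* (a′ :* b″ :+ b′ :* a″)))
              refl d a b a′ b′ a″ b″ ,
            solve 7 (λ d a b a′ b′ a″ b″ →
              (a :* a′ :+ d :* (b :* b′)) :* b″ :+ (a :* b′ :+ b :* a′) :* a″ :=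
              a :* (a′ :* b″ :+ b′ :* a″) :+ b :* (a′ :* a″ :+ d :* (b′ :* b″)))
              refl d a b a′ b′ a″ b″ }
        ; *-identity =
            (λ { (a , b) →
               trans (+-cong (*-identityˡ a) (trans (*-congˡ (zeroˡ b)) (zeroʳ d))) (+-identityʳ a) ,
               trans (+-cong (*-identityˡ b) (zeroˡ a)) (+-identityʳ b) }) ,
            (λ { (a , b) →
               trans (+-cong (*-identityʳ a) (trans (*-congˡ (zeroʳ b)) (zeroʳ d))) (+-identityʳ a) ,
               trans (+-cong (zeroʳ a) (*-identityʳ b)) (+-identityˡ b) })
        ; distrib =
            (λ { (a , b) (a′ , b′) (a″ , b″) →
              solve 7 (λ d a b a′ b′ a″ b″ →
                a :* (a′ :+ a″) :+ d :* (b :* (b′ :+ b″)) :=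
                (a :* a′ :+ d :* (b :* b′)) :+ (a :* a″ :+ d :* (b :* b″)))
                refl d a b a′ b′ a″ b″ ,
              solve 6 (λ a b a′ b′ a″ b″ →
                a :* (b′ :+ b″) :+ b :* (a′ :+ a″) :=
                (a :* b′ :+ b :* a′) :+ (a :* b″ :+ b :* a″))
                refl a b a′ b′ a″ b″ }) ,
            (λ { (a , b) (a′ , b′) (a″ , b″) →
              solve 7 (λ d a b a′ b′ a″ b″ →
                (a′ :+ a″) :* a :+ d :* ((b′ :+ b″) :* b) :=
                (a′ :* a :+ d :* (b′ :* b)) :+ (a″ :* a :+ d :* (b″ :* b)))
                refl d a b a′ b′ a″ b″ ,
              solve 6 (λ a b a′ b′ a″ b″ →
                (a′ :+ a″) :* b :+ (b′ :+ b″) :* a :=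
                (a′ :* b :+ b′ :* a) :+ (a″ :* b :+ b″ :* a))
                refl a b a′ b′ a″ b″ }) }
      ; *-comm = λ { (a , b) (a′ , b′) →
          +-cong (*-comm a a′) (*-congˡ (*-comm b b′)) ,
          trans (+-comm _ _) (+-cong (*-comm b a′) (*-comm a b′)) } } }

  norm : Carrier × Carrier → Carrier
  norm (p , q) = p * p + - (d * (q * q))

  norm-* : ∀ r s → norm (CommutativeRing._*_ quadraticExtension r s) ≈ norm r * norm s
  norm-* (a , b) (a′ , b′) = solve 5 (λ d a b a′ b′ →
    (a :* a′ :+ d :* (b :* b′)) :* (a :* a′ :+ d :* (b :* b′)) :+
      :- (d :* ((a :* b′ :+ b :* a′) :* (a :* b′ :+ b :* a′))) :=
    (a :* a :+ :- (d :* (b :* b))) :* (a′ :* a′ :+ :- (d :* (b′ :* b′))))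
    refl d a b a′ b′

  norm-cong : ∀ {r s} → CommutativeRing._≈_ quadraticExtension r s → norm r ≈ norm s
  norm-cong (e , f) = +-cong (*-cong e e) (-‿cong (*-congˡ (*-cong f f)))

-- Decidable fields and degrees of polynomials

record IsDecidableField {c ℓ} (F : CommutativeRing c ℓ) : Set (c ⊔ ℓ) where
  open CommutativeRing F
  field
    _≟_     : ∀ a b → Dec (a ≈ b)
    inverse : ∀ a → ¬ a ≈ 0# → ∃[ b ] a * b ≈ 1#
    1≉0     : ¬ 1# ≈ 0#

  open ℤCoefficientSolver F
  open import Relation.Binary.Reasoning.Setoid setoid

  *-cancelˡ : ∀ {a b c} → ¬ a ≈ 0# → a * b ≈ a * c → b ≈ c
  *-cancelˡ {a} {b} {c} nz e with inverse a nz
  ... | i , ai = begin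
    b           ≈⟨ trans (*-congʳ ai) (*-identityˡ b) ⟨
    a * i * b   ≈⟨ solve 3 (λ a i b → a :* i :* b := i :* (a :* b)) refl a i b ⟩
    i * (a * b) ≈⟨ *-congˡ e ⟩
    i * (a * c) ≈⟨ solve 3 (λ a i b → a :* i :* b := i :* (a :* b)) refl a i c ⟨
    a * i * c   ≈⟨ trans (*-congʳ ai) (*-identityˡ c) ⟩
    c           ∎

  *-nonzero : ∀ {a b} → ¬ a ≈ 0# → ¬ b ≈ 0# → ¬ a * b ≈ 0#
  *-nonzero nz nz′ e = nz′ (*-cancelˡ nz (trans e (sym (zeroʳ _))))

module PolynomialDegree {c ℓ} (F : CommutativeRing c ℓ) (isField : IsDecidableField F) where
  open CommutativeRing F
  open IsDecidableField isField
  open Polynomial F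
  open ℤCoefficientSolver F
  private module S = CommutativeRing polynomialRing

  -- The zero polynomial has no degree.
  HasDegree : Poly → ℕ → Set ℓ
  HasDegree p n = (¬ coeff p n ≈ 0#) × VanishesAbove n p

  hasDegree-unique : ∀ p {m n} → HasDegree p m → HasDegree p n → m ≡ n
  hasDegree-unique p {m} {n} (nz , v) (nz′ , v′) with ℕ.<-cmp m n
  ... | tri< m<n _ _ = ⊥-elim (nz′ (v n m<n))
  ... | tri≈ _ e _   = e
  ... | tri> _ _ n<m = ⊥-elim (nz (v′ m n<m))

  hasDegree-cong : ∀ {p q n} → p ≋ q → HasDegree p n → HasDegree q n
  hasDegree-cong e (nz , v) =
    (λ z → nz (trans (at e _) z)) , λ m lt → trans (sym (at e m)) (v m lt)

  hasDegree-⊠ : ∀ p q {m n} → HasDegree p m → HasDegree q n → HasDegree (p ⊠ q) (m ℕ.+ n)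
  hasDegree-⊠ p q (nz , v) (nz′ , v′) =
    (λ z → *-nonzero nz nz′ (trans (sym (coeff-top-⊠ p q v v′)) z)) , vanishesAbove-⊠ p q v v′

  hasDegree-⊟ : ∀ p {n} → HasDegree p n → HasDegree (⊟ p) n
  hasDegree-⊟ p (nz , v) =
    (λ z → nz (trans (sym (-‿involutive _)) (trans (-‿cong (trans (sym (coeff-⊟ p _)) z)) -0#≈0#))) ,
    λ m lt → trans (coeff-⊟ p m) (trans (-‿cong (v m lt)) -0#≈0#)
    where open import Algebra.Properties.Ring ring using (-‿involutive; -0#≈0#)

  hasDegree-⊞ : ∀ p q {m n} → VanishesAbove m p → m < n → HasDegree q n → HasDegree (p ⊞ q) n
  hasDegree-⊞ p q v m<n (nz , v′) =
    (λ z → nz (trans (sym (sum _ m<n)) z)) ,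
    λ k lt → trans (sum k (ℕ.<-trans m<n lt)) (v′ k lt)
    where
    sum : ∀ k → _ < k → coeff (p ⊞ q) k ≈ coeff q k
    sum k lt = trans (coeff-⊞ p q k) (trans (+-congʳ (v k lt)) (+-identityˡ _))

  zeroOrDegree : ∀ p → (p ≋ []) ⊎ ∃ (HasDegree p)
  zeroOrDegree [] = inj₁ (mk λ _ → refl)
  zeroOrDegree (a ∷ p) with zeroOrDegree p
  ... | inj₂ (n , nz , v) = inj₂ (suc n , nz , λ { (suc m) (s≤s lt) → v m lt })
  ... | inj₁ z with a ≟ 0#
  ...   | yes e = inj₁ (mk λ { zero → e ; (suc n) → at z n })
  ...   | no ne = inj₂ (0 , ne , λ { (suc m) lt → at z m })

  hasDegree-zero : ∀ p → HasDegree p 0 → p ≋ C (coeff p 0)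
  hasDegree-zero p (_ , v) = mk λ { zero → refl ; (suc n) → v (suc n) (s≤s z≤n) }

  hasDegree≢0 : ∀ {p n} → HasDegree p n → ¬ p ≋ []
  hasDegree≢0 (nz , _) e = nz (at e _)

-- The coordinate ring of a Weierstrass curve

module _ {c ℓ} (F : CommutativeRing c ℓ) (A B : CommutativeRing.Carrier F) where
  private module F = CommutativeRing F

  -- All that the class argument uses about the coordinate ring, independently of its realisation by
  -- pairs of polynomials. `ev x y` is evaluation at (x , y): it is additive everywhere but
  -- multiplicative only at points of the curve. `divisor-constant` expresses that no function has a
  -- simple pole at infinity.
  record CoordinateRing : Set (lsuc (c ⊔ ℓ)) where
    field
      ring : CommutativeRing c ℓ
    open CommutativeRing ring
    field
      ι      : F.Carrier → Carrier
      ι-cong : ∀ {a b} → a F.≈ b → ι a ≈ ι b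
      ι-+    : ∀ a b → ι (a F.+ b) ≈ ι a + ι b
      ι-*    : ∀ a b → ι (a F.* b) ≈ ι a * ι b
      ι-neg  : ∀ a → ι (F.- a) ≈ - ι a
      ι-1    : ι F.1# ≈ 1#
      X Y    : Carrier
      curve  : Y * Y ≈ X * X * X + ι A * X + ι B

      ev      : F.Carrier → F.Carrier → Carrier → F.Carrier
      ev-cong : ∀ x y {r s} → r ≈ s → ev x y r F.≈ ev x y s
      ev-ι    : ∀ x y a → ev x y (ι a) F.≈ a
      ev-+    : ∀ x y r s → ev x y (r + s) F.≈ ev x y r F.+ ev x y s
      ev-*    : ∀ x y → y F.* y F.≈ x F.* x F.* x F.+ A F.* x F.+ B →
                ∀ r s → ev x y (r * s) F.≈ ev x y r F.* ev x y s
      ev-X    : ∀ x y → ev x y X F.≈ x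
      ev-Y    : ∀ x y → ev x y Y F.≈ y

      cancel   : ∀ {a r s} → ¬ a ≈ 0# → a * r ≈ a * s → r ≈ s
      X-a≉0    : ∀ a → ¬ X - ι a ≈ 0#
      Y-sX-a≉0 : ∀ s a → ¬ Y - (ι s * X + ι a) ≈ 0#
      divisor-constant : ∀ {r s t x y} → r * s ≈ X - ι x → r * t ≈ Y - ι y →
                         ∃[ a ] r ≈ ι a × ¬ a F.≈ F.0#

  module _ (isField : IsDecidableField F) where
    open IsDecidableField isField
    open Polynomial F
    open PolynomialDegree F isField
    private
      module S = CommutativeRing polynomialRing
      module FS = ℤCoefficientSolver F
      module SS = ℤCoefficientSolver polynomialRing
      open import Algebra.Properties.Ring F.ring using (-0#≈0#)

    weierstrass : Poly
    weierstrass = B ∷ A ∷ F.0# ∷ F.1# ∷ []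

    weierstrass-degree : HasDegree weierstrass 3
    weierstrass-degree = 1≉0 ,
      λ { (suc (suc (suc (suc n)))) lt → F.refl
        ; 1 (s≤s ()) ; 2 (s≤s (s≤s ())) ; 3 (s≤s (s≤s (s≤s ()))) }

    open QuadraticExtension polynomialRing weierstrass
    private module R = CommutativeRing quadraticExtension

    private
      -- In the norm p² - f q² the first term has even and the second odd degree, so the leading
      -- terms cannot cancel.
      2m≢3+2n : ∀ m n → m ℕ.+ m ≢ 3 ℕ.+ (n ℕ.+ n)
      2m≢3+2n m n e = ℕ.even≢odd m (suc n)
        (≡.trans (≡.cong (m ℕ.+_) (ℕ.+-identityʳ m))
        (≡.trans e (≡.cong (λ k → suc (suc k)) (≡.trans (≡.sym (ℕ.+-suc n n))
          (≡.cong (λ k → n ℕ.+ suc k) (≡.sym (ℕ.+-identityʳ n)))))))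

      x+0≋x : ∀ p {q} → q ≋ [] → p ⊞ ⊟ (weierstrass ⊠ (q ⊠ q)) ≋ p
      x+0≋x p {q} e = S.trans (S.+-congˡ {p} (S.-‿cong {weierstrass ⊠ (q ⊠ q)} (S.*-congˡ {weierstrass} (S.*-cong {q} e e))))
        (SS.solve 2 (λ p f → p SS.:+ SS.:- (f SS.:* (SS.con ℤ.0ℤ SS.:* SS.con ℤ.0ℤ)) SS.:= p)
           S.refl p weierstrass)

      0+x≋x : ∀ {p q} → p ≋ [] → p ⊠ p ⊞ q ≋ q
      0+x≋x {p} {q} e = S.+-congʳ (S.*-cong e e)

    constant : F.Carrier → R.Carrier
    constant a = C a , []

    -- A nonzero element p + q Y has a pole of order max (2 deg p) (3 + 2 deg q)
    -- at infinity: order 1 never occurs, order 0 only for constants.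
    PoleOrder : R.Carrier → ℕ → Set (c ⊔ ℓ)
    PoleOrder r n = HasDegree (norm r) n × ¬ n ≡ 1 × (n ≡ 0 → ∃[ a ] r R.≈ constant a × ¬ a F.≈ F.0#)

    norm-degree : ∀ r → (r R.≈ R.0#) ⊎ ∃ (PoleOrder r)
    norm-degree (p , q) with zeroOrDegree p | zeroOrDegree q
    ... | inj₁ p0 | inj₁ q0 = inj₁ (p0 , q0)
    ... | inj₂ (n , dp) | inj₁ q0 = inj₂ (n ℕ.+ n ,
        hasDegree-cong {p ⊠ p} (S.sym (x+0≋x (p ⊠ p) q0)) (hasDegree-⊠ p p dp dp) , ne1 n , const n dp)
      where
      ne1 : ∀ n → ¬ n ℕ.+ n ≡ 1
      ne1 (suc zero) ()
      ne1 (suc (suc n)) ()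

      const : ∀ n → HasDegree p n → n ℕ.+ n ≡ 0 → ∃[ a ] (p , q) R.≈ constant a × ¬ a F.≈ F.0#
      const zero d ≡.refl = coeff p 0 , (hasDegree-zero p d , q0) , proj₁ d
    ... | p0? | inj₂ (m , dq) = inj₂ (both p0?)
      where
      N : Poly
      N = ⊟ (weierstrass ⊠ (q ⊠ q))

      dN : HasDegree N (3 ℕ.+ (m ℕ.+ m))
      dN = hasDegree-⊟ (weierstrass ⊠ (q ⊠ q))
        (hasDegree-⊠ weierstrass (q ⊠ q) weierstrass-degree (hasDegree-⊠ q q dq dq))

      both : (p ≋ []) ⊎ ∃ (HasDegree p) →
        ∃ (PoleOrder (p , q))
      both (inj₁ p0) = _ , hasDegree-cong (S.sym (0+x≋x p0)) dN , (λ ()) , λ ()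
      both (inj₂ (n , dp)) with ℕ.<-cmp (n ℕ.+ n) (3 ℕ.+ (m ℕ.+ m))
      ... | tri< lt _ _ =
        _ , hasDegree-⊞ (p ⊠ p) N (proj₂ (hasDegree-⊠ p p dp dp)) lt dN , (λ ()) , λ ()
      ... | tri≈ _ e _  = ⊥-elim (2m≢3+2n n m e)
      ... | tri> _ _ gt = n ℕ.+ n ,
        hasDegree-cong (S.+-comm N (p ⊠ p))
          (hasDegree-⊞ N (p ⊠ p) (proj₂ dN) gt (hasDegree-⊠ p p dp dp)) ,
        (λ e → 3+k≮1 (≡.subst (3 ℕ.+ (m ℕ.+ m) <_) e gt)) ,
        (λ e → ⊥-elim (ℕ.n≮0 (≡.subst (3 ℕ.+ (m ℕ.+ m) <_) e gt)))
        where
        3+k≮1 : ∀ {k} → ¬ 3 ℕ.+ k < 1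
        3+k≮1 (s≤s ())

    private
      X Y : R.Carrier
      X = (F.0# ∷ F.1# ∷ []) , []
      Y = [] , C F.1#

      -- By `norm-degree` a nonzero element has a norm with a degree. Norms multiply and degrees
      -- add, so the norm of a product of nonzero elements is nonzero.
      noZeroDivisors : ∀ {a r} → ¬ a R.≈ R.0# → a R.* r R.≈ R.0# → r R.≈ R.0#
      noZeroDivisors {a} {r} a≉0 e with norm-degree a | norm-degree r
      ... | inj₁ z | _      = ⊥-elim (a≉0 z)
      ... | _      | inj₁ z = z
      ... | inj₂ (m , d , _) | inj₂ (n , d′ , _) = ⊥-elim (hasDegree≢0
              (hasDegree-cong (S.sym (norm-* a r)) (hasDegree-⊠ (norm a) (norm r) d d′))
              (S.trans (norm-cong {a R.* r} {R.0#} e) norm0))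
        where
        norm0 : norm R.0# ≋ []
        norm0 = SS.solve 1 (λ f → SS.con ℤ.0ℤ SS.:* SS.con ℤ.0ℤ SS.:+
                  SS.:- (f SS.:* (SS.con ℤ.0ℤ SS.:* SS.con ℤ.0ℤ)) SS.:= SS.con ℤ.0ℤ)
                  S.refl weierstrass

      cancel : ∀ {a r s} → ¬ a R.≈ R.0# → a R.* r R.≈ a R.* s → r R.≈ s
      cancel {a} {r} {s} a≉0 e = x∙y⁻¹≈ε⇒x≈y r s (noZeroDivisors {a} {r R.- s} a≉0
        (R.trans {a R.* (r R.- s)} {a R.* r R.- a R.* s} (x[y-z]≈xy-xz a r s)
          (x≈y⇒x∙y⁻¹≈ε {a R.* r} {a R.* s} e)))
        where
        open import Algebra.Properties.Ring R.ring using (x[y-z]≈xy-xz)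
        open import Algebra.Properties.Group R.+-group using (x∙y⁻¹≈ε⇒x≈y; x≈y⇒x∙y⁻¹≈ε)

      degree-X-a : ∀ a → HasDegree (norm (X R.- constant a)) 2
      degree-X-a a = hasDegree-cong (S.sym (x+0≋x (X-a ⊠ X-a) {[]} S.refl)) (hasDegree-⊠ X-a X-a d d)
        where
        X-a : Poly
        X-a = proj₁ (X R.- constant a)
        d : HasDegree X-a 1
        d = 1≉0 , λ { (suc (suc n)) lt → F.refl ; 1 (s≤s ()) }

      degree-Y-a : ∀ a → HasDegree (norm (Y R.- constant a)) 3
      degree-Y-a a = hasDegree-⊞ (proj₁ r ⊠ proj₁ r) N
        {0} (vanishesAbove-⊠ (proj₁ r) (proj₁ r) {0} {0} v v) (s≤s z≤n)
        (hasDegree-⊟ (weierstrass ⊠ (C F.1# ⊠ C F.1#))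
          (hasDegree-⊠ weierstrass (C F.1# ⊠ C F.1#) weierstrass-degree
            (hasDegree-⊠ (C F.1#) (C F.1#) d d)))
        where
        r : R.Carrier
        r = Y R.- constant a
        N : Poly
        N = ⊟ (weierstrass ⊠ (C F.1# ⊠ C F.1#))
        v : VanishesAbove 0 (proj₁ r)
        v = λ { (suc n) lt → F.refl }
        d : HasDegree (C F.1#) 0
        d = 1≉0 , λ { (suc n) lt → F.refl }

      factor-degrees : ∀ r s {n} → HasDegree (norm (r R.* s)) n →
        ∃[ i ] ∃[ j ] PoleOrder r i × PoleOrder s j × i ℕ.+ j ≡ n
      factor-degrees r s d with norm-degree r | norm-degree s
      ... | inj₁ z | _ = ⊥-elim (hasDegree≢0 d
              (S.trans (norm-cong {r R.* s} {R.0#}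
                (R.trans {r R.* s} {R.0# R.* s} (R.*-congʳ {s} {r} {R.0#} z) (R.zeroˡ s)))
                (x+0≋x [] {[]} S.refl)))
      ... | _ | inj₁ z = ⊥-elim (hasDegree≢0 d
              (S.trans (norm-cong {r R.* s} {R.0#}
                (R.trans {r R.* s} {r R.* R.0#} (R.*-congˡ {r} {s} {R.0#} z) (R.zeroʳ r)))
                (x+0≋x [] {[]} S.refl)))
      ... | inj₂ (i , oi@(di , _)) | inj₂ (j , oj@(dj , _)) = i , j , oi , oj ,
              hasDegree-unique (norm r ⊠ norm s) (hasDegree-⊠ (norm r) (norm s) di dj)
                (hasDegree-cong (norm-* r s) d)

      -- The norms of X - x and Y - y have degrees 2 and 3. If r, s, t have orders i, j, k, then i +
      -- j = 2 and i + k = 3, while order 1 never occurs: i = 1 is excluded, i = 2 would give k = 1,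
      -- and i = 0 means that r is constant.
      divisor-constant : ∀ {r s t x y} → r R.* s R.≈ X R.- constant x → r R.* t R.≈ Y R.- constant y →
                         ∃[ a ] r R.≈ constant a × ¬ a F.≈ F.0#
      divisor-constant {r} {s} {t} {x} {y} e e′ = combine
        (factor-degrees r s (hasDegree-cong (norm-cong {X R.- constant x} {r R.* s}
          (R.sym {r R.* s} e)) (degree-X-a x)))
        (factor-degrees r t (hasDegree-cong (norm-cong {Y R.- constant y} {r R.* t}
          (R.sym {r R.* t} e′)) (degree-Y-a y)))
        where
        degrees : ∀ {P : Set (c ⊔ ℓ)} i {j} k → ¬ i ≡ 1 → ¬ k ≡ 1 → (i ≡ 0 → P) →
                  i ℕ.+ j ≡ 2 → i ℕ.+ k ≡ 3 → P
        degrees 0 k _ _ p _ _ = p ≡.refl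
        degrees 1 k ne _ _ _ _ = ⊥-elim (ne ≡.refl)
        degrees 2 .1 _ ne _ _ ≡.refl = ⊥-elim (ne ≡.refl)
        degrees (suc (suc (suc i))) k _ _ _ () _

        combine :
          ∃[ i ] ∃[ j ] PoleOrder r i × PoleOrder s j × i ℕ.+ j ≡ 2 →
          ∃[ i ] ∃[ k ] PoleOrder r i × PoleOrder t k × i ℕ.+ k ≡ 3 →
          ∃[ a ] r R.≈ constant a × ¬ a F.≈ F.0#
        combine (i , j , (di , i≢1 , const) , _ , i+j≡2) (i′ , k , (di′ , _) , (_ , k≢1 , _) , i′+k≡3) =
          degrees i k i≢1 k≢1 const i+j≡2
            (≡.subst (λ i → i ℕ.+ k ≡ 3) (hasDegree-unique (norm r) di′ di) i′+k≡3)

    coordinateRing : CoordinateRing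
    coordinateRing = record
      { ring = quadraticExtension
      ; ι = constant
      ; ι-cong = λ e → C-cong e , S.refl
      ; ι-+ = λ a b → C-+ a b , S.refl
      ; ι-* = λ a b → S.trans (C-* a b) (S.sym (x*y+f0≋ (C a ⊠ C b))) ,
          S.sym (S.trans (S.+-identityʳ (C a ⊠ [])) (S.zeroʳ (C a)))
      ; ι-neg = λ a → C-neg a , S.refl
      ; ι-1 = R.refl {R.1#}
      ; X = X ; Y = Y
      ; curve = curve
      ; ev = λ x y r → Evaluation.ev x (proj₁ r) F.+ Evaluation.ev x (proj₂ r) F.* y
      ; ev-cong = λ x y (e , f) → F.+-cong (Evaluation.ev-cong x e) (F.*-congʳ (Evaluation.ev-cong x f))
      ; ev-ι = λ x y a → FS.solve 3
          (λ x y a → a FS.:+ x FS.:* FS.con ℤ.0ℤ FS.:+ FS.con ℤ.0ℤ FS.:* y FS.:= a) F.refl x y a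
      ; ev-+ = λ { x y (p , q) (p′ , q′) → let open Evaluation x in
          F.trans (F.+-cong (ev-⊞ p p′) (F.*-congʳ (ev-⊞ q q′)))
            (FS.solve 5 (λ a b c d y → (a FS.:+ b) FS.:+ (c FS.:+ d) FS.:* y FS.:=
                (a FS.:+ c FS.:* y) FS.:+ (b FS.:+ d FS.:* y))
              F.refl (ev p) (ev p′) (ev q) (ev q′) y) }
      ; ev-* = ev-*
      ; ev-X = λ x y → F.trans
          (FS.solve 3 (λ x y o → FS.con ℤ.0ℤ FS.:+ x FS.:* (o FS.:+ x FS.:* FS.con ℤ.0ℤ) FS.:+ FS.con ℤ.0ℤ FS.:* y
             FS.:= x FS.:* o) F.refl x y F.1#)
          (F.*-identityʳ x)
      ; ev-Y = λ x y → F.trans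
          (FS.solve 3 (λ x y o → FS.con ℤ.0ℤ FS.:+ (o FS.:+ x FS.:* FS.con ℤ.0ℤ) FS.:* y FS.:= o FS.:* y)
             F.refl x y F.1#)
          (F.*-identityˡ y)
      ; cancel = λ {a} {r} {s} → cancel {a} {r} {s}
      ; X-a≉0 = λ a e → 1≉0 (at (proj₁ e) 1)
      ; Y-sX-a≉0 = λ s a e → 1≉0 (F.trans (F.sym (Y-coefficient s a)) (at (proj₂ e) 0))
      ; divisor-constant = λ {r} {s} {t} → divisor-constant {r} {s} {t}
      }
      where
      x*y+f0≋ : ∀ p → p ⊞ weierstrass ⊠ [] ≋ p
      x*y+f0≋ p = S.trans (S.+-congˡ (S.zeroʳ weierstrass)) (S.+-identityʳ p)

      Y-coefficient : ∀ s a → coeff (proj₂ (Y R.- (constant s R.* X R.+ constant a))) 0 F.≈ F.1#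
      Y-coefficient s a = F.trans (F.+-congˡ -0#≈0#) (F.+-identityʳ F.1#)

      x : Poly
      x = F.0# ∷ F.1# ∷ []

      x⊠ : ∀ p → x ⊠ p ≋ F.0# ∷ p
      x⊠ p = mk λ
        { zero → 0∷-⊠ (C F.1#) p 0
        ; (suc n) → F.trans (0∷-⊠ (C F.1#) p (suc n)) (⊠-identityˡ p n) }

      x³ : x ⊠ (x ⊠ x) ≋ F.0# ∷ F.0# ∷ x
      x³ = S.trans (x⊠ (x ⊠ x)) (mk λ { zero → F.refl ; (suc n) → at (x⊠ x) n })

      weierstrass≋ : weierstrass ≋ x ⊠ (x ⊠ x) ⊞ C A ⊠ x ⊞ C B
      weierstrass≋ = mk λ n → F.sym (F.trans (coeff-⊞ (x ⊠ (x ⊠ x) ⊞ C A ⊠ x) (C B) n)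
        (F.trans (F.+-congʳ (F.trans (coeff-⊞ (x ⊠ (x ⊠ x)) (C A ⊠ x) n)
                                     (F.+-cong (at x³ n) (coeff-C⊠ A x n))))
                 (coefficients n)))
        where
        drop : ∀ a b → (a F.+ A F.* F.0#) F.+ b F.≈ a F.+ b
        drop a b = F.+-congʳ (F.trans (F.+-congˡ (F.zeroʳ A)) (F.+-identityʳ a))

        coefficients : ∀ n → coeff (F.0# ∷ F.0# ∷ x) n F.+ A F.* coeff x n F.+ coeff (C B) n F.≈ coeff weierstrass n
        coefficients 0 = F.trans (drop _ _) (F.+-identityˡ B)
        coefficients 1 = F.trans (F.+-identityʳ _) (F.trans (F.+-identityˡ _) (F.*-identityʳ A))
        coefficients 2 = F.trans (drop _ _) (F.+-identityʳ _)
        coefficients 3 = F.trans (drop _ _) (F.+-identityʳ _)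
        coefficients (suc (suc (suc (suc n)))) = F.trans (drop _ _) (F.+-identityʳ _)

      curve : Y R.* Y R.≈ X R.* X R.* X R.+ constant A R.* X R.+ constant B
      curve =
        S.trans (S.*-congˡ {weierstrass} (S.*-identityˡ (C F.1#)))
          (S.trans (S.*-identityʳ weierstrass) (S.trans weierstrass≋
            (SS.solve 4 (λ f x a b → x SS.:* (x SS.:* x) SS.:+ a SS.:* x SS.:+ b SS.:=
               ((x SS.:* x SS.:+ f SS.:* 𝟘²) SS.:* x SS.:+ f SS.:* ((x SS.:* 𝟘 SS.:+ 𝟘 SS.:* x) SS.:* 𝟘)) SS.:+
               (a SS.:* x SS.:+ f SS.:* 𝟘²) SS.:+ b)
               S.refl weierstrass x (C A) (C B)))) ,
        SS.solve 4 (λ f o x a → 𝟘 SS.:* o SS.:+ o SS.:* 𝟘 SS.:=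
            (((x SS.:* x SS.:+ f SS.:* 𝟘²) SS.:* 𝟘 SS.:+ (x SS.:* 𝟘 SS.:+ 𝟘 SS.:* x) SS.:* x) SS.:+
              (a SS.:* 𝟘 SS.:+ 𝟘 SS.:* x)) SS.:+ 𝟘)
          S.refl weierstrass (C F.1#) x (C A)
        where
        𝟘 𝟘² : ∀ {n} → SS.Polynomial n
        𝟘  = SS.con ℤ.0ℤ
        𝟘² = 𝟘 SS.:* 𝟘

      ev-* : ∀ x y → y F.* y F.≈ x F.* x F.* x F.+ A F.* x F.+ B → ∀ r s →
        Evaluation.ev x (proj₁ (r R.* s)) F.+ Evaluation.ev x (proj₂ (r R.* s)) F.* y F.≈
        (Evaluation.ev x (proj₁ r) F.+ Evaluation.ev x (proj₂ r) F.* y) F.*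
        (Evaluation.ev x (proj₁ s) F.+ Evaluation.ev x (proj₂ s) F.* y)
      ev-* x y on (p , q) (p′ , q′) = begin
        ev (p ⊠ p′ ⊞ weierstrass ⊠ (q ⊠ q′)) F.+ ev (p ⊠ q′ ⊞ q ⊠ p′) F.* y
          ≈⟨ F.+-cong (F.trans (ev-⊞ (p ⊠ p′) _) (F.+-cong (ev-⊠ p p′)
               (F.trans (ev-⊠ weierstrass (q ⊠ q′)) (F.*-cong ev-f (ev-⊠ q q′)))))
             (F.*-congʳ (F.trans (ev-⊞ (p ⊠ q′) _) (F.+-cong (ev-⊠ p q′) (ev-⊠ q p′)))) ⟩
        (a F.* a′ F.+ y F.* y F.* (b F.* b′)) F.+ (a F.* b′ F.+ b F.* a′) F.* y
          ≈⟨ FS.solve 5 (λ a b a′ b′ y →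
               (a FS.:* a′ FS.:+ y FS.:* y FS.:* (b FS.:* b′)) FS.:+ (a FS.:* b′ FS.:+ b FS.:* a′) FS.:* y FS.:=
               (a FS.:+ b FS.:* y) FS.:* (a′ FS.:+ b′ FS.:* y)) F.refl a b a′ b′ y ⟩
        (a F.+ b F.* y) F.* (a′ F.+ b′ F.* y) ∎
        where
        open Evaluation x
        open import Relation.Binary.Reasoning.Setoid F.setoid
        a  = ev p
        b  = ev q
        a′ = ev p′
        b′ = ev q′
        ev-f : ev weierstrass F.≈ y F.* y
        ev-f = F.trans (F.+-congˡ (F.*-congˡ (F.+-congˡ (F.*-congˡ (F.+-congˡ
          (F.trans (F.*-congˡ (F.trans (F.+-congˡ (F.zeroʳ x)) (F.+-identityʳ F.1#))) (F.*-identityʳ x)))))))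
          (F.trans (FS.solve 3 (λ x A B → B FS.:+ x FS.:* (A FS.:+ x FS.:* (FS.con ℤ.0ℤ FS.:+ x)) FS.:=
              x FS.:* x FS.:* x FS.:+ A FS.:* x FS.:+ B) F.refl x A B) (F.sym on))

-- Ideal classes

module IdealClasses {c ℓ} (R : CommutativeRing c ℓ) where
  open CommutativeRing R
  open ℤCoefficientSolver R
  open import Relation.Binary.Reasoning.Setoid setoid

  Subset : Set _
  Subset = Pred Carrier (c ⊔ ℓ)

  _⊆_ : Subset → Subset → Set _
  I ⊆ J = ∀ {r} → I r → J r

  record IsIdeal (I : Subset) : Set (c ⊔ ℓ) where
    field
      sum      : ∀ {r s} → I r → I s → I (r + s)
      multiple : ∀ t {r} → I r → I (t * r)
      respects : ∀ {r s} → r ≈ s → I r → I s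

  data ⟨_,_⟩ (g h : Carrier) : Subset where
    combination : ∀ {r} u v → r ≈ u * g + v * h → ⟨ g , h ⟩ r

  infixl 7 _∙_
  data _∙_ (I J : Subset) : Subset where
    product : ∀ {r i j} → I i → J j → r ≈ i * j → (I ∙ J) r
    add     : ∀ {r s t} → (I ∙ J) r → (I ∙ J) s → t ≈ r + s → (I ∙ J) t

  ⟨⟩-isIdeal : ∀ {g h} → IsIdeal ⟨ g , h ⟩
  ⟨⟩-isIdeal {g} {h} = record
    { sum = λ { (combination u v e) (combination u′ v′ e′) → combination (u + u′) (v + v′)
        (trans (+-cong e e′) (solve 6 (λ u v u′ v′ g h →
          (u :* g :+ v :* h) :+ (u′ :* g :+ v′ :* h) := (u :+ u′) :* g :+ (v :+ v′) :* h)
          refl u v u′ v′ g h)) }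
    ; multiple = λ { t (combination u v e) → combination (t * u) (t * v)
        (trans (*-congˡ e) (solve 5 (λ t u v g h →
          t :* (u :* g :+ v :* h) := t :* u :* g :+ t :* v :* h) refl t u v g h)) }
    ; respects = λ { e (combination u v e′) → combination u v (trans (sym e) e′) } }

  generatorˡ : ∀ {g h} → ⟨ g , h ⟩ g
  generatorˡ {g} {h} = combination 1# 0# (sym (trans (+-cong (*-identityˡ g) (zeroˡ h)) (+-identityʳ g)))

  generatorʳ : ∀ {g h} → ⟨ g , h ⟩ h
  generatorʳ {g} {h} = combination 0# 1# (sym (trans (+-cong (zeroˡ g) (*-identityˡ h)) (+-identityˡ h)))

  ∙-isIdeal : ∀ {I J} → IsIdeal I → IsIdeal (I ∙ J)
  ∙-isIdeal {I} {J} idealI = record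
    { sum = λ p q → add p q refl ; multiple = multiple ; respects = respects }
    where
    multiple : ∀ t {r} → (I ∙ J) r → (I ∙ J) (t * r)
    multiple t (product i j e) =
      product (IsIdeal.multiple idealI t i) j (trans (*-congˡ e) (sym (*-assoc _ _ _)))
    multiple t (add p q e) =
      add (multiple t p) (multiple t q) (trans (*-congˡ e) (distribˡ _ _ _))

    respects : ∀ {r s} → r ≈ s → (I ∙ J) r → (I ∙ J) s
    respects e (product i j e′) = product i j (trans (sym e) e′)
    respects e (add p q e′)     = add p q (trans (sym e) e′)

  ∙-⊆ : ∀ {I J K} → IsIdeal K → (∀ {i j} → I i → J j → K (i * j)) → (I ∙ J) ⊆ K
  ∙-⊆ idealK f (product i j e) = IsIdeal.respects idealK (sym e) (f i j)
  ∙-⊆ idealK f (add p q e)     =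
    IsIdeal.respects idealK (sym e) (IsIdeal.sum idealK (∙-⊆ idealK f p) (∙-⊆ idealK f q))

  ⟨⟩-⊆ : ∀ {g h K} → IsIdeal K → K g → K h → ⟨ g , h ⟩ ⊆ K
  ⟨⟩-⊆ idealK kg kh (combination u v e) = respects (sym e) (sum (multiple u kg) (multiple v kh))
    where open IsIdeal idealK using (respects; sum; multiple)

  ⟨⟩∙⟨⟩-⊆ : ∀ {g h g′ h′ K} → IsIdeal K →
    K (g * g′) → K (g * h′) → K (h * g′) → K (h * h′) → (⟨ g , h ⟩ ∙ ⟨ g′ , h′ ⟩) ⊆ K
  ⟨⟩∙⟨⟩-⊆ {g} {h} {g′} {h′} idealK a b c d = ∙-⊆ idealK λ
    { (combination u v e) (combination u′ v′ e′) →
        respects (trans (solve 8 (λ u v u′ v′ g h g′ h′ →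
            (u :* u′) :* (g :* g′) :+ (u :* v′) :* (g :* h′) :+
            ((v :* u′) :* (h :* g′) :+ (v :* v′) :* (h :* h′)) :=
            (u :* g :+ v :* h) :* (u′ :* g′ :+ v′ :* h′)) refl u v u′ v′ g h g′ h′)
          (sym (*-cong e e′)))
        (sum (sum (multiple (u * u′) a) (multiple (u * v′) b))
             (sum (multiple (v * u′) c) (multiple (v * v′) d))) }
    where open IsIdeal idealK using (respects; sum; multiple)

  ∙-mono : ∀ {I I′ J J′} → I ⊆ I′ → J ⊆ J′ → (I ∙ J) ⊆ (I′ ∙ J′)
  ∙-mono f g (product i j e) = product (f i) (g j) e
  ∙-mono f g (add p q e)     = add (∙-mono f g p) (∙-mono f g q) e

  ∙-comm : ∀ {I J} → (I ∙ J) ⊆ (J ∙ I)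
  ∙-comm (product i j e) = product j i (trans e (*-comm _ _))
  ∙-comm (add p q e)     = add (∙-comm p) (∙-comm q) e

  ∙-assoc : ∀ {I J K} → ((I ∙ J) ∙ K) ⊆ (I ∙ (J ∙ K))
  ∙-assoc {I} {J} {K} (product p k e) = inner p k e
    where
    inner : ∀ {t r k} → (I ∙ J) r → K k → t ≈ r * k → (I ∙ (J ∙ K)) t
    inner (product i j e) k e′ = product i (product j k refl) (trans e′ (trans (*-congʳ e) (*-assoc _ _ _)))
    inner (add p q e) k e′ =
      add (inner p k refl) (inner q k refl) (trans e′ (trans (*-congʳ e) (distribʳ _ _ _)))
  ∙-assoc (add p q e) = add (∙-assoc p) (∙-assoc q) e

  -- Scaling by such elements can be undone, so classes are compared inside the ring without a field
  -- of fractions.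
  Regular : Carrier → Set _
  Regular a = ∀ {r s} → a * r ≈ a * s → r ≈ s

  regular-* : ∀ {a b} → Regular a → Regular b → Regular (a * b)
  regular-* ra rb e = rb (ra (trans (sym (*-assoc _ _ _)) (trans e (*-assoc _ _ _))))

  regular-1 : Regular 1#
  regular-1 e = trans (sym (*-identityˡ _)) (trans e (*-identityˡ _))

  -- I ~ J says that a I = b J for some regular a and b: equality of ideal classes.
  infix 4 _~_
  record _~_ (I J : Subset) : Set (c ⊔ ℓ) where
    field
      {a b}     : Carrier
      a-regular : Regular a
      b-regular : Regular b
      to        : ∀ {i} → I i → ∃[ j ] J j × a * i ≈ b * j
      from      : ∀ {j} → J j → ∃[ i ] I i × b * j ≈ a * i
  open _~_

  ~-fromEquality : ∀ {I J} → I ⊆ J → J ⊆ I → I ~ J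
  ~-fromEquality f g = record
    { a-regular = regular-1 ; b-regular = regular-1
    ; to = λ i → _ , f i , refl ; from = λ j → _ , g j , refl }

  ~-sym : ∀ {I J} → I ~ J → J ~ I
  ~-sym p = record { a-regular = b-regular p ; b-regular = a-regular p ; to = from p ; from = to p }

  private
    compose : ∀ {x y z a b a′ b′} → a * x ≈ b * y → a′ * y ≈ b′ * z → a * a′ * x ≈ b * b′ * z
    compose {x} {y} {z} {a} {b} {a′} {b′} e e′ = begin
      a * a′ * x   ≈⟨ solve 3 (λ a a′ x → a :* a′ :* x := a′ :* (a :* x)) refl a a′ x ⟩
      a′ * (a * x) ≈⟨ *-congˡ e ⟩
      a′ * (b * y) ≈⟨ solve 3 (λ a b y → a :* (b :* y) := b :* (a :* y)) refl a′ b y ⟩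
      b * (a′ * y) ≈⟨ *-congˡ e′ ⟩
      b * (b′ * z) ≈⟨ *-assoc b b′ z ⟨
      b * b′ * z   ∎

  ~-trans : ∀ {I J K} → I ~ J → J ~ K → I ~ K
  ~-trans p q = record
    { a-regular = regular-* (a-regular p) (a-regular q)
    ; b-regular = regular-* (b-regular p) (b-regular q)
    ; to = λ i → let (_ , j , e) = to p i ; (k , k∈ , e′) = to q j in k , k∈ , compose e e′
    ; from = λ k → let (_ , j , e) = from q k ; (i , i∈ , e′) = from p j in
        i , i∈ , trans (*-congʳ (*-comm _ _)) (trans (compose e e′) (*-congʳ (*-comm _ _))) }

  private
    scale : ∀ {I I′ J : Subset} {a b} → (∀ {i} → I i → ∃[ j ] I′ j × a * i ≈ b * j) →
      ∀ {r} → (I ∙ J) r → ∃[ r′ ] (I′ ∙ J) r′ × a * r ≈ b * r′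
    scale f (product i j e) = let (i′ , i′∈ , e′) = f i in _ , product i′∈ j refl ,
      trans (*-congˡ e) (trans (sym (*-assoc _ _ _)) (trans (*-congʳ e′) (*-assoc _ _ _)))
    scale f (add p q e) = let (_ , p′ , e₁) = scale f p ; (_ , q′ , e₂) = scale f q in
      _ , add p′ q′ refl ,
      trans (*-congˡ e) (trans (distribˡ _ _ _) (trans (+-cong e₁ e₂) (sym (distribˡ _ _ _))))

  ∙-congʳ : ∀ {I I′ J} → I ~ I′ → I ∙ J ~ I′ ∙ J
  ∙-congʳ p = record
    { a-regular = a-regular p ; b-regular = b-regular p ; to = scale (to p) ; from = scale (from p) }

  ~-comm : ∀ {I J} → I ∙ J ~ J ∙ I
  ~-comm = ~-fromEquality ∙-comm ∙-comm

  ∙-congˡ : ∀ {I J J′} → J ~ J′ → I ∙ J ~ I ∙ J′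
  ∙-congˡ p = ~-trans ~-comm (~-trans (∙-congʳ p) ~-comm)

  ~-assoc : ∀ {I J K} → (I ∙ J) ∙ K ~ I ∙ (J ∙ K)
  ~-assoc = ~-fromEquality ∙-assoc λ p →
    ∙-mono ∙-comm (λ z → z) (∙-comm (∙-assoc (∙-mono ∙-comm (λ z → z) (∙-comm p))))

  Unit : Subset
  Unit _ = ⊤

  ~-identityˡ : ∀ {J} → IsIdeal J → Unit ∙ J ~ J
  ~-identityˡ idealJ = ~-fromEquality
    (∙-⊆ idealJ (λ _ j → IsIdeal.multiple idealJ _ j))
    (λ j → product {i = 1#} tt j (sym (*-identityˡ _)))

  -- Because these r form an ideal, an inclusion a I ⊆ b J has to be checked on generators of I
  -- only.
  quotient-isIdeal : ∀ {J} a b → IsIdeal J → IsIdeal (λ r → ∃[ j ] J j × a * r ≈ b * j)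
  quotient-isIdeal a b idealJ = record
    { sum = λ { (i , i∈ , e) (j , j∈ , e′) → i + j , J.sum i∈ j∈ ,
        trans (distribˡ _ _ _) (trans (+-cong e e′) (sym (distribˡ _ _ _))) }
    ; multiple = λ { t {r} (j , j∈ , e) → t * j , J.multiple t j∈ , (begin
        a * (t * r) ≈⟨ solve 3 (λ a t r → a :* (t :* r) := t :* (a :* r)) refl a t r ⟩
        t * (a * r) ≈⟨ *-congˡ e ⟩
        t * (b * j) ≈⟨ solve 3 (λ a t r → a :* (t :* r) := t :* (a :* r)) refl t b j ⟩
        b * (t * j) ∎) }
    ; respects = λ { e (j , j∈ , e′) → j , j∈ , trans (*-congˡ (sym e)) e′ } }
    where module J = IsIdeal idealJ

  ⟨⟩-shift : ∀ {g h h′} u → h′ ≈ h + u * g → ⟨ g , h′ ⟩ ⊆ ⟨ g , h ⟩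
  ⟨⟩-shift {g} {h} u e = ⟨⟩-⊆ ⟨⟩-isIdeal generatorˡ (combination u 1#
    (trans e (trans (+-comm _ _) (+-congˡ (sym (*-identityˡ h))))))

  ⟨⟩-unshift : ∀ {g h h′} u → h′ ≈ h + u * g → ⟨ g , h ⟩ ⊆ ⟨ g , h′ ⟩
  ⟨⟩-unshift {g} {h} {h′} u e = ⟨⟩-shift (- u) (begin
    h                       ≈⟨ solve 3 (λ g h u → h := h :+ u :* g :+ :- u :* g) refl g h u ⟩
    h + u * g + - u * g     ≈⟨ +-congʳ e ⟨
    h′ + - u * g            ∎)

  -- The divisor of ℓ is P + Q + S and that of d₃ is S + (− S).
  collinear-~ : ∀ {d₁ d₂ d₃ ℓ m} → Regular d₃ → Regular ℓ → ℓ * m ≈ d₁ * d₂ * d₃ →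
    (⟨ d₁ , ℓ ⟩ ∙ ⟨ d₂ , ℓ ⟩) ℓ → ⟨ d₁ , ℓ ⟩ ∙ ⟨ d₂ , ℓ ⟩ ~ ⟨ d₃ , m ⟩
  collinear-~ {d₁} {d₂} {d₃} {ℓ} {m} rd rℓ e ℓ∈ = record
    { a-regular = rd ; b-regular = rℓ
    ; to = ⟨⟩∙⟨⟩-⊆ (quotient-isIdeal d₃ ℓ ⟨⟩-isIdeal)
        (m , generatorʳ , trans (*-comm _ _) (sym e))
        (d₁ * d₃ , IsIdeal.multiple ⟨⟩-isIdeal d₁ generatorˡ , rearrange d₁)
        (d₂ * d₃ , IsIdeal.multiple ⟨⟩-isIdeal d₂ generatorˡ ,
          trans (*-congˡ (*-comm _ _)) (rearrange d₂))
        (ℓ * d₃ , IsIdeal.multiple ⟨⟩-isIdeal ℓ generatorˡ , rearrange ℓ)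
    ; from = ⟨⟩-⊆ (quotient-isIdeal ℓ d₃ (∙-isIdeal ⟨⟩-isIdeal))
        (ℓ , ℓ∈ , *-comm _ _)
        (d₁ * d₂ , product generatorˡ generatorˡ refl , trans e (*-comm _ _)) }
    where
    rearrange : ∀ x → d₃ * (x * ℓ) ≈ ℓ * (x * d₃)
    rearrange x = solve 3 (λ d ℓ x → d :* (x :* ℓ) := ℓ :* (x :* d)) refl d₃ ℓ x

  subtract : ∀ {I r s} → IsIdeal I → I r → I s → I (r - s)
  subtract ideal p q = IsIdeal.sum ideal p (IsIdeal.respects ideal (-1*x≈-x _) (IsIdeal.multiple ideal (- 1#) q))
    where open import Algebra.Properties.Ring ring using (-1*x≈-x)

  cancelUnit : ∀ {I a b r} → IsIdeal I → b * a ≈ 1# → I (a * r) → I r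
  cancelUnit {I} {a} {b} {r} ideal e p = IsIdeal.respects ideal
    (trans (sym (*-assoc b a r)) (trans (*-congʳ e) (*-identityˡ r))) (IsIdeal.multiple ideal b p)

open ≡ using (refl; sym; trans; cong; cong₂; subst; subst₂; isEquivalence; module ≡-Reasoning)
open import Defs

-- The group law on an elliptic curve

IsRing : ∀ {ℓ} → Structure ℓ → Set ℓ
IsRing M = IsCommutativeRing {A = ∣ M ∣} _≡_ (Structure._+_ M) (Structure._*_ M) (Structure.-_ M)
  (Structure.0# M) (Structure.1# M)

commutativeRing : ∀ {ℓ} (M : Structure ℓ) → IsRing M → CommutativeRing ℓ ℓ
commutativeRing M isRing = record { isCommutativeRing = isRing }

module EllipticCurve {ℓ} (M : Structure ℓ) (isRing : IsRing M)
  (isField : IsDecidableField (commutativeRing M isRing))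
  (x+x≡0⇒x≡0 : ∀ x → Structure._+_ M x x ≡ Structure.0# M → x ≡ Structure.0# M)
  (A B : ∣ M ∣) (nonsingular : Nonsingular M A B) where

  F : CommutativeRing ℓ ℓ
  F = commutativeRing M isRing

  open CommutativeRing F using (_+_; _*_; -_; _-_; 0#; 1#)
  private
    module F = CommutativeRing F
    open import Algebra.Properties.Ring F.ring using (-0#≈0#; -‿involutive)
    open import Algebra.Properties.Group F.+-group using (x∙y⁻¹≈ε⇒x≈y; inverseʳ-unique)
  open IsDecidableField isField
  open ℤCoefficientSolver F

  OnCurve : ∣ M ∣ → ∣ M ∣ → Set ℓ
  OnCurve x y = y * y ≡ x * x * x + A * x + B

  -- y = s x + a meets the curve in (x₁, y₁), (x₂, y₂) and (x₃, − y₃), the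
  -- x-coordinates being the roots of x³ + A x + B − (s x + a)².
  record Collinear (x₁ y₁ x₂ y₂ x₃ y₃ s a : ∣ M ∣) : Set ℓ where
    field
      on₁ : y₁ ≡ s * x₁ + a
      on₂ : y₂ ≡ s * x₂ + a
      on₃ : - y₃ ≡ s * x₃ + a
      e₁  : s * s ≡ x₁ + x₂ + x₃
      e₂  : A ≡ (s * a + s * a) + (x₁ * x₂ + x₁ * x₃ + x₂ * x₃)
      e₃  : B + x₁ * x₂ * x₃ ≡ a * a

  module _ {x₁ y₁ s : ∣ M ∣} where
    private
      a = y₁ - s * x₁

      on₁ : y₁ ≡ s * x₁ + a
      on₁ = solve 3 (λ y s x → y := s :* x :+ (y :- s :* x)) refl y₁ s x₁

    module _ (x₂ : ∣ M ∣) where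
      private
        x₃ = s * s + - x₁ + - x₂
        y₃ = s * (x₁ + - x₃) + - y₁

        -- By the choice of x₃ the quadratic terms agree, so x³ + A x + B - (s x + a)² equals (x -
        -- x₁)(x - x₂)(x - x₃) + β x + α. Collinearity amounts to β = α = 0.
        β α : ∣ M ∣
        β = A - ((s * a + s * a) + (x₁ * x₂ + x₁ * x₃ + x₂ * x₃))
        α = (B + x₁ * x₂ * x₃) - a * a

        e₁ : s * s ≡ x₁ + x₂ + x₃
        e₁ = solve 3 (λ s x y → s :* s := x :+ y :+ (s :* s :+ :- x :+ :- y)) refl s x₁ x₂

        on₃ : - y₃ ≡ s * x₃ + a
        on₃ = solve 4 (λ s x₁ x₃ y → :- (s :* (x₁ :+ :- x₃) :+ :- y) := s :* x₃ :+ (y :- s :* x₁)) refl s x₁ x₃ y₁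

        remainder : ∀ x y → x ≡ x₁ ⊎ x ≡ x₂ → y ≡ s * x + a → OnCurve x y → β * x + α ≡ 0#
        remainder x y x∈ on e = trans (identity x x∈)
          (trans (cong₂ _-_ (sym e) (cong₂ _*_ (sym on) (sym on))) (F.-‿inverseʳ (y * y)))
          where
          identity : ∀ x → x ≡ x₁ ⊎ x ≡ x₂ →
            β * x + α ≡ (x * x * x + A * x + B) - (s * x + a) * (s * x + a)
          identity x (inj₁ refl) = solve 6 (λ A B s a x₁ x₂ →
            let x₃ = s :* s :+ :- x₁ :+ :- x₂ in
            (A :- ((s :* a :+ s :* a) :+ (x₁ :* x₂ :+ x₁ :* x₃ :+ x₂ :* x₃))) :* x₁ :+
              ((B :+ x₁ :* x₂ :* x₃) :- a :* a) :=
            (x₁ :* x₁ :* x₁ :+ A :* x₁ :+ B) :- (s :* x₁ :+ a) :* (s :* x₁ :+ a))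
            refl A B s a x₁ x₂
          identity x (inj₂ refl) = solve 6 (λ A B s a x₁ x₂ →
            let x₃ = s :* s :+ :- x₁ :+ :- x₂ in
            (A :- ((s :* a :+ s :* a) :+ (x₁ :* x₂ :+ x₁ :* x₃ :+ x₂ :* x₃))) :* x₂ :+
              ((B :+ x₁ :* x₂ :* x₃) :- a :* a) :=
            (x₂ :* x₂ :* x₂ :+ A :* x₂ :+ B) :- (s :* x₂ :+ a) :* (s :* x₂ :+ a))
            refl A B s a x₁ x₂

        build : OnCurve x₁ y₁ → β ≡ 0# → ∀ {y₂} → y₂ ≡ s * x₂ + a →
          Collinear x₁ y₁ x₂ y₂ x₃ y₃ s a
        build c₁ β≡0 on₂ = record
          { on₁ = on₁ ; on₂ = on₂ ; on₃ = on₃ ; e₁ = e₁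
          ; e₂ = x∙y⁻¹≈ε⇒x≈y _ _ β≡0
          ; e₃ = x∙y⁻¹≈ε⇒x≈y _ _ (trans (sym (F.+-identityˡ α))
                   (trans (cong (_+ α) (sym (trans (cong (_* x₁) β≡0) (F.zeroˡ x₁))))
                          (remainder x₁ y₁ (inj₁ refl) on₁ c₁))) }

      -- The linear polynomial β x + α has the two distinct roots x₁ and x₂, hence β = 0, and then α
      -- = 0 from either root.
      chord-collinear : ∀ {y₂} → OnCurve x₁ y₁ → OnCurve x₂ y₂ → ¬ x₁ ≡ x₂ →
        s * (x₂ + - x₁) ≡ y₂ + - y₁ → Collinear x₁ y₁ x₂ y₂ x₃ y₃ s a
      chord-collinear {y₂} c₁ c₂ x₁≢x₂ slope = build c₁ β≡0 on₂
        where
        on₂ : y₂ ≡ s * x₂ + a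
        on₂ = trans (solve 2 (λ y₂ y₁ → y₂ := (y₂ :+ :- y₁) :+ y₁) refl y₂ y₁)
          (trans (cong (_+ y₁) (sym slope))
            (solve 4 (λ s x₁ x₂ y → s :* (x₂ :+ :- x₁) :+ y := s :* x₂ :+ (y :- s :* x₁)) refl s x₁ x₂ y₁))

        β≡0 : β ≡ 0#
        β≡0 = *-cancelˡ (λ e → x₁≢x₂ (x∙y⁻¹≈ε⇒x≈y _ _ e)) (begin
          (x₁ - x₂) * β
            ≡⟨ solve 4 (λ x y b a → (x :- y) :* b := (b :* x :+ a) :- (b :* y :+ a)) refl x₁ x₂ β α ⟩
          (β * x₁ + α) - (β * x₂ + α)
            ≡⟨ cong₂ _-_ (remainder x₁ y₁ (inj₁ refl) on₁ c₁) (remainder x₂ y₂ (inj₂ refl) on₂ c₂) ⟩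
          0# - 0#                          ≡⟨ F.-‿inverseʳ 0# ⟩
          0#                               ≡⟨ F.zeroʳ (x₁ - x₂) ⟨
          (x₁ - x₂) * 0#                   ∎)
          where open ≡.≡-Reasoning

      -- With x₁ = x₂ there is only one root at hand, but β is then literally 3 x₁² + A - s (2 y₁),
      -- which the slope equation makes zero. The constants `con (ℤ.+ 2)` and `con (ℤ.+ 3)` evaluate
      -- to `fromℕ M 2` and `fromℕ M 3` by computation.
      tangent-collinear : ∀ {y₂} → OnCurve x₁ y₁ → x₁ ≡ x₂ → y₁ ≡ y₂ →
        s * (fromℕ M 2 * y₁) ≡ fromℕ M 3 * (x₁ * x₁) + A → Collinear x₁ y₁ x₂ y₂ x₃ y₃ s a
      tangent-collinear c refl refl slope = build c
        (trans (solve 4 (λ A s x y →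
            let a = y :- s :* x ; x₃ = s :* s :+ :- x :+ :- x in
            A :- ((s :* a :+ s :* a) :+ (x :* x :+ x :* x₃ :+ x :* x₃)) :=
            (con (ℤ.+ 3) :* (x :* x) :+ A) :- s :* (con (ℤ.+ 2) :* y)) refl A s x₁ y₁)
          (trans (cong (λ u → fromℕ M 3 * (x₁ * x₁) + A - u) slope) (F.-‿inverseʳ _)))
        on₁

  collinear-onCurve : ∀ {x₁ y₁ x₂ y₂ x₃ y₃ s a} → Collinear x₁ y₁ x₂ y₂ x₃ y₃ s a → OnCurve x₃ y₃
  collinear-onCurve {x₁} {y₁} {x₂} {y₂} {x₃} {y₃} {s} {a} col = begin
    y₃ * y₃                                   ≡⟨ solve 1 (λ y → y :* y := :- y :* :- y) refl y₃ ⟩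
    - y₃ * - y₃                               ≡⟨ cong₂ _*_ on₃ on₃ ⟩
    (s * x₃ + a) * (s * x₃ + a)               ≡⟨ solve 3 (λ s a x → (s :* x :+ a) :* (s :* x :+ a) :=
                                                   s :* s :* (x :* x) :+ (s :* a :+ s :* a) :* x :+ a :* a) refl s a x₃ ⟩
    s * s * (x₃ * x₃) + (s * a + s * a) * x₃ + a * a
      ≡⟨ cong₂ (λ u v → u * (x₃ * x₃) + (s * a + s * a) * x₃ + v) e₁ (sym e₃) ⟩
    (x₁ + x₂ + x₃) * (x₃ * x₃) + (s * a + s * a) * x₃ + (B + x₁ * x₂ * x₃)
      ≡⟨ solve 5 (λ x₁ x₂ x₃ c B →
           (x₁ :+ x₂ :+ x₃) :* (x₃ :* x₃) :+ c :* x₃ :+ (B :+ x₁ :* x₂ :* x₃) :=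
           x₃ :* x₃ :* x₃ :+ (c :+ (x₁ :* x₂ :+ x₁ :* x₃ :+ x₂ :* x₃)) :* x₃ :+ B)
           refl x₁ x₂ x₃ (s * a + s * a) B ⟩
    x₃ * x₃ * x₃ + ((s * a + s * a) + (x₁ * x₂ + x₁ * x₃ + x₂ * x₃)) * x₃ + B
      ≡⟨ cong (λ u → x₃ * x₃ * x₃ + u * x₃ + B) e₂ ⟨
    x₃ * x₃ * x₃ + A * x₃ + B ∎
    where
    open Collinear col
    open ≡.≡-Reasoning

  y≡-y⇒y≡0 : ∀ {y} → y ≡ - y → y ≡ 0#
  y≡-y⇒y≡0 {y} e = x+x≡0⇒x≡0 y (trans (cong (λ u → y + u) e) (F.-‿inverseʳ y))

  2y≢0 : ∀ {y} → ¬ y ≡ - y → ¬ fromℕ M 2 * y ≡ 0#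
  2y≢0 {y} ne e = ne (trans y≡0 (trans (sym -0#≈0#) (cong -_ (sym y≡0))))
    where
    y≡0 : y ≡ 0#
    y≡0 = x+x≡0⇒x≡0 y (trans (solve 1 (λ y → y :+ y := con (ℤ.+ 2) :* y) refl y) e)

  sum-exists : ∀ P Q → ∃[ R ] ChordTangent M A B P Q R
  sum-exists O Q = Q , identityˡ refl
  sum-exists P@(affine _ _ _) O = P , identityʳ refl
  sum-exists (affine x₁ y₁ c₁) (affine x₂ y₂ c₂) with x₁ ≟ x₂
  ... | no x₁≢x₂ = affine _ _ (collinear-onCurve (chord-collinear x₂ c₁ c₂ x₁≢x₂ slope)) ,
                   chord s x₁≢x₂ slope refl refl
    where
    inv = inverse (x₂ + - x₁) (λ e → x₁≢x₂ (sym (x∙y⁻¹≈ε⇒x≈y _ _ e)))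
    s = (y₂ + - y₁) * proj₁ inv
    slope : s * (x₂ + - x₁) ≡ y₂ + - y₁
    slope = trans (F.*-assoc _ _ _) (trans (cong ((y₂ + - y₁) *_) (trans (F.*-comm _ _) (proj₂ inv))) (F.*-identityʳ _))
  ... | yes refl with y₁ ≟ (- y₂)
  ...   | yes e = O , opposite refl e
  ...   | no y₁≢-y₂ = affine _ _ (collinear-onCurve (tangent-collinear x₁ c₁ refl y₁≡y₂ slope)) ,
                      tangent s refl y₁≡y₂ y₁≢-y₂ slope refl refl
    where
    -- Equal abscissas give (y₁ + y₂)(y₁ - y₂) = y₁² - y₂² = 0, and the first factor is nonzero.
    y₁≡y₂ : y₁ ≡ y₂
    y₁≡y₂ = x∙y⁻¹≈ε⇒x≈y _ _ (*-cancelˡ {y₁ + y₂}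
      (λ e → y₁≢-y₂ (trans (x∙y⁻¹≈ε⇒x≈y y₁ (- y₂) (trans (cong (λ u → y₁ + u) (-‿involutive y₂)) e)) refl))
      (trans (solve 2 (λ x y → (x :+ y) :* (x :- y) := x :* x :- y :* y) refl y₁ y₂)
        (trans (cong₂ _-_ c₁ c₂) (trans (F.-‿inverseʳ _) (sym (F.zeroʳ _))))))
    inv = inverse (fromℕ M 2 * y₁) (2y≢0 (λ e → y₁≢-y₂ (trans e (cong -_ y₁≡y₂))))
    n = fromℕ M 3 * (x₁ * x₁) + A
    s = n * proj₁ inv
    slope : s * (fromℕ M 2 * y₁) ≡ n
    slope = trans (F.*-assoc _ _ _) (trans (cong (n *_) (trans (F.*-comm _ _) (proj₂ inv))) (F.*-identityʳ _))

  -- The map from points to ideal classes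

  module ClassOfPoint (K : CoordinateRing F A B) where
    open CoordinateRing K using (ι; ι-cong; ι-+; ι-*; ι-neg; ι-1; X; Y; curve; cancel; X-a≉0; Y-sX-a≉0; divisor-constant)
    private module R = CommutativeRing (CoordinateRing.ring K)
    open IdealClasses (CoordinateRing.ring K)
    private module RS = ℤCoefficientSolver (CoordinateRing.ring K)

    maximal : ∣ M ∣ → ∣ M ∣ → Subset
    maximal x y = ⟨ X R.- ι x , Y R.- ι y ⟩

    class : Maybe (∣ M ∣ × ∣ M ∣) → Subset
    class nothing        = Unit
    class (just (x , y)) = maximal x y

    Class : Point M A B → Subset
    Class P = class (coords M A B P)

    unit-isIdeal : IsIdeal Unit
    unit-isIdeal = record { sum = λ _ _ → tt ; multiple = λ _ _ → tt ; respects = λ _ _ → tt }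

    class-isIdeal : ∀ c → IsIdeal (class c)
    class-isIdeal nothing  = unit-isIdeal
    class-isIdeal (just _) = ⟨⟩-isIdeal

    private
      ι-sub : ∀ u v → ι (u - v) R.≈ ι u R.- ι v
      ι-sub u v = R.trans (ι-+ u (- v)) (R.+-congˡ (ι-neg v))

      ι-unit : ∀ {u} → ¬ u ≡ 0# → ∃[ b ] b R.* ι u R.≈ R.1#
      ι-unit {u} u≢0 = let (v , e) = inverse u u≢0 in
        ι v , R.trans (R.sym (ι-* v u)) (R.trans (ι-cong (trans (F.*-comm v u) e)) ι-1)

      ι-line : ∀ {y s x a} → y ≡ s * x + a → ι y R.≈ ι s R.* ι x R.+ ι a
      ι-line {s = s} {x} {a} e = R.trans (ι-cong e) (R.trans (ι-+ _ _) (R.+-congʳ (ι-* s x)))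

    module _ {x₁ y₁ x₂ y₂ x₃ y₃ s a : ∣ M ∣} (col : Collinear x₁ y₁ x₂ y₂ x₃ y₃ s a) where
      open Collinear col
      private
        ξ₁ = ι x₁
        ξ₂ = ι x₂
        ξ₃ = ι x₃
        σ = ι s
        α = ι a
        L = σ R.* X R.+ α
        ℓ′ = Y R.- L
        m  = Y R.+ L
        d₁ = X R.- ξ₁
        d₂ = X R.- ξ₂
        d₃ = X R.- ξ₃

        σσ : σ R.* σ R.≈ ξ₁ R.+ ξ₂ R.+ ξ₃
        σσ = R.trans (R.sym (ι-* s s)) (R.trans (ι-cong e₁) (R.trans (ι-+ _ _) (R.+-congʳ (ι-+ _ _))))

        ιA : ι A R.≈ (σ R.* α R.+ σ R.* α) R.+ (ξ₁ R.* ξ₂ R.+ ξ₁ R.* ξ₃ R.+ ξ₂ R.* ξ₃)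
        ιA = R.trans (ι-cong e₂) (R.trans (ι-+ _ _) (R.+-cong
          (R.trans (ι-+ _ _) (R.+-cong (ι-* s a) (ι-* s a)))
          (R.trans (ι-+ _ _) (R.+-cong (R.trans (ι-+ _ _) (R.+-cong (ι-* _ _) (ι-* _ _))) (ι-* _ _)))))

        αα : ι B R.+ ξ₁ R.* ξ₂ R.* ξ₃ R.≈ α R.* α
        αα = R.trans (R.sym (R.trans (ι-+ _ _) (R.+-congˡ (R.trans (ι-* _ _) (R.*-congʳ (ι-* _ _))))))
          (R.trans (ι-cong e₃) (ι-* a a))

        -- `m` is the conjugate of `ℓ′` under Y ↦ - Y, so the product is the norm X³ + A X + B - L²,
        -- whose three roots are recorded in `Collinear`.
        line-divisor : ℓ′ R.* m R.≈ d₁ R.* d₂ R.* d₃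
        line-divisor = begin
          ℓ′ R.* m
            ≈⟨ RS.solve 4 (λ X Y s a → (Y RS.:- (s RS.:* X RS.:+ a)) RS.:* (Y RS.:+ (s RS.:* X RS.:+ a)) RS.:=
                 Y RS.:* Y RS.:- (s RS.:* s RS.:* (X RS.:* X) RS.:+ (s RS.:* a RS.:+ s RS.:* a) RS.:* X RS.:+ a RS.:* a))
                 R.refl X Y σ α ⟩
          Y R.* Y R.- (σ R.* σ R.* (X R.* X) R.+ c R.* X R.+ α R.* α)
            ≈⟨ R.+-cong (R.trans curve (R.+-congʳ (R.+-congˡ (R.*-congʳ ιA))))
                 (R.-‿cong (R.+-cong (R.+-congʳ (R.*-congʳ σσ)) (R.sym αα))) ⟩
          (X R.* X R.* X R.+ (c R.+ e) R.* X R.+ ι B) R.-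
            ((ξ₁ R.+ ξ₂ R.+ ξ₃) R.* (X R.* X) R.+ c R.* X R.+ (ι B R.+ ξ₁ R.* ξ₂ R.* ξ₃))
            ≈⟨ RS.solve 6 (λ X x y z c B →
                 (X RS.:* X RS.:* X RS.:+ (c RS.:+ (x RS.:* y RS.:+ x RS.:* z RS.:+ y RS.:* z)) RS.:* X RS.:+ B) RS.:-
                 ((x RS.:+ y RS.:+ z) RS.:* (X RS.:* X) RS.:+ c RS.:* X RS.:+ (B RS.:+ x RS.:* y RS.:* z)) RS.:=
                 (X RS.:- x) RS.:* (X RS.:- y) RS.:* (X RS.:- z)) R.refl X ξ₁ ξ₂ ξ₃ c (ι B) ⟩
          d₁ R.* d₂ R.* d₃ ∎
          where
          open import Relation.Binary.Reasoning.Setoid R.setoid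
          c = σ R.* α R.+ σ R.* α
          e = ξ₁ R.* ξ₂ R.+ ξ₁ R.* ξ₃ R.+ ξ₂ R.* ξ₃

        shift : ∀ {x y} → y ≡ s * x + a → ℓ′ R.≈ (Y R.- ι y) R.+ (R.- σ) R.* (X R.- ι x)
        shift {x} on = R.trans
          (RS.solve 5 (λ X Y s a x → Y RS.:- (s RS.:* X RS.:+ a) RS.:=
             (Y RS.:- (s RS.:* x RS.:+ a)) RS.:+ (RS.:- s) RS.:* (X RS.:- x)) R.refl X Y σ α (ι x))
          (R.+-congʳ (R.+-congˡ (R.-‿cong (R.sym (ι-line on)))))

        shift₃ : m R.≈ (Y R.- ι y₃) R.+ σ R.* (X R.- ξ₃)
        shift₃ = R.trans
          (RS.solve 5 (λ X Y s a x → Y RS.:+ (s RS.:* X RS.:+ a) RS.:=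
             (Y RS.:+ (s RS.:* x RS.:+ a)) RS.:+ s RS.:* (X RS.:- x)) R.refl X Y σ α ξ₃)
          (R.+-congʳ (R.+-congˡ (R.trans (R.sym (ι-line on₃)) (ι-neg y₃))))

        product-ideal : Subset
        product-ideal = ⟨ d₁ , ℓ′ ⟩ ∙ ⟨ d₂ , ℓ′ ⟩

        d₁d₂∈ : product-ideal (d₁ R.* d₂)
        d₁d₂∈ = product generatorˡ generatorˡ R.refl
        d₁ℓ∈ : product-ideal (d₁ R.* ℓ′)
        d₁ℓ∈ = product generatorˡ generatorʳ R.refl
        ℓd₂∈ : product-ideal (ℓ′ R.* d₂)
        ℓd₂∈ = product generatorʳ generatorˡ R.refl
        ℓℓ∈ : product-ideal (ℓ′ R.* ℓ′)
        ℓℓ∈ = product generatorʳ generatorʳ R.refl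

        ideal : IsIdeal product-ideal
        ideal = ∙-isIdeal ⟨⟩-isIdeal

      -- This membership is the hypothesis that `collinear-~` leaves open. The combination ℓ′ d₂ -
      -- d₁ ℓ′ = (ξ₁ - ξ₂) ℓ′ is a unit multiple of ℓ′.
      line∈-chord : ¬ x₁ ≡ x₂ → product-ideal ℓ′
      line∈-chord x₁≢x₂ = cancelUnit ideal (proj₂ (ι-unit (λ e → x₁≢x₂ (x∙y⁻¹≈ε⇒x≈y _ _ e))))
        (IsIdeal.respects ideal
          (R.trans (RS.solve 4 (λ X x y l → l RS.:* (X RS.:- y) RS.:- (X RS.:- x) RS.:* l RS.:= (x RS.:- y) RS.:* l)
                      R.refl X ξ₁ ξ₂ ℓ′)
                   (R.*-congʳ (R.sym (ι-sub x₁ x₂))))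
          (subtract ideal ℓd₂∈ d₁ℓ∈))

      -- Here ξ₁ - ξ₂ may vanish, so a unit is made from the ordinate instead. Since m - ℓ′ = 2 L,
      -- the element ℓ′ m - 2 σ d₁ ℓ′ - ℓ′² is (2 L - 2 σ d₁) ℓ′ = 2 y₁ ℓ′, and ℓ′ m = d₁ d₂ d₃ lies
      -- in the ideal.
      line∈-tangent : ¬ y₁ ≡ - y₁ → product-ideal ℓ′
      line∈-tangent y≢-y = cancelUnit ideal
        (proj₂ (ι-unit {y₁ + y₁} (λ e → y≢-y (inverseʳ-unique _ _ e))))
        (IsIdeal.respects ideal
          (begin
            (d₃ R.* (d₁ R.* d₂) R.- (σ R.+ σ) R.* (d₁ R.* ℓ′)) R.- ℓ′ R.* ℓ′
              ≈⟨ R.+-congʳ (R.+-congʳ (R.trans (R.*-comm _ _) (R.sym line-divisor))) ⟩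
            (ℓ′ R.* m R.- (σ R.+ σ) R.* (d₁ R.* ℓ′)) R.- ℓ′ R.* ℓ′
              ≈⟨ RS.solve 5 (λ X Y s a x →
                   let L = s RS.:* X RS.:+ a ; l = Y RS.:- L ; y = s RS.:* x RS.:+ a in
                   (l RS.:* (Y RS.:+ L) RS.:- (s RS.:+ s) RS.:* ((X RS.:- x) RS.:* l)) RS.:- l RS.:* l RS.:=
                   (y RS.:+ y) RS.:* l) R.refl X Y σ α ξ₁ ⟩
            ((σ R.* ξ₁ R.+ α) R.+ (σ R.* ξ₁ R.+ α)) R.* ℓ′
              ≈⟨ R.*-congʳ (R.+-cong (ι-line on₁) (ι-line on₁)) ⟨
            (ι y₁ R.+ ι y₁) R.* ℓ′
              ≈⟨ R.*-congʳ (ι-+ y₁ y₁) ⟨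
            ι (y₁ + y₁) R.* ℓ′ ∎)
          (subtract ideal (subtract ideal (IsIdeal.multiple ideal d₃ d₁d₂∈)
                                          (IsIdeal.multiple ideal (σ R.+ σ) d₁ℓ∈)) ℓℓ∈))
        where open import Relation.Binary.Reasoning.Setoid R.setoid

      -- Modulo X - x the line ℓ′ may replace Y - y as second generator at any point on it. The
      -- third intersection point is (x₃ , - y₃), so at the sum (x₃ , y₃) it is the conjugate line m
      -- that vanishes.
      collinear-class : product-ideal ℓ′ → maximal x₁ y₁ ∙ maximal x₂ y₂ ~ maximal x₃ y₃
      collinear-class ℓ∈ = ~-trans
        (~-fromEquality (∙-mono (⟨⟩-unshift _ (shift on₁)) (⟨⟩-unshift _ (shift on₂)))
                        (∙-mono (⟨⟩-shift _ (shift on₁)) (⟨⟩-shift _ (shift on₂))))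
        (~-trans (collinear-~ (cancel (X-a≉0 x₃)) (cancel (Y-sX-a≉0 s a)) line-divisor ℓ∈)
          (~-fromEquality (⟨⟩-shift σ shift₃) (⟨⟩-unshift σ shift₃)))

    -- Three of the four products of generators are visibly multiples of d, and h h′ = Y² - y²
    -- becomes one by the two curve equations. Nonsingularity enters in the converse inclusion `d∈`.
    opposite-class : ∀ {x y} → OnCurve x y → maximal x y ∙ maximal x (- y) ~ Unit
    opposite-class {x} {y} on = record
      { a-regular = regular-1 ; b-regular = cancel (X-a≉0 x)
      ; to = ⟨⟩∙⟨⟩-⊆ (quotient-isIdeal R.1# d unit-isIdeal)
          (d , tt , R.*-identityˡ _) (h′ , tt , R.*-identityˡ _)
          (h , tt , R.trans (R.*-identityˡ _) (R.*-comm h d))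
          (g , tt , R.trans (R.*-identityˡ _) hh′)
      ; from = λ {u} _ → u R.* d , IsIdeal.multiple ideal u d∈ ,
          R.trans (R.*-comm d u) (R.sym (R.*-identityˡ _)) }
      where
      ξ = ι x
      η = ι y
      d = X R.- ξ
      h = Y R.- η
      h′ = Y R.- ι (- y)
      -- The quotient of (X³ + A X) - (x³ + A x) by X - x; at X = x it is the derivative 3 x² + A.
      g = X R.* X R.+ X R.* ξ R.+ ξ R.* ξ R.+ ι A

      ideal : IsIdeal (maximal x y ∙ maximal x (- y))
      ideal = ∙-isIdeal ⟨⟩-isIdeal

      on′ : η R.* η R.≈ ξ R.* ξ R.* ξ R.+ ι A R.* ξ R.+ ι B
      on′ = R.trans (R.sym (ι-* y y)) (R.trans (ι-cong on) (R.trans (ι-+ _ _) (R.+-congʳ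
        (R.trans (ι-+ _ _) (R.+-cong (R.trans (ι-* _ _) (R.*-congʳ (ι-* x x))) (ι-* A x))))))

      h′≈ : h′ R.≈ Y R.- (R.- η)
      h′≈ = R.+-congˡ (R.-‿cong (ι-neg y))

      hh′ : h R.* h′ R.≈ d R.* g
      hh′ = R.trans (R.*-congˡ h′≈)
        (R.trans (RS.solve 2 (λ Y y → (Y RS.:- y) RS.:* (Y RS.:- (RS.:- y)) RS.:= Y RS.:* Y RS.:- y RS.:* y) R.refl Y η)
        (R.trans (R.+-cong curve (R.-‿cong on′))
        (RS.solve 4 (λ X x A B →
          (X RS.:* X RS.:* X RS.:+ A RS.:* X RS.:+ B) RS.:- (x RS.:* x RS.:* x RS.:+ A RS.:* x RS.:+ B) RS.:=
          (X RS.:- x) RS.:* (X RS.:* X RS.:+ X RS.:* x RS.:+ x RS.:* x RS.:+ A)) R.refl X ξ (ι A) (ι B))))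

      -- A common zero of the cubic and its derivative forces A = - 3 x² and B = 2 x³, so that 4 A³
      -- + 27 B² = - 108 x⁶ + 108 x⁶ = 0.
      derivative≢0 : y ≡ 0# → ¬ x * x + x * x + x * x + A ≡ 0#
      derivative≢0 refl e = nonsingular (trans
        (cong₂ (λ A B → fromℕ M 4 * (A * A * A) + fromℕ M 27 * (B * B)) A≡ B≡)
        (solve 1 (λ x → let A = :- (x :* x :+ x :* x :+ x :* x) ; B = x :* x :* x :+ x :* x :* x in
           con (ℤ.+ 4) :* (A :* A :* A) :+ con (ℤ.+ 27) :* (B :* B) := con ℤ.0ℤ) refl x))
        where
        A≡ : A ≡ - (x * x + x * x + x * x)
        A≡ = inverseʳ-unique _ _ e
        B≡ : B ≡ x * x * x + x * x * x
        B≡ = trans (solve 3 (λ x A B → B := (x :* x :* x :+ A :* x :+ B) :- (x :* x :* x :+ A :* x)) refl x A B)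
          (trans (cong₂ (λ u A → u - (x * x * x + A * x)) (trans (sym on) (F.zeroˡ 0#)) A≡)
            (solve 1 (λ x → con ℤ.0ℤ :- (x :* x :* x :+ (:- (x :* x :+ x :* x :+ x :* x)) :* x) :=
               x :* x :* x :+ x :* x :* x) refl x))

      d∈ : (maximal x y ∙ maximal x (- y)) d
      d∈ with y ≟ (- y)
      -- d h′ - h d = 2 η d, where 2 y is invertible.
      ... | no y≢-y = cancelUnit ideal (proj₂ (ι-unit {y + y} (λ e → y≢-y (inverseʳ-unique _ _ e))))
        (IsIdeal.respects ideal
          (R.trans (R.+-congʳ (R.*-congˡ h′≈))
            (R.trans (RS.solve 3 (λ d Y y → d RS.:* (Y RS.:- (RS.:- y)) RS.:- (Y RS.:- y) RS.:* d RS.:= (y RS.:+ y) RS.:* d)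
                       R.refl d Y η)
              (R.*-congʳ (R.sym (ι-+ y y)))))
          (subtract ideal (product generatorˡ generatorʳ R.refl) (product generatorʳ generatorˡ R.refl)))
      -- For y = 0 use h h′ - (X + 2 ξ) d² = (3 ξ² + A) d, with a coefficient that is nonzero by
      -- nonsingularity.
      ... | yes e = cancelUnit ideal (proj₂ (ι-unit (derivative≢0 (y≡-y⇒y≡0 e))))
        (IsIdeal.respects ideal
          (R.trans (R.+-congʳ hh′)
            (R.trans (RS.solve 3 (λ X x A → let d = X RS.:- x in
                d RS.:* (X RS.:* X RS.:+ X RS.:* x RS.:+ x RS.:* x RS.:+ A) RS.:-
                (X RS.:+ (x RS.:+ x)) RS.:* (d RS.:* d) RS.:=
                (x RS.:* x RS.:+ x RS.:* x RS.:+ x RS.:* x RS.:+ A) RS.:* d) R.refl X ξ (ι A))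
              (R.*-congʳ (R.sym (R.trans (ι-+ _ _) (R.+-congʳ (R.trans (ι-+ _ _)
                (R.+-cong (R.trans (ι-+ _ _) (R.+-cong (ι-* x x) (ι-* x x))) (ι-* x x)))))))))
          (subtract ideal (product generatorʳ generatorʳ R.refl)
            (IsIdeal.multiple ideal (X R.+ (ξ R.+ ξ)) (product generatorˡ generatorˡ R.refl))))

    class-homomorphic : ∀ {P Q R} → ChordTangent M A B P Q R → Class P ∙ Class Q ~ Class R
    class-homomorphic {Q = Q} {R} (identityˡ e) =
      subst (λ c → Unit ∙ Class Q ~ class c) e (~-identityˡ (class-isIdeal (coords M A B Q)))
    class-homomorphic {P} (identityʳ e) =
      subst (λ c → Class P ∙ Unit ~ class c) e (~-trans ~-comm (~-identityˡ (class-isIdeal (coords M A B P))))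
    class-homomorphic (opposite {x₁} {y₁} {x₂} {y₂} {e₁} refl y₁≡-y₂) =
      subst (λ y → maximal x₁ y₁ ∙ maximal x₁ y ~ Unit) (trans (cong -_ y₁≡-y₂) (-‿involutive y₂)) (opposite-class e₁)
    class-homomorphic (chord {x₂ = x₂} {e₁ = e₁} {e₂ = e₂} s x₁≢x₂ slope refl refl) =
      collinear-class col (line∈-chord col x₁≢x₂)
      where col = chord-collinear x₂ e₁ e₂ x₁≢x₂ slope
    class-homomorphic (tangent {x₂ = x₂} {e₁ = e₁} s x₁≡x₂ y₁≡y₂ y₁≢-y₂ slope refl refl) =
      collinear-class col (line∈-tangent col (λ e → y₁≢-y₂ (trans e (cong -_ y₁≡y₂))))
      where col = tangent-collinear x₂ e₁ x₁≡x₂ y₁≡y₂ slope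

    -- A generator of the ideal would divide X - x and Y - y, hence be constant.
    maximal-nonprincipal : ∀ {x y} → OnCurve x y → ¬ maximal x y ~ Unit
    maximal-nonprincipal {x} {y} on p with _~_.from p {R.1#} tt
    ... | r , r∈ , b≈ar with _~_.to p generatorˡ | _~_.to p generatorʳ
    ...   | s , _ , e | t , _ , e′ = c≢0 (trans (sym (ev-ι x y c)) (trans (sym (ev-cong x y r≈c)) (ev∈ r∈)))
      where
      open CoordinateRing K using (ev; ev-cong; ev-ι; ev-+; ev-*; ev-X; ev-Y)

      -- From a z = b u and b = a r the regular a cancels; applied to the two generators, it shows
      -- that r divides both.
      factor : ∀ {z u} → _~_.a p R.* z R.≈ _~_.b p R.* u → r R.* u R.≈ z
      factor {z} {u} e = R.sym (_~_.a-regular p (R.trans e (R.trans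
        (R.*-congʳ (R.trans (R.sym (R.*-identityʳ _)) b≈ar)) (R.*-assoc _ _ _))))

      scalar = divisor-constant (factor e) (factor e′)
      c = proj₁ scalar
      r≈c = proj₁ (proj₂ scalar)
      c≢0 = proj₂ (proj₂ scalar)

      ev-neg-ι : ∀ u → ev x y (R.- ι u) ≡ - u
      ev-neg-ι u = trans (ev-cong x y (R.sym (ι-neg u))) (ev-ι x y (- u))

      -- This is the contradiction: r lies in the ideal, yet evaluates to itself if it is a nonzero
      -- constant.
      ev∈ : ∀ {r} → maximal x y r → ev x y r ≡ 0#
      ev∈ (combination u v e) = begin
        ev x y _                             ≡⟨ ev-cong x y e ⟩
        ev x y (u R.* (X R.- ι x) R.+ v R.* (Y R.- ι y))
          ≡⟨ trans (ev-+ x y _ _) (cong₂ _+_ (ev-* x y on _ _) (ev-* x y on _ _)) ⟩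
        ev x y u * ev x y (X R.- ι x) + ev x y v * ev x y (Y R.- ι y)
          ≡⟨ cong₂ (λ z w → ev x y u * z + ev x y v * w)
               (trans (ev-+ x y _ _) (cong₂ _+_ (ev-X x y) (ev-neg-ι x)))
               (trans (ev-+ x y _ _) (cong₂ _+_ (ev-Y x y) (ev-neg-ι y))) ⟩
        ev x y u * (x - x) + ev x y v * (y - y)
          ≡⟨ solve 4 (λ u v x y → u :* (x :- x) :+ v :* (y :- y) := con ℤ.0ℤ) refl (ev x y u) (ev x y v) x y ⟩
        0# ∎
        where open ≡.≡-Reasoning

    ⊖_ : Point M A B → Point M A B
    ⊖ O              = O
    ⊖ (affine x y e) = affine x (- y) (trans (solve 1 (λ y → :- y :* :- y := y :* y) refl y) e)

    ⊖-inverse : ∀ P → ChordTangent M A B P (⊖ P) O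
    ⊖-inverse O              = identityˡ refl
    ⊖-inverse (affine x y e) = opposite refl (sym (-‿involutive y))

    private
      opposite⇒≈ : ∀ {S T} → ChordTangent M A B S (⊖ T) O → _≈ᴾ_ M A B S T
      opposite⇒≈ {T = O}            (identityˡ e)  = refl
      opposite⇒≈ {T = affine _ _ _} (identityˡ ())
      opposite⇒≈ {T = O}            (identityʳ e)  = e
      opposite⇒≈ {T = affine _ _ _} (opposite e f) = cong₂ (λ x y → just (x , y)) e (trans f (-‿involutive _))

      class-trivial : ∀ R → Class R ~ Unit → _≈ᴾ_ M A B R O
      class-trivial O              _ = refl
      class-trivial (affine x y e) p = ⊥-elim (maximal-nonprincipal e p)

    -- Let R be the sum of S and - T. Its class is that of T times that of - T, which is trivial.
    -- Since no affine point has trivial class, R is O, and the chord-tangent law yields O only for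
    -- opposite points.
    class-injective : ∀ {S T} → Class S ~ Class T → _≈ᴾ_ M A B S T
    class-injective {S} {T} p with sum-exists S (⊖ T)
    ... | R , ct with class-trivial R (~-trans (~-sym (class-homomorphic ct))
                        (~-trans (∙-congʳ p) (class-homomorphic (⊖-inverse T))))
    ...   | R≈O with R
    ...     | O = opposite⇒≈ ct

    -- Uniqueness of the sum comes from injectivity of the class map and so avoids comparing the
    -- constructors of `ChordTangent` pairwise.
    chordTangent-cong : ∀ {P P′ Q Q′ R R′} → _≈ᴾ_ M A B P P′ → _≈ᴾ_ M A B Q Q′ →
      ChordTangent M A B P Q R → ChordTangent M A B P′ Q′ R′ → _≈ᴾ_ M A B R R′
    chordTangent-cong {P} {P′} {Q} {Q′} {R} {R′} P≈P′ Q≈Q′ ct ct′ = class-injective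
      (~-trans (~-sym (class-homomorphic ct))
      (subst (λ q → Class P ∙ class q ~ Class R′) (sym Q≈Q′)
        (subst (λ p → class p ∙ Class Q′ ~ Class R′) (sym P≈P′) (class-homomorphic ct′))))

    ellipticGroup : EllipticGroup M A B
    ellipticGroup = record
      { _⊕_ = _⊕_
      ; ⊖_ = ⊖_
      ; isAbelianGroup = record
        { isGroup = record
          { isMonoid = record
            { isSemigroup = record
              { isMagma = record
                { isEquivalence = record { refl = refl ; sym = sym ; trans = trans }
                ; ∙-cong = λ {P} {P′} {Q} {Q′} e f → chordTangent-cong {P} {P′} {Q} {Q′} e f (ct P Q) (ct P′ Q′) }
              ; assoc = λ P Q R → class-injective (~-trans (~-sym (class-⊕ (P ⊕ Q) R))
                  (~-trans (∙-congʳ (~-sym (class-⊕ P Q))) (~-trans ~-assoc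
                  (~-trans (∙-congˡ (class-⊕ Q R)) (class-⊕ P (Q ⊕ R)))))) }
            ; identity = (λ P → chordTangent-cong {O} {O} {P} {P} refl refl (ct O P) (identityˡ refl)) ,
                         (λ P → chordTangent-cong {P} {P} {O} {O} refl refl (ct P O) (identityʳ refl)) }
          ; inverse = (λ P → trans (comm (⊖ P) P) (inverse′ P)) , inverse′
          ; ⁻¹-cong = ⊖-cong }
        ; comm = comm }
      ; chordTangent = ct }
      where
      _⊕_ : Point M A B → Point M A B → Point M A B
      P ⊕ Q = proj₁ (sum-exists P Q)

      ct : ∀ P Q → ChordTangent M A B P Q (P ⊕ Q)
      ct P Q = proj₂ (sum-exists P Q)

      class-⊕ : ∀ P Q → Class P ∙ Class Q ~ Class (P ⊕ Q)
      class-⊕ P Q = class-homomorphic (ct P Q)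

      comm : ∀ P Q → _≈ᴾ_ M A B (P ⊕ Q) (Q ⊕ P)
      comm P Q = class-injective (~-trans (~-sym (class-⊕ P Q)) (~-trans ~-comm (class-⊕ Q P)))

      inverse′ : ∀ P → _≈ᴾ_ M A B (P ⊕ (⊖ P)) O
      inverse′ P = chordTangent-cong {P} {P} {⊖ P} {⊖ P} refl refl (ct P (⊖ P)) (⊖-inverse P)

      ⊖-cong : ∀ {P Q} → _≈ᴾ_ M A B P Q → _≈ᴾ_ M A B (⊖ P) (⊖ Q)
      ⊖-cong {O} {O} e = refl
      ⊖-cong {affine x y _} {affine .x .y _} refl = refl

  open ClassOfPoint (coordinateRing F A B isField) public using (chordTangent-cong; ellipticGroup)

-- Formulas in tuples of variables

private variable
  ℓ : Level
  k m n : ℕ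
  Γ : List ℕ

-- Concatenation is kept as a binary tree so that `values` brackets the tuples exactly as the given
-- formulas expect them, for instance as (x ++ (y ++ z)) ++ c for a graph of addition with
-- parameters.
data Args (Γ : List ℕ) : ℕ → Set where
  nil : Args Γ 0
  [_] : k ∈ Γ → Args Γ k
  _⧺_ : Args Γ m → Args Γ n → Args Γ (m ℕ.+ n)

infixr 5 _⧺_
infixr 4 _∧ᴮ_
infixr 3 _∨ᴮ_
infixr 2 _⇒ᴮ_

-- First-order formulas whose variables are tuples: Γ lists their lengths.
data Block (Γ : List ℕ) : Set where
  rel            : Formula n → Args Γ n → Block Γ
  eqᴮ            : k ∈ Γ → k ∈ Γ → Block Γ
  _∧ᴮ_ _∨ᴮ_ _⇒ᴮ_ : Block Γ → Block Γ → Block Γ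
  ∀ᴮ ∃ᴮ          : ∀ k → Block (k ∷ Γ) → Block Γ

Env : Structure ℓ → List ℕ → Set ℓ
Env M = ListAll.All (Vec ∣ M ∣)

module _ (M : Structure ℓ) where

  get : Env M Γ → k ∈ Γ → Vec ∣ M ∣ k
  get (x ∷ ρ) (here refl) = x
  get (x ∷ ρ) (there i)   = get ρ i

  values : Env M Γ → Args Γ n → Vec ∣ M ∣ n
  values ρ nil     = []
  values ρ [ i ]   = get ρ i
  values ρ (a ⧺ b) = values ρ a ++ values ρ b

  Holds : Block Γ → Env M Γ → Set ℓ
  Holds (rel φ a) ρ = M ⊨ φ [ values ρ a ]
  Holds (eqᴮ i j) ρ = get ρ i ≡ get ρ j
  Holds (φ ∧ᴮ ψ)  ρ = Holds φ ρ × Holds ψ ρ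
  Holds (φ ∨ᴮ ψ)  ρ = Holds φ ρ ⊎ Holds ψ ρ
  Holds (φ ⇒ᴮ ψ)  ρ = Holds φ ρ → Holds ψ ρ
  Holds (∀ᴮ k φ)  ρ = (x : Vec ∣ M ∣ k) → Holds φ (x ∷ ρ)
  Holds (∃ᴮ k φ)  ρ = Σ (Vec ∣ M ∣ k) λ x → Holds φ (x ∷ ρ)

  flatten : Env M Γ → Vec ∣ M ∣ (ListAction.sum Γ)
  flatten []      = []
  flatten (x ∷ ρ) = x ++ flatten ρ

-- The head of the tuple is bound innermost, since index zero belongs to the innermost quantifier.
∀^ ∃^ : ∀ k → Formula (k ℕ.+ n) → Formula n
∀^ zero    φ = φ
∀^ (suc k) φ = ∀^ k (∀′ φ)
∃^ zero    φ = φ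
∃^ (suc k) φ = ∃^ k (∃′ φ)

positions : k ∈ Γ → Vec (Fin (ListAction.sum Γ)) k
positions {k} {k ∷ Γ} (here refl) = Vec.map (_↑ˡ ListAction.sum Γ) (allFin k)
positions {k} {j ∷ Γ} (there i)   = Vec.map (j ↑ʳ_) (positions i)

argPositions : Args Γ n → Vec (Fin (ListAction.sum Γ)) n
argPositions nil     = []
argPositions [ i ]   = positions i
argPositions (a ⧺ b) = argPositions a ++ argPositions b

equal : Vec (Fin n) k → Vec (Fin n) k → Formula n
equal []       []       = ⊥′ ⇒′ ⊥′
equal (i ∷ is) (j ∷ js) = (var i ≐ var j) ∧′ equal is js

compile : Block Γ → Formula (ListAction.sum Γ)
compile (rel φ a) = ren (lookup (argPositions a)) φ
compile (eqᴮ i j) = equal (positions i) (positions j)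
compile (φ ∧ᴮ ψ)  = compile φ ∧′ compile ψ
compile (φ ∨ᴮ ψ)  = compile φ ∨′ compile ψ
compile (φ ⇒ᴮ ψ)  = compile φ ⇒′ compile ψ
compile (∀ᴮ k φ)  = ∀^ k (compile φ)
compile (∃ᴮ k φ)  = ∃^ k (compile φ)

module _ (M : Structure ℓ) where
  open Equivalence

  ∀^-correct : ∀ k (φ : Formula (k ℕ.+ n)) (ρ : Vec ∣ M ∣ n) →
    (∀ x → M ⊨ φ [ x ++ ρ ]) ⇔ (M ⊨ ∀^ k φ [ ρ ])
  ∀^-correct zero    φ ρ = mk⇔ (λ f → f []) (λ { p [] → p })
  ∀^-correct (suc k) φ ρ = mk⇔
    (λ f → to (∀^-correct k (∀′ φ) ρ) λ xs x → f (x ∷ xs))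
    (λ { p (x ∷ xs) → from (∀^-correct k (∀′ φ) ρ) p xs x })

  ∃^-correct : ∀ k (φ : Formula (k ℕ.+ n)) (ρ : Vec ∣ M ∣ n) →
    (∃[ x ] (M ⊨ φ [ x ++ ρ ])) ⇔ (M ⊨ ∃^ k φ [ ρ ])
  ∃^-correct zero    φ ρ = mk⇔ (λ { ([] , p) → p }) (λ p → [] , p)
  ∃^-correct (suc k) φ ρ = mk⇔
    (λ { (x ∷ xs , p) → to (∃^-correct k (∃′ φ) ρ) (xs , x , p) })
    (λ p → let (xs , x , q) = from (∃^-correct k (∃′ φ) ρ) p in x ∷ xs , q)

  lookup-positions : (ρ : Env M Γ) (i : k ∈ Γ) → Vec.map (lookup (flatten M ρ)) (positions i) ≡ get M ρ i
  lookup-positions {k = k} (x ∷ ρ) (here refl) = begin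
    Vec.map (lookup (x ++ flatten M ρ)) (Vec.map (_↑ˡ _) (allFin k)) ≡⟨ map-∘ _ _ (allFin k) ⟨
    Vec.map (λ j → lookup (x ++ flatten M ρ) (j ↑ˡ _)) (allFin k) ≡⟨ map-cong (lookup-++ˡ x (flatten M ρ)) (allFin k) ⟩
    Vec.map (lookup x) (allFin k)                                 ≡⟨ map-lookup-allFin x ⟩
    x                                                         ∎
    where open ≡-Reasoning
  lookup-positions (x ∷ ρ) (there i) = trans (sym (map-∘ _ _ (positions i)))
    (trans (map-cong (lookup-++ʳ x (flatten M ρ)) (positions i)) (lookup-positions ρ i))

  lookup-argPositions : (ρ : Env M Γ) (a : Args Γ n) →
    Vec.map (lookup (flatten M ρ)) (argPositions a) ≡ values M ρ a
  lookup-argPositions ρ nil     = refl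
  lookup-argPositions ρ [ i ]   = lookup-positions ρ i
  lookup-argPositions ρ (a ⧺ b) = trans (map-++ _ (argPositions a) (argPositions b))
    (cong₂ _++_ (lookup-argPositions ρ a) (lookup-argPositions ρ b))

  equal-correct : (ρ : Vec ∣ M ∣ n) (is js : Vec (Fin n) k) →
    (Vec.map (lookup ρ) is ≡ Vec.map (lookup ρ) js) ⇔ (M ⊨ equal is js [ ρ ])
  equal-correct ρ []       []       = mk⇔ (λ _ ()) (λ _ → refl)
  equal-correct ρ (i ∷ is) (j ∷ js) = mk⇔
    (λ e → let (h , t) = ∷-injective e in h , to (equal-correct ρ is js) t)
    (λ { (h , t) → cong₂ _∷_ h (from (equal-correct ρ is js) t) })

  compile-correct : (φ : Block Γ) (ρ : Env M Γ) → Holds M φ ρ ⇔ (M ⊨ compile φ [ flatten M ρ ])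
  compile-correct (rel φ a) ρ = mk⇔ (sat-ren M agree φ) (sat-ren⁻¹ M agree φ)
    where
    agree : Agree M (values M ρ a) (lookup (argPositions a)) (flatten M ρ)
    agree i = trans (cong (λ v → lookup v i) (sym (lookup-argPositions ρ a)))
                    (lookup-map i _ (argPositions a))
  compile-correct (eqᴮ i j) ρ = mk⇔
    (λ e → to E (trans (lookup-positions ρ i) (trans e (sym (lookup-positions ρ j)))))
    (λ p → trans (sym (lookup-positions ρ i)) (trans (from E p) (lookup-positions ρ j)))
    where E = equal-correct (flatten M ρ) (positions i) (positions j)
  compile-correct (φ ∧ᴮ ψ) ρ = mk⇔
    (λ { (p , q) → to (compile-correct φ ρ) p , to (compile-correct ψ ρ) q })
    (λ { (p , q) → from (compile-correct φ ρ) p , from (compile-correct ψ ρ) q })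
  compile-correct (φ ∨ᴮ ψ) ρ = mk⇔
    (Sum.map (to (compile-correct φ ρ)) (to (compile-correct ψ ρ)))
    (Sum.map (from (compile-correct φ ρ)) (from (compile-correct ψ ρ)))
  compile-correct (φ ⇒ᴮ ψ) ρ = mk⇔
    (λ f p → to (compile-correct ψ ρ) (f (from (compile-correct φ ρ) p)))
    (λ f p → from (compile-correct ψ ρ) (f (to (compile-correct φ ρ) p)))
  compile-correct (∀ᴮ k φ) ρ = mk⇔
    (λ f → to (∀^-correct k _ _) λ x → to (compile-correct φ (x ∷ ρ)) (f x))
    (λ p x → from (compile-correct φ (x ∷ ρ)) (from (∀^-correct k _ _) p x))
  compile-correct (∃ᴮ k φ) ρ = mk⇔
    (λ { (x , p) → to (∃^-correct k _ _) (x , to (compile-correct φ (x ∷ ρ)) p) })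
    (λ p → let (x , q) = from (∃^-correct k _ _) p in x , from (compile-correct φ (x ∷ ρ)) q)

transfer : (M : Structure ℓ) → M ⊨Thℚ → (φ : Block []) → Holds 𝓠 φ [] → Holds M φ []
transfer M th φ p =
  Equivalence.from (compile-correct M φ []) (th (compile φ) (Equivalence.to (compile-correct 𝓠 φ []) p))

-- Uniform definability of the finite subsets of ℚᵐ

module IntegerCodes where
  open import Data.Integer.Base using (_+_; _*_; -_; _-_)

  -- The integer i itself would not do as a divisor of μ: the value 0 has to be allowed, and 0
  -- divides no nonzero μ. The number 1 + 2 i is never 0 and still bounds |i|.
  odd : ℤ → ℤ
  odd i = 1ℤ + (i + i)

  odd≢0 : ∀ i → ¬ odd i ≡ 0ℤ
  odd≢0 (+ n)    ()
  odd≢0 -[1+ n ] ()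

  ∣i∣≤∣odd∣ : ∀ i → ∣ i ∣ᶻ ≤ ∣ odd i ∣ᶻ
  ∣i∣≤∣odd∣ (+ n)    = ℕ.≤-trans (ℕ.m≤m+n n n) (ℕ.n≤1+n _)
  ∣i∣≤∣odd∣ -[1+ n ] = s≤s (ℕ.m≤m+n n n)

  ∣⇒∣∣≤ : ∀ {i j} → ¬ j ≡ 0ℤ → i ∣ℤ j → ∣ i ∣ᶻ ≤ ∣ j ∣ᶻ
  ∣⇒∣∣≤ {i} {j} j≢0 d = ℕ∣.∣⇒≤ {{ℤ.≢-nonZero j≢0}} (ℤ∣.∣⇒∣ᵤ d)

  *-≢0 : ∀ {i j} → ¬ i ≡ 0ℤ → ¬ j ≡ 0ℤ → ¬ i * j ≡ 0ℤ
  *-≢0 {i} i≢0 j≢0 e with ℤ.i*j≡0⇒i≡0∨j≡0 i e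
  ... | inj₁ z = i≢0 z
  ... | inj₂ z = j≢0 z

  product : ∀ {A : Set} → (A → ℤ) → List A → ℤ
  product f []       = 1ℤ
  product f (x ∷ xs) = f x * product f xs

  ∣product : ∀ {A : Set} (f : A → ℤ) {x xs} → x ∈ xs → f x ∣ℤ product f xs
  ∣product f {x} {_ ∷ xs} (here refl) = divides (product f xs) (ℤ.*-comm (f x) _)
  ∣product f {x} {y ∷ xs} (there i)   = ℤ∣.∣n⇒∣m*n (f y) (∣product f i)

  product≢0 : ∀ {A : Set} (f : A → ℤ) → (∀ x → ¬ f x ≡ 0ℤ) → ∀ xs → ¬ product f xs ≡ 0ℤ
  product≢0 f nz []       ()
  product≢0 f nz (x ∷ xs) = *-≢0 (nz x) (product≢0 f nz xs)

  Comaximal : ℤ → ℤ → Set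
  Comaximal a b = ∃[ p ] ∃[ q ] p * a + q * b ≡ 1ℤ

  comaximal-∣ : ∀ {a b w} → Comaximal a b → a ∣ℤ b * w → a ∣ℤ w
  comaximal-∣ {a} {b} {w} (p , q , e) (divides k e′) = divides (p * w + q * k) (begin
    w                             ≡⟨ ℤ.*-identityˡ w ⟨
    1ℤ * w                        ≡⟨ cong (_* w) e ⟨
    (p * a + q * b) * w           ≡⟨ ring₁ p a q b w ⟩
    p * w * a + q * (b * w)       ≡⟨ cong (λ z → p * w * a + q * z) e′ ⟩
    p * w * a + q * (k * a)       ≡⟨ ring₂ p a q k w ⟩
    (p * w + q * k) * a           ∎)
    where
    open ≡-Reasoning
    ring₁ : ∀ p a q b w → (p * a + q * b) * w ≡ p * w * a + q * (b * w)
    ring₁ = solve-∀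
    ring₂ : ∀ p a q k w → p * w * a + q * (k * a) ≡ (p * w + q * k) * a
    ring₂ = solve-∀

  comaximal-product : ∀ {A : Set} (f : A → ℤ) {a} xs → (∀ x → x ∈ xs → Comaximal a (f x)) →
    a ∣ℤ product f xs → a ∣ℤ 1ℤ
  comaximal-product f []       c d = d
  comaximal-product f (x ∷ xs) c d =
    comaximal-product f xs (λ y y∈ → c y (there y∈)) (comaximal-∣ (c x (here refl)) d)

  -- The moduli of Gödel's β function. With a = 1 + u c, b = 1 + u c′ and u = t (c - c′) one has t
  -- (c b - c′ a) = u; substituting this into 1 = a - c u gives the two coefficients.
  comaximal-1+u* : ∀ {u} c c′ → (c - c′) ∣ℤ u → Comaximal (1ℤ + u * c) (1ℤ + u * c′)
  comaximal-1+u* c c′ (divides t refl) = 1ℤ + c * t * c′ , - (c * c * t) , ring t c c′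
    where
    ring : ∀ t c c′ → (1ℤ + c * t * c′) * (1ℤ + t * (c - c′) * c) +
      (- (c * c * t)) * (1ℤ + t * (c - c′) * c′) ≡ 1ℤ
    ring = solve-∀

  -- The leading digit 1 at the empty tuple keeps the value nonzero even on the zero tuple;
  -- otherwise the modulus there would be 1 and would divide everything.
  horner : ∀ {m} → ℤ → Vec ℤ m → ℤ
  horner β []      = 1ℤ
  horner β (i ∷ x) = i + β * horner β x

  Box : ∀ {m} → ℕ → Vec ℤ m → Set
  Box N = All (λ i → ∣ i ∣ᶻ ≤ N)

  module _ (N : ℕ) where
    -- Digits are balanced, running from - N to N, so there are 2 N + 1 of them.
    base : ℤ
    base = + suc (N ℕ.+ N)

    -- The difference i - j is a multiple of the base of absolute value at most 2 N, hence zero.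
    digit : ∀ {i j a b} → ∣ i ∣ᶻ ≤ N → ∣ j ∣ᶻ ≤ N → i + base * a ≡ j + base * b → i ≡ j × a ≡ b
    digit {i} {j} {a} {b} i≤ j≤ e = i≡j , sym b≡a
      where
      difference : i - j ≡ base * (b - a)
      difference = begin
        i - j                                ≡⟨ ring₁ i j base a ⟩
        (i + base * a) - (j + base * a)      ≡⟨ cong (_- (j + base * a)) e ⟩
        (j + base * b) - (j + base * a)      ≡⟨ ring₂ j base a b ⟩
        base * (b - a)                       ∎
        where
        open ≡-Reasoning
        ring₁ : ∀ i j B a → i - j ≡ (i + B * a) - (j + B * a)
        ring₁ = solve-∀
        ring₂ : ∀ j B a b → (j + B * b) - (j + B * a) ≡ B * (b - a)
        ring₂ = solve-∀

      small : ∀ t → suc (N ℕ.+ N) ℕ.* t ≤ N ℕ.+ N → t ≡ 0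
      small zero    _  = refl
      small (suc t) le = ⊥-elim (ℕ.<-irrefl refl (ℕ.≤-trans (ℕ.m≤m*n (suc (N ℕ.+ N)) (suc t)) le))

      b≡a : b ≡ a
      b≡a = ℤ.i-j≡0⇒i≡j b a (ℤ.∣i∣≡0⇒i≡0 (small ∣ b - a ∣ᶻ (begin
        suc (N ℕ.+ N) ℕ.* ∣ b - a ∣ᶻ   ≡⟨ ℤ.abs-* base (b - a) ⟨
        ∣ base * (b - a) ∣ᶻ            ≡⟨ cong ∣_∣ᶻ difference ⟨
        ∣ i - j ∣ᶻ                     ≤⟨ ℤ.∣i-j∣≤∣i∣+∣j∣ i j ⟩
        ∣ i ∣ᶻ ℕ.+ ∣ j ∣ᶻ               ≤⟨ ℕ.+-mono-≤ i≤ j≤ ⟩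
        N ℕ.+ N                       ∎)))
        where open ℕ.≤-Reasoning

      i≡j : i ≡ j
      i≡j = ℤ.i-j≡0⇒i≡j i j (trans difference (trans (cong (base *_) (ℤ.i≡j⇒i-j≡0 {b} b≡a)) (ℤ.*-zeroʳ base)))

    horner-injective : ∀ {m} {x y : Vec ℤ m} → Box N x → Box N y →
      horner base x ≡ horner base y → x ≡ y
    horner-injective []       []       e = refl
    horner-injective (i ∷ is) (j ∷ js) e = let (i≡j , e′) = digit i j e in
      cong₂ _∷_ i≡j (horner-injective is js e′)

    -- A zero value would have the second expansion 0 + base · 0; stripping digits then leads down
    -- to the leading 1.
    horner≢0 : ∀ {m} {x : Vec ℤ m} → Box N x → ¬ horner base x ≡ 0ℤ
    horner≢0 []               ()
    horner≢0 (_∷_ {x = i} i≤ is) e = horner≢0 is (proj₂ (digit {i} {0ℤ} {_} {0ℤ} i≤ z≤n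
      (trans e (sym (trans (ℤ.+-identityˡ _) (ℤ.*-zeroʳ base))))))

    horner-bounded : ∀ m → ∃[ C ] ∀ {x : Vec ℤ m} → Box N x → ∣ horner base x ∣ᶻ ≤ C
    horner-bounded zero    = 1 , λ { [] → ℕ.≤-refl }
    horner-bounded (suc m) with horner-bounded m
    ... | C , h = N ℕ.+ suc (N ℕ.+ N) ℕ.* C , λ { {i ∷ x} (i≤ ∷ x≤) → begin
        ∣ i + base * horner base x ∣ᶻ                    ≤⟨ ℤ.∣i+j∣≤∣i∣+∣j∣ i _ ⟩
        ∣ i ∣ᶻ ℕ.+ ∣ base * horner base x ∣ᶻ              ≡⟨ cong (∣ i ∣ᶻ ℕ.+_) (ℤ.abs-* base (horner base x)) ⟩
        ∣ i ∣ᶻ ℕ.+ suc (N ℕ.+ N) ℕ.* ∣ horner base x ∣ᶻ   ≤⟨ ℕ.+-mono-≤ i≤ (ℕ.*-monoʳ-≤ (suc (N ℕ.+ N)) (h x≤)) ⟩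
        N ℕ.+ suc (N ℕ.+ N) ℕ.* C                       ∎ }
      where open ℕ.≤-Reasoning

  ∣-factorial : ∀ {k n} → k ≢ 0 → k ≤ n → k ℕ∣.∣ n !
  ∣-factorial {zero}  k≢0 _  = ⊥-elim (k≢0 refl)
  ∣-factorial {suc k} _   le = ℕ∣.∣-trans (ℕ∣.m∣m*n (k !)) (ℕ∣.m≤n⇒m!∣n! le)

  -- The tuples x all of whose entries i satisfy 1 + 2 i ∣ μ lie in a finite box;
  -- on it the moduli 1 + u (Horner value of x) are pairwise comaximal, so that
  -- divisibility of v singles out an arbitrary subset.
  Coded : ∀ {m} → (μ β u v : ℤ) → Vec ℤ m → Set
  Coded μ β u v x = All (λ i → odd i ∣ℤ μ) x × (1ℤ + u * horner β x) ∣ℤ v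

  finite-coded : ∀ {m} (L : List (Vec ℤ m)) →
    ∃[ μ ] ∃[ β ] ∃[ u ] ∃[ v ] ∀ x → Coded μ β u v x ⇔ x ∈ L
  finite-coded {m} L = μ , β , u , product modulus L , λ x → mk⇔ (decode x) encode
    where
    oddProduct : ∀ {m} → Vec ℤ m → ℤ
    oddProduct []      = 1ℤ
    oddProduct (i ∷ x) = odd i * oddProduct x

    oddProduct≢0 : ∀ {m} (x : Vec ℤ m) → ¬ oddProduct x ≡ 0ℤ
    oddProduct≢0 []      ()
    oddProduct≢0 (i ∷ x) = *-≢0 (odd≢0 i) (oddProduct≢0 x)

    ∣oddProduct : ∀ {m} (x : Vec ℤ m) {μ} → oddProduct x ∣ℤ μ → All (λ i → odd i ∣ℤ μ) x
    ∣oddProduct []      d = []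
    ∣oddProduct (i ∷ x) d =
      ℤ∣.∣-trans (divides (oddProduct x) (ℤ.*-comm (odd i) _)) d ∷
      ∣oddProduct x (ℤ∣.∣-trans (divides (odd i) refl) d)

    μ = product oddProduct L
    -- As μ ≠ 0, the condition `odd i ∣ℤ μ` forces |i| ≤ |odd i| ≤ |μ|, also for tuples outside `L`.
    N = ∣ μ ∣ᶻ
    β = base N
    C = proj₁ (horner-bounded N m)
    -- Differences of two Horner values are at most 2 C, so they divide K !. The summand 3 makes K !
    -- at least 6, which keeps every modulus away from ± 1: with K ! = 2 the modulus 1 - 2 would be
    -- a unit.
    K = 3 ℕ.+ (C ℕ.+ C)
    u = + (K !)

    modulus : Vec ℤ m → ℤ
    modulus x = 1ℤ + u * horner β x

    box : ∀ {m} {x : Vec ℤ m} → All (λ i → odd i ∣ℤ μ) x → Box N x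
    box = All.map λ {i} d →
      ℕ.≤-trans (∣i∣≤∣odd∣ i) (∣⇒∣∣≤ (product≢0 oddProduct oddProduct≢0 L) d)

    encode : ∀ {x} → x ∈ L → Coded μ β u (product modulus L) x
    encode {x} x∈ = ∣oddProduct x (∣product oddProduct x∈) , ∣product modulus x∈

    comaximal : ∀ {x y} → Box N x → Box N y → ¬ x ≡ y → Comaximal (modulus x) (modulus y)
    comaximal {x} {y} bx by x≢y = comaximal-1+u* {u} cx cy
      (ℤ∣.∣ᵤ⇒∣ {cx - cy} {u} (∣-factorial
        (λ e → x≢y (horner-injective N bx by (ℤ.i-j≡0⇒i≡j cx cy (ℤ.∣i∣≡0⇒i≡0 e))))
        (begin
          ∣ cx - cy ∣ᶻ          ≤⟨ ℤ.∣i-j∣≤∣i∣+∣j∣ cx cy ⟩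
          ∣ cx ∣ᶻ ℕ.+ ∣ cy ∣ᶻ    ≤⟨ ℕ.+-mono-≤ (proj₂ (horner-bounded N m) bx) (proj₂ (horner-bounded N m) by) ⟩
          C ℕ.+ C              ≤⟨ ℕ.m≤n+m _ 3 ⟩
          K                    ∎)))
      where
      open ℕ.≤-Reasoning
      cx = horner β x
      cy = horner β y

    nonunit : ∀ {x} → Box N x → ¬ modulus x ∣ℤ 1ℤ
    nonunit {x} bx d = impossible (begin
      6                        ≤⟨ ℕ∣.∣⇒≤ {{K ℕ.!≢0}} (ℕ∣.m≤n⇒m!∣n! {3} {K} (ℕ.m≤m+n 3 _)) ⟩
      K !                      ≤⟨ ℕ.m≤m*n (K !) ∣ c ∣ᶻ {{ℤ.≢-nonZero (horner≢0 N bx)}} ⟩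
      K ! ℕ.* ∣ c ∣ᶻ            ≡⟨ ℤ.abs-* u c ⟨
      ∣ u * c ∣ᶻ                ≡⟨ cong ∣_∣ᶻ (ring (u * c)) ⟩
      ∣ modulus x - 1ℤ ∣ᶻ       ≤⟨ ℤ.∣i-j∣≤∣i∣+∣j∣ (modulus x) 1ℤ ⟩
      ∣ modulus x ∣ᶻ ℕ.+ 1      ≤⟨ ℕ.+-monoˡ-≤ 1 (∣⇒∣∣≤ (λ ()) d) ⟩
      2                        ∎)
      where
      open ℕ.≤-Reasoning
      c = horner β x
      ring : ∀ a → a ≡ (1ℤ + a) - 1ℤ
      ring = solve-∀
      impossible : ¬ 6 ≤ 2
      impossible (s≤s (s≤s ()))

    -- For x outside `L` the modulus of x is comaximal with every factor of the product that it
    -- divides, so it would divide 1.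
    decode : ∀ x → Coded μ β u (product modulus L) x → x ∈ L
    decode x (o , d) with x ∈? L
      where open DecMembership (≡-dec ℤ._≟_)
    ... | yes x∈ = x∈
    ... | no x∉  = ⊥-elim (nonunit (box o) (comaximal-product modulus L
      (λ y y∈ → comaximal (box o) (box (proj₁ (encode y∈))) (λ { refl → x∉ y∈ })) d))

open IntegerCodes

-- Common denominators of finitely many rational tuples

/1-injective : ∀ {i j} → i / 1 ≡ j / 1 → i ≡ j
/1-injective {i} {j} e with ℚᵘ.≃-trans (ℚᵘ.≃-sym (ℚ.toℚᵘ-fromℚᵘ (mkℚᵘ i 0)))
  (ℚᵘ.≃-trans (ℚᵘ.≃-reflexive (cong ℚ.toℚᵘ e)) (ℚ.toℚᵘ-fromℚᵘ (mkℚᵘ j 0)))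
... | *≡* e′ = trans (sym (ℤ.*-identityʳ i)) (trans e′ (ℤ.*-identityʳ j))

Scaled : ℤ → Vec ℚ m → Vec ℤ m → Set
Scaled δ = Pointwise (λ q i → δ / 1 ℚ.* q ≡ i / 1)

scaled-injective : ∀ δ .{{_ : NonZero δ}} {x y : Vec ℚ m} {v} → Scaled (+ δ) x v → Scaled (+ δ) y v → x ≡ y
scaled-injective δ []       []       = refl
scaled-injective δ (e ∷ es) (f ∷ fs) =
  cong₂ _∷_ (ℚ.≤-antisym (cancel (ℚ.≤-reflexive (trans e (sym f)))) (cancel (ℚ.≤-reflexive (trans f (sym e)))))
            (scaled-injective δ es fs)
  where
  instance
    positive : ℚ.Positive (+ δ / 1)
    positive = ℚ.normalize-pos δ 1
  cancel : ∀ {y z} → + δ / 1 ℚ.* y ℚ.≤ + δ / 1 ℚ.* z → y ℚ.≤ z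
  cancel = ℚ.*-cancelˡ-≤-pos (+ δ / 1)

scaled-unique : ∀ δ {x : Vec ℚ m} {v w} → Scaled δ x v → Scaled δ x w → v ≡ w
scaled-unique δ []       []       = refl
scaled-unique δ (e ∷ es) (f ∷ fs) = cong₂ _∷_ (/1-injective (trans (sym e) f)) (scaled-unique δ es fs)

scaled-multiple : ∀ k δ {x : Vec ℚ m} {v} → Scaled δ x v → Scaled (k ℤ.* δ) x (Vec.map (k ℤ.*_) v)
scaled-multiple k δ []               = []
scaled-multiple k δ (_∷_ {x = q} {y = i} e es) =
  trans (cong (ℚ._* q) (sym (*-/1 k δ))) (trans (ℚ.*-assoc (k / 1) (δ / 1) q)
    (trans (cong ((k / 1) ℚ.*_) e) (*-/1 k i))) ∷ scaled-multiple k δ es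

clearDenominators : (x : Vec ℚ m) → ∃[ δ ] NonZero δ × ∃[ v ] Scaled (+ δ) x v
clearDenominators []      = 1 , _ , [] , []
clearDenominators (q ∷ x) with clearDenominators x
... | δ , nz , v , s = ↧ₙ q ℕ.* δ , ℕ.m*n≢0 (↧ₙ q) δ {{_}} {{nz}} , _ ,
  subst (λ z → Scaled z (q ∷ x) (+ δ ℤ.* ↥ q ∷ Vec.map (↧ q ℤ.*_) v)) (sym (ℤ.pos-* (↧ₙ q) δ))
    (trans (cong (λ z → z / 1 ℚ.* q) (ℤ.*-comm (↧ q) (+ δ)))
       (Pointwise.head (scaled-multiple (+ δ) (↧ q) (denominator-* q ∷ [])))
      ∷ scaled-multiple (↧ q) (+ δ) s)

record CommonDenominator (L : List (Vec ℚ m)) : Set where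
  field
    δ           : ℕ
    nonZero     : NonZero δ
    L′          : List (Vec ℤ m)
    numerator   : ∀ {x} → x ∈ L → ∃[ v ] v ∈ L′ × Scaled (+ δ) x v
    denominator : ∀ {v} → v ∈ L′ → ∃[ x ] x ∈ L × Scaled (+ δ) x v

commonDenominator : (L : List (Vec ℚ m)) → CommonDenominator L
commonDenominator []      = record { δ = 1 ; nonZero = _ ; L′ = [] ; numerator = λ () ; denominator = λ () }
commonDenominator (x ∷ L) with clearDenominators x | commonDenominator L
... | ε , nz , v , s | c = record
  { δ = ε ℕ.* δ
  ; nonZero = ℕ.m*n≢0 ε δ {{nz}} {{nonZero}}
  ; L′ = Vec.map (+ δ ℤ.*_) v ∷ List.map (Vec.map (+ ε ℤ.*_)) L′
  ; numerator = λ
      { (here refl) → _ , here refl , head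
      ; (there x∈) → let (w , w∈ , s) = numerator x∈ in _ , there (∈-map⁺ _ w∈) , tail s }
  ; denominator = λ
      { (here refl) → x , here refl , head
      ; (there v∈) → let (w , w∈ , e) = ∈-map⁻ _ v∈ ; (y , y∈ , s) = denominator w∈ in
          y , there y∈ , subst (Scaled (+ (ε ℕ.* δ)) y) (sym e) (tail s) } }
  where
  open CommonDenominator c
  head : Scaled (+ (ε ℕ.* δ)) x (Vec.map (+ δ ℤ.*_) v)
  head = subst (λ z → Scaled z x _) (trans (ℤ.*-comm (+ δ) (+ ε)) (sym (ℤ.pos-* ε δ))) (scaled-multiple (+ δ) (+ ε) s)
  tail : ∀ {y w} → Scaled (+ δ) y w → Scaled (+ (ε ℕ.* δ)) y (Vec.map (+ ε ℤ.*_) w)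
  tail {y} s = subst (λ z → Scaled z y _) (sym (ℤ.pos-* ε δ)) (scaled-multiple (+ ε) (+ δ) s)

-- Membership in a coded finite set as a formula

module Membership (Z : Formula 1) (defZ : Definesℤ Z) where
  open Equivalence

  -- `at` inserts only variables into Z, so the integer is first named by a bound variable and then
  -- equated with the term.
  integral : Term n → Formula n
  integral t = ∃′ (at 𝓠 Z zero ∧′ renT suc t ≐ var zero)

  divisor : Term n → Term n → Formula n
  divisor s t = ∃′ (at 𝓠 Z zero ∧′ renT suc t ≐ var zero *′ renT suc s)

  private
    eval-suc : ∀ (ρ : Vec ℚ n) w t → eval 𝓠 (w ∷ ρ) (renT suc t) ≡ eval 𝓠 ρ t
    eval-suc ρ w t = sym (eval-ren 𝓠 (λ _ → refl) t)

    fromZ : ∀ (ρ : Vec ℚ n) w → 𝓠 ⊨ at 𝓠 Z zero [ w ∷ ρ ] → ∃[ i ] w ≡ i / 1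
    fromZ ρ w p = to (defZ w) (from (sat-at 𝓠 Z (w ∷ ρ) zero) p)

    toZ : ∀ (ρ : Vec ℚ n) i → 𝓠 ⊨ at 𝓠 Z zero [ i / 1 ∷ ρ ]
    toZ ρ i = to (sat-at 𝓠 Z (i / 1 ∷ ρ) zero) (from (defZ (i / 1)) (i , refl))

  integral-correct : ∀ (ρ : Vec ℚ n) t → (𝓠 ⊨ integral t [ ρ ]) ⇔ (∃[ i ] eval 𝓠 ρ t ≡ i / 1)
  integral-correct ρ t = mk⇔
    (λ { (w , z , e) → let (i , w≡) = fromZ ρ w z in i , trans (sym (eval-suc ρ w t)) (trans e w≡) })
    (λ { (i , e) → i / 1 , toZ ρ i , trans (eval-suc ρ (i / 1) t) e })

  divisor-correct : ∀ (ρ : Vec ℚ n) s t i j → eval 𝓠 ρ s ≡ i / 1 → eval 𝓠 ρ t ≡ j / 1 →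
    (𝓠 ⊨ divisor s t [ ρ ]) ⇔ i ∣ℤ j
  divisor-correct ρ s t i j es et = mk⇔
    (λ { (w , z , e) → let (k , w≡) = fromZ ρ w z in
      divides k (/1-injective (trans (sym et) (trans (sym (eval-suc ρ w t))
        (trans e (trans (cong₂ ℚ._*_ w≡ (trans (eval-suc ρ w s) es)) (*-/1 k i)))))) })
    (λ { (divides k e) → k / 1 , toZ ρ k , trans (eval-suc ρ (k / 1) t)
      (trans et (trans (cong (_/ 1) e) (trans (sym (*-/1 k i))
        (cong ((k / 1) ℚ.*_) (sym (trans (eval-suc ρ (k / 1) s) es)))))) })

  module _ (d μ β : Term n) where
    entries : Vec (Term n) m → Formula n
    entries []       = ⊥′ ⇒′ ⊥′
    entries (t ∷ ts) = integral (d *′ t) ∧′ divisor (1′ +′ (d *′ t +′ d *′ t)) μ ∧′ entries ts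

    hornerTerm : Vec (Term n) m → Term n
    hornerTerm []       = 1′
    hornerTerm (t ∷ ts) = d *′ t +′ β *′ hornerTerm ts

    module _ (ρ : Vec ℚ n) (δ μ′ β′ : ℤ) (ed : eval 𝓠 ρ d ≡ δ / 1) (eμ : eval 𝓠 ρ μ ≡ μ′ / 1)
      (eβ : eval 𝓠 ρ β ≡ β′ / 1) where
      private
        eval-odd : ∀ {q} i → q ≡ i / 1 → ℚ.1ℚ ℚ.+ (q ℚ.+ q) ≡ odd i / 1
        eval-odd i refl = trans (cong (ℚ.1ℚ ℚ.+_) (+-/1 i i)) (+-/1 1ℤ (i ℤ.+ i))

      entries-sound : (ts : Vec (Term n) m) → 𝓠 ⊨ entries ts [ ρ ] →
        ∃[ v ] Scaled δ (Vec.map (eval 𝓠 ρ) ts) v × All (λ i → odd i ∣ℤ μ′) v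
      entries-sound []       _ = [] , [] , []
      entries-sound (t ∷ ts) (p , q , r) =
        let (i , e) = to (integral-correct ρ (d *′ t)) p
            (v , s , a) = entries-sound ts r
        in i ∷ v , trans (cong (ℚ._* eval 𝓠 ρ t) (sym ed)) e ∷ s ,
           to (divisor-correct ρ (1′ +′ (d *′ t +′ d *′ t)) μ (odd i) μ′ (eval-odd i e) eμ) q ∷ a

      entries-complete : (ts : Vec (Term n) m) {v : Vec ℤ m} → Scaled δ (Vec.map (eval 𝓠 ρ) ts) v →
        All (λ i → odd i ∣ℤ μ′) v → 𝓠 ⊨ entries ts [ ρ ]
      entries-complete []       []      []      = λ ()
      entries-complete (t ∷ ts) {i ∷ _} (e ∷ s) (o ∷ a) =
        let e′ = trans (cong (ℚ._* eval 𝓠 ρ t) ed) e in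
        from (integral-correct ρ (d *′ t)) (i , e′) ,
        from (divisor-correct ρ (1′ +′ (d *′ t +′ d *′ t)) μ (odd i) μ′ (eval-odd i e′) eμ) o ,
        entries-complete ts s a

      eval-horner : (ts : Vec (Term n) m) {v : Vec ℤ m} → Scaled δ (Vec.map (eval 𝓠 ρ) ts) v →
        eval 𝓠 ρ (hornerTerm ts) ≡ horner β′ v / 1
      eval-horner []       []                    = refl
      eval-horner (t ∷ ts) {i ∷ v} (e ∷ s) = trans
        (cong₂ ℚ._+_ (trans (cong (ℚ._* eval 𝓠 ρ t) ed) e)
          (trans (cong₂ ℚ._*_ eβ (eval-horner ts s)) (*-/1 β′ (horner β′ v))))
        (+-/1 i (β′ ℤ.* horner β′ v))

  -- The parameters are δ, μ, β, u, v: the tuples x such that Coded μ β u v (δ x).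
  codedFormula : ∀ m → Formula (m ℕ.+ 5)
  codedFormula m = entries d μ β xs ∧′ divisor (1′ +′ u *′ hornerTerm d μ β xs) v
    where
    xs = tabulate (λ j → var (j ↑ˡ 5))
    parameter = λ (j : Fin 5) → var (m ↑ʳ j)
    d = parameter zero
    μ = parameter (suc zero)
    β = parameter (suc (suc zero))
    u = parameter (suc (suc (suc zero)))
    v = parameter (suc (suc (suc (suc zero))))

  codedFormula-finite : (L : List (Vec ℚ m)) → ∃[ s ] ∀ x → (𝓠 ⊨ codedFormula m [ x ++ s ]) ⇔ x ∈ L
  codedFormula-finite {m} L with commonDenominator L
  ... | c with finite-coded (CommonDenominator.L′ c)
  ...   | μ , β , u , v , coded = s , λ x → mk⇔ (sound x) (complete x)
    where
    open CommonDenominator c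
    s : Vec ℚ 5
    s = + δ / 1 ∷ μ / 1 ∷ β / 1 ∷ u / 1 ∷ v / 1 ∷ []

    module _ (x : Vec ℚ m) where
      xs : Vec (Term (m ℕ.+ 5)) m
      xs = tabulate (λ j → var (j ↑ˡ 5))

      par : Fin 5 → Term (m ℕ.+ 5)
      par j = var (m ↑ʳ j)

      eval-xs : Vec.map (eval 𝓠 (x ++ s)) xs ≡ x
      eval-xs = trans (sym (tabulate-∘ _ _)) (trans (tabulate-cong (lookup-++ˡ x s)) (tabulate∘lookup x))

      eval-par : ∀ j → eval 𝓠 (x ++ s) (par j) ≡ lookup s j
      eval-par j = lookup-++ʳ x s j

      d′ = par zero
      μ′ = par (suc zero)
      β′ = par (suc (suc zero))

      modulus : ∀ {w} → Scaled (+ δ) (Vec.map (eval 𝓠 (x ++ s)) xs) w →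
        eval 𝓠 (x ++ s) (1′ +′ par (suc (suc (suc zero))) *′ hornerTerm d′ μ′ β′ xs) ≡ (1ℤ ℤ.+ u ℤ.* horner β w) / 1
      modulus {w} sc = trans (cong (ℚ.1ℚ ℚ.+_)
        (trans (cong₂ ℚ._*_ (eval-par _) (eval-horner d′ μ′ β′ (x ++ s) (+ δ) μ β
            (eval-par zero) (eval-par (suc zero)) (eval-par (suc (suc zero))) xs sc))
          (*-/1 u (horner β w)))) (+-/1 1ℤ (u ℤ.* horner β w))

      dc : ∀ {w} → Scaled (+ δ) (Vec.map (eval 𝓠 (x ++ s)) xs) w → _
      dc {w} sc = divisor-correct (x ++ s) (1′ +′ par (suc (suc (suc zero))) *′ hornerTerm d′ μ′ β′ xs)
        (par (suc (suc (suc (suc zero))))) (1ℤ ℤ.+ u ℤ.* horner β w) v (modulus sc) (eval-par _)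

      sound : 𝓠 ⊨ codedFormula m [ x ++ s ] → x ∈ L
      sound (p , q) =
        let (w , sc , a)   = entries-sound d′ μ′ β′ (x ++ s) (+ δ) μ β
                               (eval-par zero) (eval-par (suc zero)) (eval-par (suc (suc zero))) xs p
            (y , y∈ , sc′) = denominator (to (coded w) (a , to (dc sc) q))
        in subst (_∈ L) (scaled-injective δ {{nonZero}} sc′ (subst (λ x → Scaled (+ δ) x w) eval-xs sc)) y∈

      complete : x ∈ L → 𝓠 ⊨ codedFormula m [ x ++ s ]
      complete x∈ =
        let (w , w∈ , sc) = numerator x∈
            (a , d)       = from (coded w) w∈
            sc′           = subst (λ x → Scaled (+ δ) x w) (sym eval-xs) sc
        in entries-complete d′ μ′ β′ (x ++ s) (+ δ) μ β
             (eval-par zero) (eval-par (suc zero)) (eval-par (suc (suc zero))) xs sc′ a ,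
           from (dc sc′) d

  opaque
    -- From here on the formula is known only through `finite-definable`.
    member : ∀ m → Formula (m ℕ.+ 5)
    member = codedFormula

    finite-definable : (L : List (Vec ℚ m)) → ∃[ s ] ∀ x → (𝓠 ⊨ member m [ x ++ s ]) ⇔ x ∈ L
    finite-definable = codedFormula-finite

-- Integer multiples as a definable relation

i-1+1 : ∀ i → i ℤ.- 1ℤ ℤ.+ 1ℤ ≡ i
i-1+1 i = trans (ℤ.+-assoc i (ℤ.- 1ℤ) 1ℤ) (ℤ.+-identityʳ i)

∣i+1∣≤ : ∀ i → ∣ i ℤ.+ 1ℤ ∣ᶻ ≤ suc ∣ i ∣ᶻ
∣i+1∣≤ i = ℕ.≤-trans (ℤ.∣i+j∣≤∣i∣+∣j∣ i 1ℤ) (ℕ.≤-reflexive (ℕ.+-comm ∣ i ∣ᶻ 1))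

∣i-1∣≤ : ∀ i → ∣ i ℤ.- 1ℤ ∣ᶻ ≤ suc ∣ i ∣ᶻ
∣i-1∣≤ i = ℕ.≤-trans (ℤ.∣i-j∣≤∣i∣+∣j∣ i 1ℤ) (ℕ.≤-reflexive (ℕ.+-comm ∣ i ∣ᶻ 1))

∣j∣≡∣i∣⇒j≡±i : ∀ i j → ∣ j ∣ᶻ ≡ ∣ i ∣ᶻ → j ≡ i ⊎ j ≡ ℤ.- i
∣j∣≡∣i∣⇒j≡±i (+ m)    (+ n)      refl = inj₁ refl
∣j∣≡∣i∣⇒j≡±i (+ m)    -[1+ n ]   refl = inj₂ refl
∣j∣≡∣i∣⇒j≡±i -[1+ m ] (+ suc n)  refl = inj₂ refl
∣j∣≡∣i∣⇒j≡±i -[1+ m ] -[1+ n ]   refl = inj₁ refl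

interval : ℕ → List ℤ
interval N = List.map +_ (upTo (suc N)) List.++ List.map (λ n → ℤ.- (+ n)) (upTo (suc N))

∈-interval : ∀ {N} i → ∣ i ∣ᶻ ≤ N → i ∈ interval N
∈-interval {N} (+ n)    le = ∈-++⁺ˡ (∈-map⁺ +_ (∈-upTo⁺ (s≤s le)))
∈-interval {N} -[1+ n ] le = ∈-++⁺ʳ (List.map +_ (upTo (suc N))) (∈-map⁺ (λ n → ℤ.- (+ n)) (∈-upTo⁺ (s≤s le)))

interval-∈ : ∀ {N i} → i ∈ interval N → ∣ i ∣ᶻ ≤ N
interval-∈ {N} {i} i∈ with ∈-++⁻ (List.map +_ (upTo (suc N))) i∈
... | inj₁ p with ∈-map⁻ +_ p
...   | n , n∈ , refl = ℕ.s≤s⁻¹ (∈-upTo⁻ n∈)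
interval-∈ {N} {i} i∈ | inj₂ p with ∈-map⁻ (λ n → ℤ.- (+ n)) p
...   | n , n∈ , refl = ℕ.≤-trans (ℕ.≤-reflexive (ℤ.∣-i∣≡∣i∣ (+ n))) (ℕ.s≤s⁻¹ (∈-upTo⁻ n∈))

-- A definable group reaches first-order logic through the graph of its addition, so the axioms are
-- stated for the graph; each of them is a clause of `groupᴮ`. The domain is read off the graph as
-- well: it consists of the x with x + e = x.
record IsRelationalGroup {X : Set} (Add : X → X → X → Set) (e : X) : Set where
  Dom : X → Set
  Dom x = Add x e x

  field
    dom-e       : Dom e
    functional  : ∀ x y z z′ → Add x y z → Add x y z′ → z ≡ z′
    total       : ∀ x y → Dom x → Dom y → ∃[ z ] Add x y z
    doms        : ∀ x y z → Add x y z → Dom x × Dom y × Dom z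
    associative : ∀ x y z u w v → Add x y u → Add u z w → Add y z v → Add x v w
    commutative : ∀ x y z → Add x y z → Add y x z
    invertible  : ∀ x → Dom x → ∃[ y ] Add x y e

module RelationalGroup {X : Set} {Add : X → X → X → Set} {e : X} (isGroup : IsRelationalGroup Add e) where
  open IsRelationalGroup isGroup using (Dom; dom-e)

  functional : ∀ {x y z z′} → Add x y z → Add x y z′ → z ≡ z′
  functional = IsRelationalGroup.functional isGroup _ _ _ _

  total : ∀ {x y} → Dom x → Dom y → ∃[ z ] Add x y z
  total = IsRelationalGroup.total isGroup _ _

  doms : ∀ {x y z} → Add x y z → Dom x × Dom y × Dom z
  doms = IsRelationalGroup.doms isGroup _ _ _

  associative : ∀ {x y z u w v} → Add x y u → Add u z w → Add y z v → Add x v w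
  associative = IsRelationalGroup.associative isGroup _ _ _ _ _ _

  commutative : ∀ {x y z} → Add x y z → Add y x z
  commutative = IsRelationalGroup.commutative isGroup _ _ _

  invertible : ∀ {x} → Dom x → ∃[ y ] Add x y e
  invertible = IsRelationalGroup.invertible isGroup _

  group : AbelianGroup _ _
  group = record
    { Carrier = Σ X Dom
    ; _≈_ = λ a b → proj₁ a ≡ proj₁ b
    ; _∙_ = _∙_
    ; ε = e , dom-e
    ; _⁻¹ = λ a → proj₁ (invertible (proj₂ a)) , proj₁ (proj₂ (doms (proj₂ (invertible (proj₂ a)))))
    ; isAbelianGroup = record
      { isGroup = record
        { isMonoid = record
          { isSemigroup = record
            { isMagma = record
              { isEquivalence = record { refl = refl ; sym = sym ; trans = trans }
              ; ∙-cong = λ {a} {a′} {b} {b′} e f → functional (add a b)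
                  (subst₂ (λ x y → Add x y _) (sym e) (sym f) (add a′ b′)) }
            ; assoc = λ a b d → functional (associative (add a b) (add (a ∙ b) d) (add b d)) (add a (b ∙ d)) }
          ; identity = (λ a → trans (∙-comm (e , dom-e) a) (idʳ a)) , idʳ }
        ; inverse = (λ a → trans (∙-comm _ a) (inverseʳ a)) , inverseʳ
        ; ⁻¹-cong = λ {a} {b} → ⁻¹-cong a b }
      ; comm = ∙-comm } }
    where
    _∙_ : Σ X Dom → Σ X Dom → Σ X Dom
    a ∙ b = let (z , s) = total (proj₂ a) (proj₂ b) in z , proj₂ (proj₂ (doms s))

    add : ∀ a b → Add (proj₁ a) (proj₁ b) (proj₁ (a ∙ b))
    add a b = proj₂ (total (proj₂ a) (proj₂ b))

    ∙-comm : ∀ a b → proj₁ (a ∙ b) ≡ proj₁ (b ∙ a)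
    ∙-comm a b = functional (commutative (add a b)) (add b a)

    idʳ : ∀ a → proj₁ (a ∙ (e , dom-e)) ≡ proj₁ a
    idʳ a = functional (add a (e , dom-e)) (proj₂ a)

    inv : ∀ a → Add (proj₁ a) (proj₁ (invertible (proj₂ a))) e
    inv a = proj₂ (invertible (proj₂ a))

    inverseʳ : ∀ a → proj₁ (a ∙ (_ , proj₁ (proj₂ (doms (inv a))))) ≡ e
    inverseʳ a = functional (add a (_ , proj₁ (proj₂ (doms (inv a))))) (inv a)

    -- Inverses are picked from proofs of membership in the domain, which may differ for equal
    -- elements. Uniqueness settles it: a⁻¹ = a⁻¹ + (a + b⁻¹) = (a⁻¹ + a) + b⁻¹ = b⁻¹.
    ⁻¹-cong : ∀ a b → proj₁ a ≡ proj₁ b → proj₁ (invertible (proj₂ a)) ≡ proj₁ (invertible (proj₂ b))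
    ⁻¹-cong a b a≡b = functional
      (proj₁ (proj₂ (doms (inv a))))
      (associative (commutative (inv a)) (commutative (proj₁ (proj₂ (doms (inv b)))))
        (subst (λ x → Add x (proj₁ (invertible (proj₂ b))) e) (sym a≡b) (inv b)))

  open AbelianGroup group using (_∙_; _≈_) renaming (Carrier to G)
  open IntegerMultiples group

  add : ∀ a b → Add (proj₁ a) (proj₁ b) (proj₁ (a ∙ b))
  add a b = proj₂ (total (proj₂ a) (proj₂ b))

  -- x = x + (y + y⁻¹) = z + y⁻¹
  cancelʳ : ∀ {x x′ y z} → Add x y z → Add x′ y z → x ≡ x′
  cancelʳ p q = let (y⁻¹ , r) = invertible (proj₁ (proj₂ (doms p)))
                    (_ , s) = total (proj₂ (proj₂ (doms p))) (proj₁ (proj₂ (doms r))) in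
    trans (functional (proj₁ (doms p)) (undo p r s)) (sym (functional (proj₁ (doms q)) (undo q r s)))
    where
    undo : ∀ {x y z y⁻¹ w} → Add x y z → Add y y⁻¹ e → Add z y⁻¹ w → Add x e w
    undo p r s = associative p s r

  add⇒≡ : ∀ {a b x} → Add (proj₁ a) (proj₁ b) x → x ≡ proj₁ (a ∙ b)
  add⇒≡ {a} {b} p = functional p (add a b)

  _⋆′_ : ℤ → G → X
  i ⋆′ a = proj₁ (i ⋆ a)

  ⋆-suc : ∀ i a → Add (i ⋆′ a) (proj₁ a) ((i ℤ.+ 1ℤ) ⋆′ a)
  ⋆-suc i a = subst₂ (Add (i ⋆′ a)) (⋆-1 a) (sym (⋆-+ i 1ℤ a)) (add (i ⋆ a) (1ℤ ⋆ a))

  ⋆-pred : ∀ i a → Add ((i ℤ.- 1ℤ) ⋆′ a) (proj₁ a) (i ⋆′ a)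
  ⋆-pred i a = subst (λ j → Add ((i ℤ.- 1ℤ) ⋆′ a) (proj₁ a) (j ⋆′ a)) (i-1+1 i) (⋆-suc (i ℤ.- 1ℤ) a)

module IntegerWalk {k : ℕ} {Add : Vec ℚ k → Vec ℚ k → Vec ℚ k → Set} {e : Vec ℚ k}
  (isGroup : IsRelationalGroup Add e) (i : ℤ) (a : Σ (Vec ℚ k) (IsRelationalGroup.Dom isGroup)) where
  open RelationalGroup isGroup
  open Equivalence

  target : Vec ℚ 1
  target = i / 1 ∷ []

  module _ (Member : Vec ℚ 1 → Vec ℚ k → Set) where
    -- The premises of `actionᴮ` exactly as `Holds` unfolds them, with integers as tuples of length
    -- one, so that they apply to the formula without translation.
    Start Step : Set
    Start = Σ (Vec ℚ 1) λ z → (lookup z zero ≡ ℚ.0ℚ) × Member z e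
    Step  = (j : Vec ℚ 1) (x : Vec ℚ k) → Member j x →
      j ≡ target ⊎ lookup (j ++ target) zero ≡ ℚ.- lookup (j ++ target) (suc zero) ⊎
      (Σ (Vec ℚ 1) λ j′ → Σ (Vec ℚ k) λ y → (lookup (j′ ++ j) zero ≡ lookup (j′ ++ j) (suc zero) ℚ.+ ℚ.1ℚ) ×
         Add x (proj₁ a) y × Member j′ y) ×
      (Σ (Vec ℚ 1) λ j′ → Σ (Vec ℚ k) λ y → (lookup (j ++ j′) zero ≡ lookup (j ++ j′) (suc zero) ℚ.+ ℚ.1ℚ) ×
         Add y (proj₁ a) x × Member j′ y)

    private
      Reached : ℤ → Set
      Reached j = Member (j / 1 ∷ []) (j ⋆′ a)

      predecessor : ∀ j {q} → j / 1 ≡ q ℚ.+ ℚ.1ℚ → q ≡ (j ℤ.- 1ℤ) / 1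
      predecessor j {q} e = begin
        q                                 ≡⟨ ℚ.+-identityʳ q ⟨
        q ℚ.+ (ℚ.1ℚ ℚ.+ ℚ.- ℚ.1ℚ)         ≡⟨ ℚ.+-assoc q ℚ.1ℚ (ℚ.- ℚ.1ℚ) ⟨
        q ℚ.+ ℚ.1ℚ ℚ.+ ℚ.- ℚ.1ℚ           ≡⟨ cong (ℚ._+ ℚ.- ℚ.1ℚ) e ⟨
        j / 1 ℚ.+ ℚ.- ℚ.1ℚ                ≡⟨ +-/1 j (ℤ.- 1ℤ) ⟩
        (j ℤ.- 1ℤ) / 1                    ∎
        where open ≡-Reasoning

      -- |j| < |i| rules out the two escape clauses j = ± i. The neighbours supplied by the step are
      -- not named, but addition is functional and cancellable, so they must be the expected
      -- multiples.
      neighbours : Step → ∀ j → ∣ j ∣ᶻ < ∣ i ∣ᶻ → Reached j → Reached (j ℤ.+ 1ℤ) × Reached (j ℤ.- 1ℤ)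
      neighbours step j lt p with step (j / 1 ∷ []) (j ⋆′ a) p
      ... | inj₁ e = ⊥-elim (ℕ.<-irrefl (cong ∣_∣ᶻ (/1-injective {j} {i} (proj₁ (∷-injective e)))) lt)
      ... | inj₂ (inj₁ e) = ⊥-elim (ℕ.<-irrefl
              (trans (cong ∣_∣ᶻ (/1-injective {j} {ℤ.- i} (trans e (neg-/1 i)))) (ℤ.∣-i∣≡∣i∣ i)) lt)
      ... | inj₂ (inj₂ ((j₁ ∷ [] , y₁ , e₁ , s₁ , m₁) , (j₂ ∷ [] , y₂ , e₂ , s₂ , m₂))) =
        subst₂ (λ q y → Member (q ∷ []) y) (trans e₁ (+-/1 j 1ℤ)) (functional s₁ (⋆-suc j a)) m₁ ,
        subst₂ (λ q y → Member (q ∷ []) y) (predecessor j e₂) (cancelʳ s₂ (⋆-pred j a)) m₂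

      -m-1 : ∀ m → ℤ.- (+ m) ℤ.- 1ℤ ≡ ℤ.- (+ suc m)
      -m-1 m = trans (sym (ℤ.neg-distrib-+ (+ m) 1ℤ)) (cong ℤ.-_ (ℤ.+-comm (+ m) 1ℤ))

      -- Moving away from 0 in both directions at once reaches i whatever its sign.
      walk : Start → Step → ∀ m → m ≤ ∣ i ∣ᶻ → Reached (+ m) × Reached (ℤ.- (+ m))
      walk (z ∷ [] , refl , p) step zero    le = p , p
      walk start               step (suc m) le =
        let (p , q) = walk start step m (ℕ.≤-trans (ℕ.n≤1+n m) le) in
        subst Reached (ℤ.+-comm (+ m) 1ℤ) (proj₁ (neighbours step (+ m) le p)) ,
        subst Reached (-m-1 m) (proj₂ (neighbours step (ℤ.- (+ m))
          (ℕ.≤-trans (s≤s (ℕ.≤-reflexive (ℤ.∣-i∣≡∣i∣ (+ m)))) le) q))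

      reach : Start → Step → ∀ j → ∣ j ∣ᶻ ≤ ∣ i ∣ᶻ → Reached j
      reach start step (+ m)    le = proj₁ (walk start step m le)
      reach start step -[1+ m ] le = proj₂ (walk start step (suc m) le)

    walk-reaches : Start × Step → Member target (i ⋆′ a)
    walk-reaches (start , step) = reach start step i ℕ.≤-refl

  point : ℤ → Vec ℚ (1 ℕ.+ k)
  point j = (j / 1 ∷ []) ++ (j ⋆′ a)

  -- The set that pins down the value: it is closed, because steps may stop at ± i, and its only
  -- entry over i is the multiple i a.
  trace : List (Vec ℚ (1 ℕ.+ k))
  trace = List.map point (interval ∣ i ∣ᶻ)

  trace-value : ∀ b → (target ++ b) ∈ trace → b ≡ i ⋆′ a
  trace-value b p with ∈-map⁻ point {xs = interval ∣ i ∣ᶻ} p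
  ... | j , _ , e = trans (proj₂ (∷-injective e))
    (cong (_⋆′ a) (sym (/1-injective {i} {j} (proj₁ (∷-injective e)))))

  trace-closed : ∀ {Member} → (∀ j x → Member j x ⇔ (j ++ x) ∈ trace) → Start Member × Step Member
  trace-closed {Member} spec = (0ℤ / 1 ∷ [] , refl , reached 0ℤ z≤n) , step
    where
    reached : ∀ j → ∣ j ∣ᶻ ≤ ∣ i ∣ᶻ → Member (j / 1 ∷ []) (j ⋆′ a)
    reached j le = from (spec _ _) (∈-map⁺ point (∈-interval j le))

    step : Step Member
    step (q ∷ []) x p with ∈-map⁻ point {xs = interval ∣ i ∣ᶻ} (to (spec _ _) p)
    ... | j , j∈ , refl with ∣ j ∣ᶻ ℕ.≟ ∣ i ∣ᶻ
    ...   | yes e = Sum.map (λ { refl → refl }) (λ { refl → inj₁ (sym (neg-/1 i)) }) (∣j∣≡∣i∣⇒j≡±i i j e)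
    ...   | no ne = inj₂ (inj₂
      (((j ℤ.+ 1ℤ) / 1 ∷ [] , (j ℤ.+ 1ℤ) ⋆′ a , sym (+-/1 j 1ℤ) , ⋆-suc j a ,
         reached (j ℤ.+ 1ℤ) (ℕ.≤-trans (∣i+1∣≤ j) lt)) ,
       ((j ℤ.- 1ℤ) / 1 ∷ [] , (j ℤ.- 1ℤ) ⋆′ a ,
         trans (cong (_/ 1) (sym (i-1+1 j))) (sym (+-/1 (j ℤ.- 1ℤ) 1ℤ)) ,
         ⋆-pred j a , reached (j ℤ.- 1ℤ) (ℕ.≤-trans (∣i-1∣≤ j) lt))))
      where
      lt : ∣ j ∣ᶻ < ∣ i ∣ᶻ
      lt = ℕ.≤∧≢⇒< (interval-∈ j∈) ne

private
  pattern v0 = here refl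
  pattern v1 = there v0
  pattern v2 = there v1
  pattern v3 = there v2
  pattern v4 = there v3
  pattern v5 = there v4
  pattern v6 = there v5
  pattern v7 = there v6
  pattern v8 = there v7
  pattern v9 = there v8

-- The module laws as a first-order sentence

module Action (Z : Formula 1) (defZ : Definesℤ Z) (k m : ℕ) (γ : Formula ((k ℕ.+ (k ℕ.+ k)) ℕ.+ m)) where
  open Membership Z defZ
  open Equivalence

  sumᴮ : k ∈ Γ → k ∈ Γ → k ∈ Γ → m ∈ Γ → Block Γ
  sumᴮ x y z c = rel γ (([ x ] ⧺ ([ y ] ⧺ [ z ])) ⧺ [ c ])

  memberᴮ : 1 ∈ Γ → k ∈ Γ → 5 ∈ Γ → Block Γ
  memberᴮ i x s = rel (member (1 ℕ.+ k)) (([ i ] ⧺ [ x ]) ⧺ [ s ])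

  -- With variables n, a, b, e, c, and e the identity: b = n a.  It says that
  -- (n , b) belongs to every coded set T containing (0 , e) which is closed
  -- under (i , x) ↦ (i ± 1 , x ± a) as long as i ≠ ± n.
  actionᴮ : Block (1 ∷ k ∷ k ∷ k ∷ m ∷ [])
  actionᴮ = ∀ᴮ 5 (start ∧ᴮ step ⇒ᴮ memberᴮ v1 v3 v0)
    where
    start = ∃ᴮ 1 (rel (var zero ≐ 0′) [ v0 ] ∧ᴮ memberᴮ v0 v5 v1)

    step = ∀ᴮ 1 (∀ᴮ k (memberᴮ v1 v0 v2 ⇒ᴮ
      eqᴮ v1 v3 ∨ᴮ rel (var zero ≐ -′ var (suc zero)) ([ v1 ] ⧺ [ v3 ]) ∨ᴮ
      ∃ᴮ 1 (∃ᴮ k (rel (var zero ≐ var (suc zero) +′ 1′) ([ v1 ] ⧺ [ v3 ]) ∧ᴮ sumᴮ v2 v6 v0 v9 ∧ᴮ memberᴮ v1 v0 v4)) ∧ᴮ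
      ∃ᴮ 1 (∃ᴮ k (rel (var zero ≐ var (suc zero) +′ 1′) ([ v3 ] ⧺ [ v1 ]) ∧ᴮ sumᴮ v0 v6 v2 v9 ∧ᴮ memberᴮ v1 v0 v4))))

  -- To place `actionᴮ` under other quantifiers it is compiled first and then applied as a relation
  -- symbol; the identity and the parameters are passed along as arguments.
  actᴮ : 1 ∈ Γ → k ∈ Γ → k ∈ Γ → k ∈ Γ → m ∈ Γ → Block Γ
  actᴮ n a b e c = rel (compile actionᴮ) ([ n ] ⧺ [ a ] ⧺ [ b ] ⧺ [ e ] ⧺ [ c ] ⧺ nil)

  domᴮ : k ∈ Γ → k ∈ Γ → m ∈ Γ → Block Γ
  domᴮ x e c = sumᴮ x e x c

  groupᴮ : Block (k ∷ m ∷ [])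
  groupᴮ =
    domᴮ v0 v0 v1 ∧ᴮ
    ∀ᴮ k (∀ᴮ k (∀ᴮ k (∀ᴮ k (sumᴮ v3 v2 v1 v5 ⇒ᴮ sumᴮ v3 v2 v0 v5 ⇒ᴮ eqᴮ v1 v0)))) ∧ᴮ
    ∀ᴮ k (∀ᴮ k (domᴮ v1 v2 v3 ⇒ᴮ domᴮ v0 v2 v3 ⇒ᴮ ∃ᴮ k (sumᴮ v2 v1 v0 v4))) ∧ᴮ
    ∀ᴮ k (∀ᴮ k (∀ᴮ k (sumᴮ v2 v1 v0 v4 ⇒ᴮ domᴮ v2 v3 v4 ∧ᴮ domᴮ v1 v3 v4 ∧ᴮ domᴮ v0 v3 v4))) ∧ᴮ
    -- x, y, z, u = x + y, w = u + z, v = y + z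
    ∀ᴮ k (∀ᴮ k (∀ᴮ k (∀ᴮ k (∀ᴮ k (∀ᴮ k
      (sumᴮ v5 v4 v2 v7 ⇒ᴮ sumᴮ v2 v3 v1 v7 ⇒ᴮ sumᴮ v4 v3 v0 v7 ⇒ᴮ sumᴮ v5 v0 v1 v7)))))) ∧ᴮ
    ∀ᴮ k (∀ᴮ k (∀ᴮ k (sumᴮ v2 v1 v0 v4 ⇒ᴮ sumᴮ v1 v2 v0 v4))) ∧ᴮ
    ∀ᴮ k (domᴮ v0 v1 v2 ⇒ᴮ ∃ᴮ k (sumᴮ v1 v0 v2 v3))

  -- The first two clauses turn the relation into a function, and the others state the module laws
  -- on its values. The laws for 0 and for inverses are derived from these inside the group.
  actionLawsᴮ : Block (k ∷ m ∷ [])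
  actionLawsᴮ =
    ∀ᴮ 1 (∀ᴮ k (rel Z [ v1 ] ⇒ᴮ domᴮ v0 v2 v3 ⇒ᴮ ∃ᴮ k (domᴮ v0 v3 v4 ∧ᴮ actᴮ v2 v1 v0 v3 v4))) ∧ᴮ
    ∀ᴮ 1 (∀ᴮ k (∀ᴮ k (∀ᴮ k (rel Z [ v3 ] ⇒ᴮ domᴮ v2 v4 v5 ⇒ᴮ
      actᴮ v3 v2 v1 v4 v5 ⇒ᴮ actᴮ v3 v2 v0 v4 v5 ⇒ᴮ eqᴮ v1 v0)))) ∧ᴮ
    ∀ᴮ 1 (∀ᴮ k (rel (var zero ≐ 1′) [ v1 ] ⇒ᴮ domᴮ v0 v2 v3 ⇒ᴮ actᴮ v1 v0 v0 v2 v3)) ∧ᴮ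
    -- n, n′, l = n + n′, a, b = n a, b′ = n′ a, d = b + b′
    ∀ᴮ 1 (∀ᴮ 1 (∀ᴮ 1 (∀ᴮ k (∀ᴮ k (∀ᴮ k (∀ᴮ k (rel Z [ v6 ] ⇒ᴮ rel Z [ v5 ] ⇒ᴮ
      rel (var zero ≐ var (suc zero) +′ var (suc (suc zero))) ([ v4 ] ⧺ [ v6 ] ⧺ [ v5 ]) ⇒ᴮ domᴮ v3 v7 v8 ⇒ᴮ
      actᴮ v6 v3 v2 v7 v8 ⇒ᴮ actᴮ v5 v3 v1 v7 v8 ⇒ᴮ sumᴮ v2 v1 v0 v8 ⇒ᴮ actᴮ v4 v3 v0 v7 v8))))))) ∧ᴮ
    -- n, n′, l = n n′, a, b = n′ a, d = n b
    ∀ᴮ 1 (∀ᴮ 1 (∀ᴮ 1 (∀ᴮ k (∀ᴮ k (∀ᴮ k (rel Z [ v5 ] ⇒ᴮ rel Z [ v4 ] ⇒ᴮ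
      rel (var zero ≐ var (suc zero) *′ var (suc (suc zero))) ([ v3 ] ⧺ [ v5 ] ⧺ [ v4 ]) ⇒ᴮ domᴮ v2 v6 v7 ⇒ᴮ
      actᴮ v4 v2 v1 v6 v7 ⇒ᴮ actᴮ v5 v1 v0 v6 v7 ⇒ᴮ actᴮ v3 v2 v0 v6 v7)))))) ∧ᴮ
    -- n, a, a′, a″ = a + a′, b = n a, b′ = n a′, b″ = b + b′
    ∀ᴮ 1 (∀ᴮ k (∀ᴮ k (∀ᴮ k (∀ᴮ k (∀ᴮ k (∀ᴮ k (rel Z [ v6 ] ⇒ᴮ domᴮ v5 v7 v8 ⇒ᴮ domᴮ v4 v7 v8 ⇒ᴮ
      sumᴮ v5 v4 v3 v8 ⇒ᴮ actᴮ v6 v5 v2 v7 v8 ⇒ᴮ actᴮ v6 v4 v1 v7 v8 ⇒ᴮ sumᴮ v2 v1 v0 v8 ⇒ᴮ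
      actᴮ v6 v3 v0 v7 v8)))))))

  module Parameters (c : Vec ℚ m) (e : Vec ℚ k) (isGroup : Holds 𝓠 groupᴮ (e ∷ c ∷ [])) where
    Add : (x y z : Vec ℚ k) → Set
    Add x y z = 𝓠 ⊨ γ [ (x ++ (y ++ z)) ++ c ]

    isRelationalGroup : IsRelationalGroup Add e
    isRelationalGroup = let (p₁ , p₂ , p₃ , p₄ , p₅ , p₆ , p₇) = isGroup in record
      { dom-e = p₁ ; functional = p₂ ; total = p₃ ; doms = p₄
      ; associative = p₅ ; commutative = p₆ ; invertible = p₇ }

    Member : Vec ℚ 5 → Vec ℚ 1 → Vec ℚ k → Set
    Member s j x = 𝓠 ⊨ member (1 ℕ.+ k) [ (j ++ x) ++ s ]

    Act : Vec ℚ 1 → Vec ℚ k → Vec ℚ k → Set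
    Act n a b = 𝓠 ⊨ compile actionᴮ [ n ++ (a ++ (b ++ (e ++ (c ++ [])))) ]

    open RelationalGroup isRelationalGroup using (group; _⋆′_)

    module _ (i : ℤ) (a : AbelianGroup.Carrier group) where
      open IntegerWalk isRelationalGroup i a

      act-complete : Act target (proj₁ a) (i ⋆′ a)
      act-complete = to (compile-correct 𝓠 actionᴮ (target ∷ proj₁ a ∷ i ⋆′ a ∷ e ∷ c ∷ []))
        λ s closed → walk-reaches (Member s) closed

      act-sound : ∀ b → Act target (proj₁ a) b → b ≡ i ⋆′ a
      -- The quantifier over all coded sets is instantiated at a code of `trace`.
      act-sound b p = let (s , spec) = finite-definable trace in
        trace-value b (to (spec (target ++ b)) (from (compile-correct 𝓠 actionᴮ (target ∷ proj₁ a ∷ b ∷ e ∷ c ∷ [])) p s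
          (trace-closed {Member s} λ j x → spec (j ++ x))))

    private
      open RelationalGroup isRelationalGroup using (add⇒≡)
      open AbelianGroup group using (_∙_) renaming (Carrier to G)
      open IntegerMultiples group using (_⋆_; ⋆-1; ⋆-+; ⋆-assoc; ⋆-distrib)

      IsInteger : ℚ → Set
      IsInteger q = 𝓠 ⊨ Z [ q ∷ [] ]

      number : ∀ {q} → IsInteger q → ∃[ i ] q ≡ i / 1
      number = to (defZ _)

      act : ∀ i (a : G) {q b} → q ≡ i / 1 → b ≡ i ⋆′ a → Act (q ∷ []) (proj₁ a) b
      act i a refl refl = act-complete i a

      value : ∀ i (a : G) {q} b → q ≡ i / 1 → Act (q ∷ []) (proj₁ a) b → b ≡ i ⋆′ a
      value i a b refl p = act-sound i a b p

    actionLaws : Holds 𝓠 actionLawsᴮ (e ∷ c ∷ [])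
    actionLaws = exists , unique , one , sum-law , product-law , distributive
      where
      exists : (n : Vec ℚ 1) (a : Vec ℚ k) → 𝓠 ⊨ Z [ n ] → Add a e a → Σ (Vec ℚ k) λ b → Add b e b × Act n a b
      exists (q ∷ []) a z da = let (i , q≡) = number z in
        i ⋆′ (a , da) , proj₂ (i ⋆ (a , da)) , act i (a , da) q≡ refl

      unique : (n : Vec ℚ 1) (a b b′ : Vec ℚ k) → 𝓠 ⊨ Z [ n ] → Add a e a → Act n a b → Act n a b′ → b ≡ b′
      unique (q ∷ []) a b b′ z da p p′ = let (i , q≡) = number z in
        trans (value i (a , da) b q≡ p) (sym (value i (a , da) b′ q≡ p′))

      one : (n : Vec ℚ 1) (a : Vec ℚ k) → lookup n zero ≡ ℚ.1ℚ → Add a e a → Act n a a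
      one (q ∷ []) a q≡1 da = act 1ℤ (a , da) q≡1 (sym (⋆-1 (a , da)))

      sum-law : (n n′ l : Vec ℚ 1) (a b b′ d : Vec ℚ k) → 𝓠 ⊨ Z [ n ] → 𝓠 ⊨ Z [ n′ ] →
        lookup (l ++ (n ++ n′)) zero ≡ lookup (l ++ (n ++ n′)) (suc zero) ℚ.+ lookup (l ++ (n ++ n′)) (suc (suc zero)) →
        Add a e a → Act n a b → Act n′ a b′ → Add b b′ d → Act l a d
      sum-law (q ∷ []) (q′ ∷ []) (r ∷ []) a b b′ d z z′ l≡ da p p′ s =
        let (i , q≡) = number z ; (j , q′≡) = number z′ ; A = a , da
            b≡ = value i A b q≡ p ; b′≡ = value j A b′ q′≡ p′ in
        act (i ℤ.+ j) A (trans l≡ (trans (cong₂ ℚ._+_ q≡ q′≡) (+-/1 i j)))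
          (trans (add⇒≡ {i ⋆ A} {j ⋆ A} (subst₂ (λ x y → Add x y d) b≡ b′≡ s)) (sym (⋆-+ i j A)))

      product-law : (n n′ l : Vec ℚ 1) (a b d : Vec ℚ k) → 𝓠 ⊨ Z [ n ] → 𝓠 ⊨ Z [ n′ ] →
        lookup (l ++ (n ++ n′)) zero ≡ lookup (l ++ (n ++ n′)) (suc zero) ℚ.* lookup (l ++ (n ++ n′)) (suc (suc zero)) →
        Add a e a → Act n′ a b → Act n b d → Act l a d
      product-law (q ∷ []) (q′ ∷ []) (r ∷ []) a b d z z′ l≡ da p p′ =
        let (i , q≡) = number z ; (j , q′≡) = number z′ ; A = a , da
            b≡ = value j A b q′≡ p in
        act (i ℤ.* j) A (trans l≡ (trans (cong₂ ℚ._*_ q≡ q′≡) (*-/1 i j)))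
          (trans (value i (j ⋆ A) d q≡ (subst (λ x → Act (q ∷ []) x d) b≡ p′)) (sym (⋆-assoc i j A)))

      distributive : (n : Vec ℚ 1) (a a′ a″ b b′ b″ : Vec ℚ k) → 𝓠 ⊨ Z [ n ] → Add a e a → Add a′ e a′ →
        Add a a′ a″ → Act n a b → Act n a′ b′ → Add b b′ b″ → Act n a″ b″
      distributive (q ∷ []) a a′ a″ b b′ b″ z da da′ s p p′ s′ =
        let (i , q≡) = number z ; A = a , da ; A′ = a′ , da′
            a″≡ = add⇒≡ {A} {A′} s in
        subst (λ x → Act (q ∷ []) x b″) (sym a″≡) (act i (A ∙ A′) q≡
          (trans (add⇒≡ {i ⋆ A} {i ⋆ A′}
              (subst₂ (λ x y → Add x y b″) (value i A b q≡ p) (value i A′ b′ q≡ p′) s′))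
            (sym (⋆-distrib i A A′))))

  actionTheoremᴮ : Block []
  actionTheoremᴮ = ∀ᴮ m (∀ᴮ k (groupᴮ ⇒ᴮ actionLawsᴮ))

  actionTheorem : ∀ {ℓ} (M : Structure ℓ) → M ⊨Thℚ → Holds M actionTheoremᴮ []
  actionTheorem M th = transfer M th actionTheoremᴮ λ c e isGroup → Parameters.actionLaws c e isGroup

-- Elements of an abstract group are represented by tuples through `encode`, so one argument covers
-- both kinds of groups: for a definable group `encode` forgets the proof of membership, for an
-- elliptic curve it sends a point to its coding triple.
module DefinableAddition {ℓ g h : Level} (M : Structure ℓ) (th : M ⊨Thℚ) (Z : Formula 1) (defZ : Definesℤ Z)
  (G : AbelianGroup g h) {k m : ℕ} (γ : Formula ((k ℕ.+ (k ℕ.+ k)) ℕ.+ m)) (c : Vec ∣ M ∣ m)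
  (encode : AbelianGroup.Carrier G → Vec ∣ M ∣ k)
  (encode-cong : ∀ {a b} → AbelianGroup._≈_ G a b → encode a ≡ encode b)
  (encode-injective : ∀ {a b} → encode a ≡ encode b → AbelianGroup._≈_ G a b)
  (graph : ∀ v → (∃[ a ] ∃[ b ] v ≡ encode a ++ (encode b ++ encode (AbelianGroup._∙_ G a b))) ⇔
     (M ⊨ γ [ v ++ c ]))
  where

  open AbelianGroup G renaming
    (refl to ≈-refl; sym to ≈-sym; trans to ≈-trans; identityˡ to ∙-identityˡ; identityʳ to ∙-identityʳ)
  open Action Z defZ k m γ
  open NonstandardIntegers M th Z defZ
  open Equivalence
  open GroupProperties group using (identityˡ-unique; inverseˡ-unique)
  private
    module ℤ* = CommutativeRing ring

    Add : (x y z : Vec ∣ M ∣ k) → Set ℓ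
    Add x y z = M ⊨ γ [ (x ++ (y ++ z)) ++ c ]

    e : Vec ∣ M ∣ k
    e = encode ε

    sum : ∀ a b → Add (encode a) (encode b) (encode (a ∙ b))
    sum a b = to (graph _) (a , b , refl)

    sum′ : ∀ a b {d} → a ∙ b ≈ d → Add (encode a) (encode b) (encode d)
    sum′ a b p = subst (Add (encode a) (encode b)) (encode-cong p) (sum a b)

    decode : ∀ x y z → Add x y z → ∃[ a ] ∃[ b ] (x ≡ encode a) × (y ≡ encode b) × (z ≡ encode (a ∙ b))
    decode x y z p = let (a , b , q) = from (graph (x ++ (y ++ z))) p
                         (x≡ , q′)   = ++-injective x (encode a) q
                         (y≡ , z≡)   = ++-injective y (encode b) q′
                     in a , b , x≡ , y≡ , z≡

    dom : ∀ a → Add (encode a) e (encode a)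
    dom a = sum′ a ε (∙-identityʳ a)

    decode-dom : ∀ x → Add x e x → ∃[ a ] x ≡ encode a
    decode-dom x p = let (a , _ , x≡ , _) = decode x e x p in a , x≡

    functional : ∀ x y z z′ → Add x y z → Add x y z′ → z ≡ z′
    functional x y z z′ p p′ with decode x y z p | decode x y z′ p′
    ... | a , b , refl , refl , refl | a′ , b′ , a≡ , b≡ , refl =
      encode-cong (∙-cong (encode-injective a≡) (encode-injective b≡))

    total : ∀ x y → Add x e x → Add y e y → Σ (Vec ∣ M ∣ k) (Add x y)
    total x y p q with decode-dom x p | decode-dom y q
    ... | a , refl | b , refl = encode (a ∙ b) , sum a b

    doms : ∀ x y z → Add x y z → Add x e x × Add y e y × Add z e z
    doms x y z p with decode x y z p
    ... | a , b , refl , refl , refl = dom a , dom b , dom (a ∙ b)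

    associative : ∀ x y z u w v → Add x y u → Add u z w → Add y z v → Add x v w
    associative x y z u w v p q r with decode x y u p | decode u z w q | decode y z v r
    ... | a , b , refl , refl , refl | ab , d , ab≡ , refl , refl | b′ , d′ , b≡ , d≡ , refl =
      sum′ a (b′ ∙ d′) (≈-trans (∙-congˡ (∙-cong (≈-sym (encode-injective b≡)) (≈-sym (encode-injective d≡))))
        (≈-trans (≈-sym (assoc a b d)) (∙-congʳ (encode-injective ab≡))))

    commutative : ∀ x y z → Add x y z → Add y x z
    commutative x y z p with decode x y z p
    ... | a , b , refl , refl , refl = sum′ b a (comm b a)

    invertible : ∀ x → Add x e x → Σ (Vec ∣ M ∣ k) λ y → Add x y e
    invertible x p with decode-dom x p
    ... | a , refl = encode (a ⁻¹) , sum′ a (a ⁻¹) (inverseʳ a)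

    Act : Vec ∣ M ∣ 1 → Vec ∣ M ∣ k → Vec ∣ M ∣ k → Set ℓ
    Act n a b = M ⊨ compile actionᴮ [ n ++ (a ++ (b ++ (e ++ (c ++ [])))) ]

    laws : Holds M actionLawsᴮ (e ∷ c ∷ [])
    laws = actionTheorem M th c e
      (dom ε , functional , total , doms , associative , commutative , invertible)

  infixr 7.5 _·*_
  opaque
    _·*_ : *ℤ → Carrier → Carrier
    (x , z) ·* a =
      let (b , db , _) = proj₁ laws (x ∷ []) (encode a) z (dom a) in proj₁ (decode-dom b db)

    act : ∀ x a → Act (proj₁ x ∷ []) (encode a) (encode (x ·* a))
    act (x , z) a = let (b , db , p) = proj₁ laws (x ∷ []) (encode a) z (dom a) in
      subst (Act (x ∷ []) (encode a)) (proj₂ (decode-dom b db)) p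

    value : ∀ x a b → Act (proj₁ x ∷ []) (encode a) (encode b) → x ·* a ≈ b
    value (x , z) a b p = encode-injective
      (proj₁ (proj₂ laws) (x ∷ []) (encode a) (encode ((x , z) ·* a)) (encode b) z (dom a) (act (x , z) a) p)

  private
    ·*-cong : ∀ {x y a b} → proj₁ x ≡ proj₁ y → a ≈ b → x ·* a ≈ y ·* b
    ·*-cong {x} {y} {a} {b} p q = value x a (y ·* b)
      (subst₂ (λ u v → Act (u ∷ []) v (encode (y ·* b))) (sym p) (sym (encode-cong q)) (act y b))

    ·*-identityˡ : ∀ a → ℤ*.1# ·* a ≈ a
    ·*-identityˡ a = value ℤ*.1# a a (proj₁ (proj₂ (proj₂ laws)) (proj₁ ℤ*.1# ∷ []) (encode a) refl (dom a))

    ·*-distribʳ : ∀ a x y → (x ℤ*.+ y) ·* a ≈ x ·* a ∙ y ·* a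
    ·*-distribʳ a x y = value (x ℤ*.+ y) a (x ·* a ∙ y ·* a) (proj₁ (proj₂ (proj₂ (proj₂ laws)))
      (proj₁ x ∷ []) (proj₁ y ∷ []) (proj₁ (x ℤ*.+ y) ∷ []) (encode a)
      (encode (x ·* a)) (encode (y ·* a)) (encode (x ·* a ∙ y ·* a))
      (proj₂ x) (proj₂ y) refl (dom a) (act x a) (act y a) (sum (x ·* a) (y ·* a)))

    ·*-assoc : ∀ x y a → (x ℤ*.* y) ·* a ≈ x ·* (y ·* a)
    ·*-assoc x y a = value (x ℤ*.* y) a (x ·* (y ·* a)) (proj₁ (proj₂ (proj₂ (proj₂ (proj₂ laws))))
      (proj₁ x ∷ []) (proj₁ y ∷ []) (proj₁ (x ℤ*.* y) ∷ []) (encode a) (encode (y ·* a)) (encode (x ·* (y ·* a)))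
      (proj₂ x) (proj₂ y) refl (dom a) (act y a) (act x (y ·* a)))

    ·*-distribˡ : ∀ x a b → x ·* (a ∙ b) ≈ x ·* a ∙ x ·* b
    ·*-distribˡ x a b = value x (a ∙ b) (x ·* a ∙ x ·* b) (proj₂ (proj₂ (proj₂ (proj₂ (proj₂ laws))))
      (proj₁ x ∷ []) (encode a) (encode b) (encode (a ∙ b))
      (encode (x ·* a)) (encode (x ·* b)) (encode (x ·* a ∙ x ·* b))
      (proj₂ x) (dom a) (dom b) (sum a b) (act x a) (act x b) (sum (x ·* a) (x ·* b)))

    ·*-zeroˡ : ∀ a → ℤ*.0# ·* a ≈ ε
    ·*-zeroˡ a = identityˡ-unique _ _ (≈-trans (≈-sym (·*-distribʳ a ℤ*.0# ℤ*.0#))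
      (·*-cong (ℤ*.+-identityˡ ℤ*.0#) ≈-refl))

    ·*-zeroʳ : ∀ x → x ·* ε ≈ ε
    ·*-zeroʳ x = identityˡ-unique _ _ (≈-trans (≈-sym (·*-distribˡ x ε ε))
      (·*-cong {x} refl (∙-identityˡ ε)))

    -- `embed` is given only by chosen witnesses, but it is elementary, so its compatibility with an
    -- operation is the truth of an atomic formula at rational arguments.
    embed-+ : ∀ i j → embed M th ((i ℤ.+ j) / 1) ≡ Structure._+_ M (embed M th (i / 1)) (embed M th (j / 1))
    embed-+ i j = embed-elementary M th (var zero ≐ var (suc zero) +′ var (suc (suc zero)))
      ((i ℤ.+ j) / 1 ∷ i / 1 ∷ j / 1 ∷ []) (sym (+-/1 i j))

    embed-neg : ∀ i → embed M th ((ℤ.- i) / 1) ≡ Structure.-_ M (embed M th (i / 1))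
    embed-neg i = embed-elementary M th (var zero ≐ -′ var (suc zero))
      ((ℤ.- i) / 1 ∷ i / 1 ∷ []) (sym (neg-/1 i))

    embed-0 : embed M th (0ℤ / 1) ≡ Structure.0# M
    embed-0 = embed-elementary M th (var zero ≐ 0′) (0ℤ / 1 ∷ []) refl

    embed-1 : embed M th (1ℤ / 1) ≡ Structure.1# M
    embed-1 = embed-elementary M th (var zero ≐ 1′) (1ℤ / 1 ∷ []) refl

    extends-ℕ : ∀ n a → embedℤ (+ n) ·* a ≈ natural G (+ n) a
    extends-ℕ zero    a = ≈-trans (·*-cong {y = ℤ*.0#} embed-0 ≈-refl) (·*-zeroˡ a)
    extends-ℕ (suc n) a = ≈-trans
      (·*-cong {y = ℤ*.1# ℤ*.+ embedℤ (+ n)}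
        (trans (embed-+ 1ℤ (+ n)) (cong (λ u → Structure._+_ M u _) embed-1)) ≈-refl)
      (≈-trans (·*-distribʳ a ℤ*.1# (embedℤ (+ n))) (∙-cong (·*-identityˡ a) (extends-ℕ n a)))

    -- Both sides are inverse to x a, by the two distributive laws. The form is dictated by
    -- `natural`, which takes positive multiples of the inverse for negative integers.
    negate : ∀ x a → (ℤ*.- x) ·* a ≈ x ·* (a ⁻¹)
    negate x a = ≈-trans
      (inverseˡ-unique _ _ (≈-trans (≈-sym (·*-distribʳ a (ℤ*.- x) x))
        (≈-trans (·*-cong {y = ℤ*.0#} (ℤ*.-‿inverseˡ x) ≈-refl) (·*-zeroˡ a))))
      (≈-sym (inverseˡ-unique _ _ (≈-trans (≈-sym (·*-distribˡ x (a ⁻¹) a))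
        (≈-trans (·*-cong {x} refl (inverseˡ a)) (·*-zeroʳ x)))))

    extends : ∀ i a → embedℤ i ·* a ≈ natural G i a
    extends (+ n)      a = extends-ℕ n a
    extends (-[1+ n ]) a = ≈-trans
      (·*-cong {y = ℤ*.- embedℤ (+ suc n)} (embed-neg (+ suc n)) ≈-refl)
      (≈-trans (negate (embedℤ (+ suc n)) a) (extends-ℕ (suc n) (a ⁻¹)))

  moduleExtension : ModuleExtension G
  moduleExtension = record
    { _·*_ = _·*_
    ; isLeftModule = record
      { isLeftSemimodule = record
        { +ᴹ-isCommutativeMonoid = isCommutativeMonoid
        ; isPreleftSemimodule = record
          { *ₗ-cong = λ {x} {y} → ·*-cong {x} {y}
          ; *ₗ-zeroˡ = ·*-zeroˡ
          ; *ₗ-distribʳ = ·*-distribʳ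
          ; *ₗ-identityˡ = ·*-identityˡ
          ; *ₗ-assoc = ·*-assoc
          ; *ₗ-zeroʳ = ·*-zeroʳ
          ; *ₗ-distribˡ = ·*-distribˡ } }
      ; -ᴹ‿cong = ⁻¹-cong
      ; -ᴹ‿inverse = inverse }
    ; extends = extends }

-- Definability of the group law on an elliptic curve

module ModelField {ℓ} (M : Structure ℓ) (th : M ⊨Thℚ) where
  open Structure M

  private
    x₀ : ∀ {n} → Term (suc n)
    x₀ = var 0F
    x₁ : ∀ {n} → Term (suc (suc n))
    x₁ = var 1F
    x₂ : ∀ {n} → Term (suc (suc (suc n)))
    x₂ = var 2F

  ring : IsRing M
  ring = record
    { isRing = record
      { +-isAbelianGroup = record
        { isGroup = record
          { isMonoid = record
            { isSemigroup = record
              { isMagma = record { isEquivalence = isEquivalence ; ∙-cong = cong₂ _+_ }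
              ; assoc = th (∀′ (∀′ (∀′ ((x₂ +′ x₁) +′ x₀ ≐ x₂ +′ (x₁ +′ x₀))))) ℚ.+-assoc }
            ; identity = th (∀′ (0′ +′ x₀ ≐ x₀)) ℚ.+-identityˡ , th (∀′ (x₀ +′ 0′ ≐ x₀)) ℚ.+-identityʳ }
          ; inverse = th (∀′ (-′ x₀ +′ x₀ ≐ 0′)) ℚ.+-inverseˡ , th (∀′ (x₀ +′ -′ x₀ ≐ 0′)) ℚ.+-inverseʳ
          ; ⁻¹-cong = cong -_ }
        ; comm = th (∀′ (∀′ (x₁ +′ x₀ ≐ x₀ +′ x₁))) ℚ.+-comm }
      ; *-cong = cong₂ _*_
      ; *-assoc = th (∀′ (∀′ (∀′ ((x₂ *′ x₁) *′ x₀ ≐ x₂ *′ (x₁ *′ x₀))))) ℚ.*-assoc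
      ; *-identity = th (∀′ (1′ *′ x₀ ≐ x₀)) ℚ.*-identityˡ , th (∀′ (x₀ *′ 1′ ≐ x₀)) ℚ.*-identityʳ
      ; distrib =
          th (∀′ (∀′ (∀′ (x₂ *′ (x₁ +′ x₀) ≐ x₂ *′ x₁ +′ x₂ *′ x₀)))) ℚ.*-distribˡ-+ ,
          th (∀′ (∀′ (∀′ ((x₁ +′ x₀) *′ x₂ ≐ x₁ *′ x₂ +′ x₀ *′ x₂)))) ℚ.*-distribʳ-+ }
    ; *-comm = th (∀′ (∀′ (x₁ *′ x₀ ≐ x₀ *′ x₁))) ℚ.*-comm }

  isField : IsDecidableField (commutativeRing M ring)
  isField = record
    { _≟_ = λ x y → toDec (th (∀′ (∀′ (x₁ ≐ x₀ ∨′ (x₁ ≐ x₀ ⇒′ ⊥′)))) (λ x y → decide (x ℚ.≟ y)) x y)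
    ; inverse = λ x x≢0 → nonzero x≢0
        (th (∀′ (x₀ ≐ 0′ ∨′ ∃′ (x₁ *′ x₀ ≐ 1′))) ℚ-inverse x)
    ; 1≉0 = λ e → lower (th (1′ ≐ 0′ ⇒′ ⊥′) (λ ()) e) }
    where
    toDec : ∀ {x y : ∣ M ∣} → (x ≡ y) ⊎ (x ≡ y → _) → Dec (x ≡ y)
    toDec (inj₁ e) = yes e
    toDec (inj₂ f) = no λ e → lower (f e)

    nonzero : ∀ {x : ∣ M ∣} {P : ∣ M ∣ → Set ℓ} → ¬ x ≡ 0# → x ≡ 0# ⊎ ∃ P → ∃ P
    nonzero x≢0 (inj₁ e) = ⊥-elim (x≢0 e)
    nonzero x≢0 (inj₂ y) = y

    decide : ∀ {x y : ℚ.ℚ} → Dec (x ≡ y) → (x ≡ y) ⊎ (x ≡ y → _)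
    decide (yes e) = inj₁ e
    decide (no ne) = inj₂ λ e → Level.lift (ne e)

    ℚ-inverse : ∀ x → x ≡ ℚ.0ℚ ⊎ (∃[ y ] x ℚ.* y ≡ ℚ.1ℚ)
    ℚ-inverse x with x ℚ.≟ ℚ.0ℚ
    ... | yes e  = inj₁ e
    ... | no x≢0 = inj₂ (ℚ.1/_ x {{ℚ.≢-nonZero x≢0}} , ℚ.*-inverseʳ x {{ℚ.≢-nonZero x≢0}})

  x+x≡0⇒x≡0 : ∀ x → x + x ≡ 0# → x ≡ 0#
  x+x≡0⇒x≡0 = th (∀′ (x₀ +′ x₀ ≐ 0′ ⇒′ x₀ ≐ 0′)) λ x e → begin
    x                         ≡⟨ ℚ.*-identityˡ x ⟨
    (ℚ.½ ℚ.+ ℚ.½) ℚ.* x       ≡⟨ ℚ.*-distribʳ-+ x ℚ.½ ℚ.½ ⟩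
    ℚ.½ ℚ.* x ℚ.+ ℚ.½ ℚ.* x   ≡⟨ ℚ.*-distribˡ-+ ℚ.½ x x ⟨
    ℚ.½ ℚ.* (x ℚ.+ x)         ≡⟨ cong (ℚ.½ ℚ.*_) e ⟩
    ℚ.½ ℚ.* ℚ.0ℚ              ≡⟨ ℚ.*-zeroʳ ℚ.½ ⟩
    ℚ.0ℚ                      ∎
    where open ≡-Reasoning

-- A point is coded by a triple: O by (0, 0, 0), (x, y) by (x, y, 1).  The
-- variables are the three coordinates of P, of Q, of R, then A and B.
chordTangentFormula : Formula 11
chordTangentFormula =
  (isO 0F 1F 2F ∧′ point 3F 4F 5F ∧′ same 3F 4F 5F 6F 7F 8F) ∨′
  (isO 3F 4F 5F ∧′ point 0F 1F 2F ∧′ same 0F 1F 2F 6F 7F 8F) ∨′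
  (isAffine 0F 1F 2F ∧′ isAffine 3F 4F 5F ∧′ isO 6F 7F 8F ∧′ x 0F ≐ x 3F ∧′ x 1F ≐ -′ x 4F) ∨′
  (isAffine 0F 1F 2F ∧′ isAffine 3F 4F 5F ∧′ isAffine 6F 7F 8F ∧′ ∃′
    ((y 0F ≐ y 3F ⇒′ ⊥′) ∧′ s *′ (y 3F +′ -′ y 0F) ≐ y 4F +′ -′ y 1F ∧′ third)) ∨′
  (isAffine 0F 1F 2F ∧′ isAffine 3F 4F 5F ∧′ isAffine 6F 7F 8F ∧′ ∃′
    (y 0F ≐ y 3F ∧′ y 1F ≐ y 4F ∧′ (y 1F ≐ -′ y 4F ⇒′ ⊥′) ∧′
     s *′ (numeral 2 *′ y 1F) ≐ numeral 3 *′ (y 0F *′ y 0F) +′ y 9F ∧′ third))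
  where
  x : Fin 11 → Term 11
  x = var

  y : Fin 11 → Term 12
  y i = var (suc i)

  s : Term 12
  s = var 0F

  third : Formula 12
  third = y 6F ≐ s *′ s +′ -′ y 0F +′ -′ y 3F ∧′ y 7F ≐ s *′ (y 0F +′ -′ y 6F) +′ -′ y 1F

  isO isAffine point : (i j k : Fin 11) → Formula 11
  isO i j k = x i ≐ 0′ ∧′ x j ≐ 0′ ∧′ x k ≐ 0′
  isAffine i j k = x k ≐ 1′ ∧′ x j *′ x j ≐ x i *′ x i *′ x i +′ x 9F *′ x i +′ x (suc 9F)
  point i j k = isO i j k ∨′ isAffine i j k

  same : (i j k i′ j′ k′ : Fin 11) → Formula 11
  same i j k i′ j′ k′ = x i ≐ x i′ ∧′ x j ≐ x j′ ∧′ x k ≐ x k′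

module EllipticGraph {ℓ} (M : Structure ℓ) (A B : ∣ M ∣) where
  open Structure M using (0#; 1#)

  encode : Point M A B → Vec ∣ M ∣ 3
  encode O              = 0# ∷ 0# ∷ 0# ∷ []
  encode (affine x y _) = x ∷ y ∷ 1# ∷ []

  encode-cong : ∀ {P Q} → _≈ᴾ_ M A B P Q → encode P ≡ encode Q
  encode-cong {O}            {O}              e    = refl
  encode-cong {affine x y _} {affine .x .y _} refl = refl

  encode-injective : ¬ 1# ≡ 0# → ∀ {P Q} → encode P ≡ encode Q → _≈ᴾ_ M A B P Q
  encode-injective 1≢0 {O}            {O}            e    = refl
  encode-injective 1≢0 {O}            {affine _ _ _} e    = ⊥-elim (1≢0 (sym (cong (λ v → lookup v 2F) e)))
  encode-injective 1≢0 {affine _ _ _} {O}            e    = ⊥-elim (1≢0 (cong (λ v → lookup v 2F) e))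
  encode-injective 1≢0 {affine _ _ _} {affine _ _ _} refl = refl

  triple : Point M A B → Point M A B → Point M A B → Vec ∣ M ∣ 9
  triple P Q R = encode P ++ (encode Q ++ encode R)

  complete : ∀ {P Q R} → ChordTangent M A B P Q R →
    M ⊨ chordTangentFormula [ triple P Q R ++ (A ∷ B ∷ []) ]
  complete (identityˡ {O} {O} e) = inj₁ ((refl , refl , refl) , inj₁ (refl , refl , refl) , refl , refl , refl)
  complete (identityˡ {affine x y c} {affine .x .y _} refl) =
    inj₁ ((refl , refl , refl) , inj₂ (refl , c) , refl , refl , refl)
  complete (identityʳ {O} {O} e) = inj₂ (inj₁ ((refl , refl , refl) , inj₁ (refl , refl , refl) , refl , refl , refl))
  complete (identityʳ {affine x y c} {affine .x .y _} refl) =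
    inj₂ (inj₁ ((refl , refl , refl) , inj₂ (refl , c) , refl , refl , refl))
  complete (opposite {e₁ = c₁} {c₂} e f) =
    inj₂ (inj₂ (inj₁ ((refl , c₁) , (refl , c₂) , (refl , refl , refl) , e , f)))
  complete (chord {e₁ = c₁} {c₂} {c₃} s x≢ slope e f) =
    inj₂ (inj₂ (inj₂ (inj₁ ((refl , c₁) , (refl , c₂) , (refl , c₃) ,
      s , (λ z → Level.lift (x≢ z)) , slope , e , f))))
  complete (tangent {e₁ = c₁} {c₂} {c₃} s x≡ y≡ y≢ slope e f) =
    inj₂ (inj₂ (inj₂ (inj₂ ((refl , c₁) , (refl , c₂) , (refl , c₃) ,
      s , x≡ , y≡ , (λ z → Level.lift (y≢ z)) , slope , e , f))))

  sound : ∀ v → M ⊨ chordTangentFormula [ v ++ (A ∷ B ∷ []) ] →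
    ∃[ P ] ∃[ Q ] ∃[ R ] ChordTangent M A B P Q R × v ≡ triple P Q R
  sound (_ ∷ _ ∷ _ ∷ _ ∷ _ ∷ _ ∷ _ ∷ _ ∷ _ ∷ []) = λ
    { (inj₁ ((refl , refl , refl) , inj₁ (refl , refl , refl) , refl , refl , refl)) →
        O , O , O , identityˡ refl , refl
    ; (inj₁ ((refl , refl , refl) , inj₂ (refl , c) , refl , refl , refl)) →
        O , affine _ _ c , affine _ _ c , identityˡ refl , refl
    ; (inj₂ (inj₁ ((refl , refl , refl) , inj₁ (refl , refl , refl) , refl , refl , refl))) →
        O , O , O , identityʳ refl , refl
    ; (inj₂ (inj₁ ((refl , refl , refl) , inj₂ (refl , c) , refl , refl , refl))) →
        affine _ _ c , O , affine _ _ c , identityʳ refl , refl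
    ; (inj₂ (inj₂ (inj₁ ((refl , c₁) , (refl , c₂) , (refl , refl , refl) , e , f)))) →
        affine _ _ c₁ , affine _ _ c₂ , O , opposite e f , refl
    ; (inj₂ (inj₂ (inj₂ (inj₁ ((refl , c₁) , (refl , c₂) , (refl , c₃) , s , x≢ , slope , e , f))))) →
        affine _ _ c₁ , affine _ _ c₂ , affine _ _ c₃ , chord s (λ z → lower (x≢ z)) slope e f , refl
    ; (inj₂ (inj₂ (inj₂ (inj₂ ((refl , c₁) , (refl , c₂) , (refl , c₃) , s , x≡ , y≡ , y≢ , slope , e , f))))) →
        affine _ _ c₁ , affine _ _ c₂ , affine _ _ c₃ , tangent s x≡ y≡ (λ z → lower (y≢ z)) slope e f , refl }

theorem5p1 : ∀ {ℓ} (κ : Set ℓ) → Inaccessible κ →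
    (*ℚ : Structure ℓ) (th : *ℚ ⊨Thℚ) → Saturated *ℚ → (∣ *ℚ ∣ ↔ κ) →
    (Z : Formula 1) (defZ : Definesℤ Z) →
    let open NonstandardIntegers *ℚ th Z defZ in
    ((A : DefinableAbelianGroup *ℚ) →
    ModuleExtension (DefinableAbelianGroup.abelianGroup A))
    ×
    ((A B : ∣ *ℚ ∣) → Nonsingular *ℚ A B →
    Σ (EllipticGroup *ℚ A B) λ E →
    ModuleExtension (EllipticGroup.abelianGroup E))
theorem5p1 κ _ *ℚ th _ _ Z defZ = definable , elliptic
  where
  open NonstandardIntegers *ℚ th Z defZ using (ModuleExtension)
  open ModelField *ℚ th

  definable : (A : DefinableAbelianGroup *ℚ) → ModuleExtension (DefinableAbelianGroup.abelianGroup A)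
  definable A = DefinableAddition.moduleExtension *ℚ th Z defZ abelianGroup
    (proj₁ (proj₂ graph-definable)) (proj₁ (proj₂ (proj₂ graph-definable)))
    proj₁ (λ e → e) (λ e → e) (proj₂ (proj₂ (proj₂ graph-definable)))
    where open DefinableAbelianGroup A

  elliptic : (A B : ∣ *ℚ ∣) → Nonsingular *ℚ A B →
    Σ (EllipticGroup *ℚ A B) λ E → ModuleExtension (EllipticGroup.abelianGroup E)
  elliptic A B nonsingular = ellipticGroup ,
    DefinableAddition.moduleExtension *ℚ th Z defZ (EllipticGroup.abelianGroup ellipticGroup)
      chordTangentFormula (A ∷ B ∷ []) encode
      (λ {P} {Q} → encode-cong {P} {Q}) (λ {P} {Q} → encode-injective (IsDecidableField.1≉0 isField) {P} {Q})
      λ v → mk⇔ to (from v)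
    where
    open EllipticCurve *ℚ ring isField x+x≡0⇒x≡0 A B nonsingular
    open EllipticGroup ellipticGroup using (_⊕_; chordTangent)
    open EllipticGraph *ℚ A B

    to : ∀ {v} → (∃[ P ] ∃[ Q ] v ≡ triple P Q (P ⊕ Q)) → *ℚ ⊨ chordTangentFormula [ v ++ (A ∷ B ∷ []) ]
    to (P , Q , refl) = complete (chordTangent P Q)

    from : ∀ v → *ℚ ⊨ chordTangentFormula [ v ++ (A ∷ B ∷ []) ] → ∃[ P ] ∃[ Q ] v ≡ triple P Q (P ⊕ Q)
    -- The formula provides some sum R of P and Q; uniqueness of the chord-tangent sum identifies it
    -- with `P ⊕ Q`.
    from v p = let (P , Q , R , ct , e) = sound v p in P , Q ,
      trans e (cong (λ w → encode P ++ (encode Q ++ w))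
        (encode-cong (chordTangent-cong {P} {P} {Q} {Q} refl refl ct (chordTangent P Q))))
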